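{- Let $G$ be a maximal planar graph on $n\ge 7$ vertices and let $f:E(G)\to\{ -1,1\}$ be such that $\min\{e(-1),e(1)\}\ge 3\lfloor\frac{n-1}{2}\rfloor-5$. Then $G$ contains a spanning tree $T$ with $|f(T)|\le 1$ (zero-sum or almost zero-sum). Moreover, the bound is sharp: for every $n\ge 7$ there exist a maximal planar graph $G$ on $n$ vertices and a colouring $f:E(G)\to\{ -1,1\}$ with $\min\{e(-1),e(1)\}=3\lfloor\frac{n-1}{2}\rfloor-6$ such that no spanning tree $T$ of $G$ has $|f(T)|\le 1$.
   Context: A maximal planar graph is a planar graph to which no edge can be added while preserving planarity. For $f:E(G)\to\{ -1,1\}$ and a subgraph $H$, $f(H)=\sum_{e\in E(H)}f(e)$; $e(-1)$ and $e(1)$ denote the numbers of edges coloured $-1$ and $1$ respectively. -}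

module Defs where

open import Data.Bool using (Bool; true; false; _∧_; _∨_; not; if_then_else_)
open import Data.Nat using (ℕ; zero; suc; _+_; _*_; _≤_; _<_; _≤ᵇ_; _<ᵇ_)
open import Data.Fin using (Fin; toℕ; _≟_)
open import Data.Integer as ℤ using (ℤ)
open import Data.List using (List; []; _∷_; _∷ʳ_; length; map; allFin; upTo; foldr)
open import Data.Nat.ListAction using (sum)
open import Data.Bool.ListAction using (all; any)
open import Data.List.Relation.Unary.Linked using (Linked)
open import Data.List.Relation.Unary.Unique.Propositional using (Unique)
open import Data.Sign using (Sign) renaming (_≟_ to _≟ₛ_)
open import Data.Product using (Σ; ∃; _×_; _,_)
open import Relation.Binary.PropositionalEquality using (_≡_; _≢_)
open import Relation.Nullary using (¬_)
open import Relation.Nullary.Decidable using (⌊_⌋)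

Adj : ℕ → Set
Adj n = Fin n → Fin n → Bool

SimpleGraph : ∀ {n} → Adj n → Set
SimpleGraph {n} A = (∀ u v → A u v ≡ A v u) × (∀ v → A v v ≡ false)

count : ∀ {n} → (Fin n → Bool) → ℕ
count {n} p = sum (map (λ i → if p i then 1 else 0) (allFin n))

countPairs : ∀ {n} → (Fin n → Fin n → Bool) → ℕ
countPairs {n} p = sum (map (λ u → count (λ v → (toℕ u <ᵇ toℕ v) ∧ p u v)) (allFin n))

#edges : ∀ {n} → Adj n → ℕ
#edges A = countPairs A

data Reach {n} (A : Adj n) : Fin n → Fin n → Set where
  here  : ∀ {v} → Reach A v v
  there : ∀ {u w v} → A u w ≡ true → Reach A w v → Reach A u v

Connected : ∀ {n} → Adj n → Set
Connected A = ∀ u v → Reach A u v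

reachB : ∀ {n} → Adj n → ℕ → Fin n → Fin n → Bool
reachB A zero    u v = ⌊ u ≟ v ⌋
reachB {n} A (suc k) u v = reachB A k u v ∨ any (λ w → A u w ∧ reachB A k w v) (allFin n)

-- number of connected components: vertices that are the least vertex
-- (w.r.t. toℕ) of their component
#components : ∀ {n} → Adj n → ℕ
#components {n} A = count (λ v → all (λ w → not ((toℕ w <ᵇ toℕ v) ∧ reachB A n w v)) (allFin n))

#isolated : ∀ {n} → Adj n → ℕ
#isolated {n} A = count (λ v → all (λ w → not (A v w)) (allFin n))

IsCycle : ∀ {n} → Adj n → List (Fin n) → Set
IsCycle A [] = Data.Empty.⊥
  where import Data.Empty
IsCycle A (x ∷ ys) = (2 ≤ length ys) × Unique (x ∷ ys)
                   × Linked (λ a b → A a b ≡ true) ((x ∷ ys) ∷ʳ x)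

Acyclic : ∀ {n} → Adj n → Set
Acyclic A = ∀ cs → ¬ IsCycle A cs

SpanningTree : ∀ {n} → Adj n → Adj n → Set
SpanningTree A T = SimpleGraph T × (∀ u v → T u v ≡ true → A u v ≡ true)
                 × Connected T × Acyclic T

iter : ∀ {X : Set} → (X → X) → ℕ → X → X
iter f zero    x = x
iter f (suc k) x = f (iter f k x)

IsRotation : ∀ {n} → Adj n → (Fin n → Fin n → Fin n) → Set
IsRotation A ρ = ∀ v →
    (∀ u → A v u ≡ true → A v (ρ v u) ≡ true)
  × (∀ u w → A v u ≡ true → A v w ≡ true → ρ v u ≡ ρ v w → u ≡ w)
  × (∀ u w → A v u ≡ true → A v w ≡ true → ∃ λ k → iter (ρ v) k u ≡ w)

Dart : ℕ → Set
Dart n = Fin n × Fin n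

faceStep : ∀ {n} → (Fin n → Fin n → Fin n) → Dart n → Dart n
faceStep ρ (u , v) = (v , ρ v u)

dartCode : ∀ {n} → Dart n → ℕ
dartCode {n} (u , v) = toℕ u * n + toℕ v

-- number of faces = number of orbits of the face-tracing permutation on
-- darts (each orbit counted at its least dart; orbits have size ≤ n*n)
#faces : ∀ {n} → Adj n → (Fin n → Fin n → Fin n) → ℕ
#faces {n} A ρ = sum (map (λ u → count (λ v → A u v ∧
    all (λ k → dartCode (u , v) ≤ᵇ dartCode (iter (faceStep ρ) k (u , v))) (upTo (n * n)))) (allFin n))

-- planar: there is a rotation system of Euler genus 0, i.e.
-- V - E + F = 2C, where isolated vertices each contribute one face
Planar : ∀ {n} → Adj n → Set
Planar {n} A = Σ (Fin n → Fin n → Fin n) λ ρ → IsRotation A ρ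
  × n + (#faces A ρ + #isolated A) ≡ #edges A + 2 * #components A

addEdge : ∀ {n} → Adj n → Fin n → Fin n → Adj n
addEdge A u v x y = A x y ∨ ((⌊ x ≟ u ⌋ ∧ ⌊ y ≟ v ⌋) ∨ (⌊ x ≟ v ⌋ ∧ ⌊ y ≟ u ⌋))

MaximalPlanar : ∀ {n} → Adj n → Set
MaximalPlanar A = SimpleGraph A × Planar A
  × (∀ u v → u ≢ v → A u v ≡ false → ¬ Planar (addEdge A u v))

Colouring : ℕ → Set
Colouring n = Fin n → Fin n → Sign

SymColouring : ∀ {n} → Colouring n → Set
SymColouring f = ∀ u v → f u v ≡ f v u

eCount : ∀ {n} → Adj n → Colouring n → Sign → ℕ
eCount A f s = countPairs (λ u v → A u v ∧ ⌊ f u v ≟ₛ s ⌋)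

signℤ : Sign → ℤ
signℤ Sign.- = ℤ.-[1+ 0 ]
signℤ Sign.+ = ℤ.+ 1

fSum : ∀ {n} → Colouring n → Adj n → ℤ
fSum {n} f H = foldr ℤ._+_ (ℤ.+ 0) (map (λ u → foldr ℤ._+_ (ℤ.+ 0)
    (map (λ v → if (toℕ u <ᵇ toℕ v) ∧ H u v then signℤ (f u v) else ℤ.+ 0) (allFin n))) (allFin n))

{-# OPTIONS --safe #-}
-- By matroid exchange a spanning tree with |f(T)| ≤ 1 exists as soon as both colour classes have rank at
-- least m = ⌊(n-1)/2⌋, and a planar graph of rank r ≥ 2 has at most 3r - 3 edges; so a class with at least
-- 3m - 5 edges has rank at least m.
--
-- Planarity is only given through a rotation system, so the edge bound for a subgraph H is derived from
-- permutations: the boundary walks of H are the orbits of a permutation of all darts of the surface, and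
-- inserting an edge uv composes that permutation with the transposition of (u , v) and (v , u). Such a
-- transposition changes the number of orbits by at most one, and it joins two orbits if uv is a bridge;
-- hence deleting edges never increases the genus. The same calculation, applied to a rotation system
-- extended by one edge, shows that a planar graph stays planar when two components are joined by an edge,
-- so that maximal planar graphs are connected.
--
-- Sharpness: colour a triangulated subgraph on m vertices of a stacked triangulation with +1 and the rest
-- with -1. A forest has at most m - 1 edges of the first kind.
module Submission where

open import Defs
open import Data.Bool using (Bool; true; false; _∧_; _∨_; not; if_then_else_)
open import Data.Bool.ListAction using (all; any)
open import Data.Bool.Properties using (∧-comm) renaming (_≟_ to _≟ᵇ_)
open import Data.Empty using (⊥; ⊥-elim)
open import Data.Fin using (Fin; toℕ; fromℕ<; zero; suc; combine; _≟_)
open import Data.Fin.Properties using (toℕ<n; toℕ-injective; toℕ-fromℕ<; fromℕ<-injective; pigeonhole; any?; toℕ-combine; combine-injective)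
open import Data.Integer as ℤ using (ℤ; ∣_∣)
open import Data.Integer.Properties using (∣⊖∣-≤; ∣m⊖n∣≡∣n⊖m∣; m-n≡m⊖n)
open import Data.Integer.Solver using () renaming (module +-*-Solver to ℤ-Solver)
open import Data.List using (List; []; _∷_; _++_; _∷ʳ_; length; map; allFin; upTo; foldr; cartesianProduct)
import Data.List.Membership.DecPropositional
open import Data.List.Membership.Propositional using (_∈_; _∉_)
open import Data.List.Membership.Propositional.Properties using (∈-allFin; ∈-cartesianProduct⁺; ∈-upTo⁺)
open import Data.List.Properties using (length-tabulate)
open import Data.List.Relation.Unary.All using (All; []; _∷_) renaming (lookup to All-lookup)
open import Data.List.Relation.Unary.All.Properties using (¬Any⇒All¬)
open import Data.List.Relation.Unary.AllPairs using ([]; _∷_)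
open import Data.List.Relation.Unary.Any using (here; there)
open import Data.List.Relation.Unary.Linked using (Linked; []; [-]; _∷_)
open import Data.List.Relation.Unary.Unique.Propositional using (Unique)
open import Data.List.Relation.Unary.Unique.Propositional.Properties using (allFin⁺; cartesianProduct⁺)
open import Data.Nat using (ℕ; zero; suc; _+_; _*_; _∸_; _/_; _⊓_; _≤_; _<_; z≤n; s≤s; _≤?_; _<?_; _≤ᵇ_; _<ᵇ_; _≡ᵇ_)
open import Data.Nat.DivMod using (_%_; m≡m%n+[m/n]*n; m%n<n)
open import Data.Nat.ListAction using (sum)
open import Data.Nat.Properties
  using ( ≤-refl; ≤-reflexive; ≤-trans; ≤-antisym; ≤-total; ≤-pred; <-trans; ≤-<-trans; <-irrefl; <-cmp; <⇒≤; ≮⇒≥; ≰⇒>; ≤∧≢⇒<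
        ; n≤1+n; n<1+n; 1+n≰n; m≤n⇒m≤1+n; m≤n⇒m<n∨m≡n; m≤n⇒∃[o]m+o≡n; m≤m+n; m≤n+m; suc-injective
        ; +-comm; +-assoc; +-identityʳ; +-suc; +-mono-≤; +-monoˡ-≤; +-monoʳ-≤; +-cancelˡ-≤; +-cancelʳ-≤; +-cancelʳ-≡
        ; *-comm; *-distribˡ-+; *-monoʳ-≤; *-cancelˡ-≡; m+n∸n≡m; m+n∸m≡n; m≤n+m∸n; m≤n+o⇒m∸n≤o; m⊓n≤m; m⊓n≤n; m≥n⇒m⊓n≡n )
open import Data.Nat.Solver using (module +-*-Solver)
open import Data.Product using (Σ; ∃; _×_; _,_; proj₁; proj₂)
open import Data.Product.Properties using (≡-dec)
open import Data.Sign using (Sign) renaming (_≟_ to _≟ₛ_)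
open import Data.Sum using (_⊎_; inj₁; inj₂; [_,_]′)
open import Function using (_∘_; case_of_)
open import Relation.Binary using (IsEquivalence; DecidableEquality; tri<; tri≈; tri>)
open import Relation.Binary.PropositionalEquality using (_≡_; _≢_; refl; sym; trans; cong; cong₂; subst)
open import Relation.Nullary using (¬_; Dec; yes; no)
open import Relation.Nullary.Decidable using (⌊_⌋)

-- Booleans and counting

∧-true : ∀ {a b} → a ∧ b ≡ true → a ≡ true × b ≡ true
∧-true {true} {true} _ = refl , refl

∧-intro : ∀ {a b} → a ≡ true → b ≡ true → a ∧ b ≡ true
∧-intro refl refl = refl

∨-true : ∀ {a b} → a ∨ b ≡ true → a ≡ true ⊎ b ≡ true
∨-true {true} _ = inj₁ refl
∨-true {false} e = inj₂ e

∨-introˡ : ∀ {a b} → a ≡ true → a ∨ b ≡ true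
∨-introˡ refl = refl

∨-introʳ : ∀ {a b} → b ≡ true → a ∨ b ≡ true
∨-introʳ {true} _ = refl
∨-introʳ {false} e = e

true≢false : ∀ {a} {P : Set} → a ≡ true → a ≡ false → P
true≢false {true} refl ()

bool-cases : ∀ b → b ≡ true ⊎ b ≡ false
bool-cases true = inj₁ refl
bool-cases false = inj₂ refl

not-true : ∀ {b} → not b ≡ true → b ≡ false
not-true {false} _ = refl

not-false : ∀ {b} → not b ≡ false → b ≡ true
not-false {true} _ = refl

not-intro : ∀ {b} → b ≡ false → not b ≡ true
not-intro refl = refl

≢true : ∀ {b} → ¬ (b ≡ true) → b ≡ false
≢true {true} f = ⊥-elim (f refl)
≢true {false} _ = refl

bool-ext : ∀ {a b} → (a ≡ true → b ≡ true) → (b ≡ true → a ≡ true) → a ≡ b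
bool-ext {true} f _ = sym (f refl)
bool-ext {false} {true} _ g = g refl
bool-ext {false} {false} _ _ = refl

isYes⁻ : {P : Set} (d : Dec P) → ⌊ d ⌋ ≡ true → P
isYes⁻ (yes p) _ = p

isYes⁺ : {P : Set} (d : Dec P) → P → ⌊ d ⌋ ≡ true
isYes⁺ (yes _) _ = refl
isYes⁺ (no ¬p) p = ⊥-elim (¬p p)

isNo⁺ : {P : Set} (d : Dec P) → ¬ P → ⌊ d ⌋ ≡ false
isNo⁺ (yes p) ¬p = ⊥-elim (¬p p)
isNo⁺ (no _) _ = refl

<ᵇ-true : ∀ {m n} → (m <ᵇ n) ≡ true → m < n
<ᵇ-true {zero} {suc n} _ = s≤s z≤n
<ᵇ-true {suc m} {suc n} e = s≤s (<ᵇ-true e)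

<ᵇ-intro : ∀ {m n} → m < n → (m <ᵇ n) ≡ true
<ᵇ-intro {zero} (s≤s _) = refl
<ᵇ-intro {suc m} (s≤s p) = <ᵇ-intro p

≤ᵇ-true : ∀ {m n} → (m ≤ᵇ n) ≡ true → m ≤ n
≤ᵇ-true {zero} _ = z≤n
≤ᵇ-true {suc m} e = <ᵇ-true e

≤ᵇ-false : ∀ {m n} → (m ≤ᵇ n) ≡ false → n < m
≤ᵇ-false {suc m} {zero} _ = s≤s z≤n
≤ᵇ-false {suc zero} {suc n} ()
≤ᵇ-false {suc (suc m)} {suc n} e = s≤s (≤ᵇ-false {suc m} {n} e)

≤ᵇ-intro : ∀ {m n} → m ≤ n → (m ≤ᵇ n) ≡ true
≤ᵇ-intro {zero} _ = refl
≤ᵇ-intro {suc m} p = <ᵇ-intro p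

all-elim : {X : Set} (p : X → Bool) (xs : List X) → all p xs ≡ true → ∀ {x} → x ∈ xs → p x ≡ true
all-elim p (x ∷ xs) e (here refl) = proj₁ (∧-true e)
all-elim p (x ∷ xs) e (there m) = all-elim p xs (proj₂ (∧-true {p x} e)) m

all-intro : {X : Set} (p : X → Bool) (xs : List X) → (∀ {x} → x ∈ xs → p x ≡ true) → all p xs ≡ true
all-intro p [] f = refl
all-intro p (x ∷ xs) f = ∧-intro (f (here refl)) (all-intro p xs (f ∘ there))

all-false : {X : Set} (p : X → Bool) (xs : List X) → all p xs ≡ false → ∃ λ x → x ∈ xs × p x ≡ false
all-false p (x ∷ xs) e with p x in px
... | false = x , here refl , px
... | true with all-false p xs e
...   | y , m , py = y , there m , py

any-elim : {X : Set} (p : X → Bool) (xs : List X) → any p xs ≡ true → ∃ λ x → x ∈ xs × p x ≡ true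
any-elim p (x ∷ xs) e with p x in px
... | true = x , here refl , px
... | false with any-elim p xs e
...   | y , m , py = y , there m , py

any-intro : {X : Set} (p : X → Bool) (xs : List X) → ∀ {x} → x ∈ xs → p x ≡ true → any p xs ≡ true
any-intro p (x ∷ xs) (here refl) e = ∨-introˡ e
any-intro p (x ∷ xs) (there m) e = ∨-introʳ {p x} (any-intro p xs m e)

linear : ∀ {a b} c {l r} → l ≤ r → a + c ≡ l → r ≡ b + c → a ≤ b
linear {a} {b} c l≤r refl refl = +-cancelʳ-≤ c a b l≤r

cnt : {X : Set} → (X → Bool) → List X → ℕ
cnt p xs = sum (map (λ x → if p x then 1 else 0) xs)

cnt-cong : {X : Set} {p q : X → Bool} (xs : List X) → (∀ {x} → x ∈ xs → p x ≡ q x) → cnt p xs ≡ cnt q xs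
cnt-cong [] e = refl
cnt-cong (x ∷ xs) e = cong₂ (λ b k → (if b then 1 else 0) + k) (e (here refl)) (cnt-cong xs (e ∘ there))

cnt-split : {X : Set} (p q : X → Bool) (xs : List X) →
  cnt p xs ≡ cnt (λ x → p x ∧ q x) xs + cnt (λ x → p x ∧ not (q x)) xs
cnt-split p q [] = refl
cnt-split p q (x ∷ xs) with p x | q x
... | false | _ = cnt-split p q xs
... | true | true = cong suc (cnt-split p q xs)
... | true | false = trans (cong suc (cnt-split p q xs)) (sym (+-suc _ _))

cnt-all : {X : Set} (xs : List X) → cnt (λ _ → true) xs ≡ length xs
cnt-all [] = refl
cnt-all (x ∷ xs) = cong suc (cnt-all xs)

record Enum (X : Set) : Set where
  field
    _≡?_ : DecidableEquality X
    elems : List X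
    unique : Unique elems
    complete : ∀ x → x ∈ elems
    size : ℕ
    rank : X → ℕ
    rank-injective : ∀ {x y} → rank x ≡ rank y → x ≡ y
    rank<size : ∀ x → rank x < size

card : {X : Set} → Enum X → (X → Bool) → ℕ
card E p = cnt p (Enum.elems E)

without : {X : Set} → DecidableEquality X → (X → Bool) → X → X → Bool
without _≟_ p a x = p x ∧ not ⌊ x ≟ a ⌋

without-intro : {X : Set} (_≟_ : DecidableEquality X) (p : X → Bool) {a x : X} → p x ≡ true → x ≢ a → without _≟_ p a x ≡ true
without-intro _≟_ p {a} {x} px x≢a = ∧-intro px (not-intro (isNo⁺ (x ≟ a) x≢a))

without-elim : {X : Set} (_≟_ : DecidableEquality X) (p : X → Bool) {a x : X} → without _≟_ p a x ≡ true → p x ≡ true × x ≢ a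
without-elim _≟_ p {a} {x} e with ∧-true e
... | px , ne = px , λ x≡a → true≢false (isYes⁺ (x ≟ a) x≡a) (not-true ne)

without-absent : {X : Set} (_≟_ : DecidableEquality X) (p : X → Bool) {a : X} → p a ≡ false → ∀ x → without _≟_ p a x ≡ p x
without-absent _≟_ p {a} pa x = bool-ext (proj₁ ∘ without-elim _≟_ p) λ px → without-intro _≟_ p px λ { refl → true≢false px pa }

cnt-without-fresh : {X : Set} (_≟_ : DecidableEquality X) (p : X → Bool) (a : X) (xs : List X) → All (a ≢_) xs →
  cnt (without _≟_ p a) xs ≡ cnt p xs
cnt-without-fresh _≟_ p a xs fresh = cnt-cong xs λ {x} m →
  bool-ext (λ e → proj₁ (without-elim _≟_ p e)) (λ px → without-intro _≟_ p px (λ x≡a → All-lookup fresh m (sym x≡a)))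

cnt-without : {X : Set} (_≟_ : DecidableEquality X) (p : X → Bool) {a : X} (xs : List X) → Unique xs → a ∈ xs → p a ≡ true →
  cnt p xs ≡ suc (cnt (without _≟_ p a) xs)
cnt-without _≟_ p {a} (.a ∷ xs) (fresh ∷ u) (here refl) pa with p a | a ≟ a
... | true | yes _ = cong suc (sym (cnt-without-fresh _≟_ p a xs fresh))
... | true | no ne = ⊥-elim (ne refl)
cnt-without _≟_ p {a} (x ∷ xs) (fresh ∷ u) (there m) pa with x ≟ a
... | yes refl = ⊥-elim (All-lookup fresh m refl)
... | no _ with p x
...   | true = cong suc (cnt-without _≟_ p xs u m pa)
...   | false = cnt-without _≟_ p xs u m pa

cnt-drop : {X : Set} (_≟_ : DecidableEquality X) (p : X → Bool) {a : X} (xs : List X) → a ∈ xs → p a ≡ true →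
  suc (cnt (without _≟_ p a) xs) ≤ cnt p xs
cnt-drop _≟_ p {a} (.a ∷ xs) (here refl) pa with p a | a ≟ a
... | true | yes _ = s≤s (mono xs)
  where
  mono : ∀ ys → cnt (without _≟_ p a) ys ≤ cnt p ys
  mono [] = z≤n
  mono (y ∷ ys) with p y | y ≟ a
  ... | true | yes _ = m≤n⇒m≤1+n (mono ys)
  ... | true | no _ = s≤s (mono ys)
  ... | false | _ = mono ys
... | true | no ne = ⊥-elim (ne refl)
cnt-drop _≟_ p {a} (x ∷ xs) (there m) pa with p x | x ≟ a
... | true | yes _ = m≤n⇒m≤1+n (cnt-drop _≟_ p xs m pa)
... | true | no _ = s≤s (cnt-drop _≟_ p xs m pa)
... | false | _ = cnt-drop _≟_ p xs m pa

cnt-inject : {X Y : Set} (_≟_ : DecidableEquality Y) {p : X → Bool} {q : Y → Bool} (xs : List X) (ys : List Y) (S : X → Y → Set) →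
  Unique xs →
  (∀ {x} → p x ≡ true → ∃ λ y → y ∈ ys × q y ≡ true × S x y) →
  (∀ {x x' y} → p x ≡ true → p x' ≡ true → S x y → S x' y → x ≡ x') →
  cnt p xs ≤ cnt q ys
cnt-inject {X} {Y} _≟_ {p} xs ys S u f inj = go xs u λ _ → f
  where
  go : ∀ {q : Y → Bool} (xs : List X) → Unique xs → (∀ {x} → x ∈ xs → p x ≡ true → ∃ λ y → y ∈ ys × q y ≡ true × S x y) →
    cnt p xs ≤ cnt q ys
  go [] u f = z≤n
  go {q} (x ∷ xs) (fresh ∷ u) f with p x in px
  ... | false = go xs u (f ∘ there)
  ... | true with f (here refl) px
  ...   | y , y∈ , qy , sxy = ≤-trans (s≤s (go xs u f')) (cnt-drop _≟_ q ys y∈ qy)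
    where
    f' : ∀ {x'} → x' ∈ xs → p x' ≡ true → ∃ λ y' → y' ∈ ys × without _≟_ q y y' ≡ true × S x' y'
    f' {x'} m px' with f (there m) px'
    ... | y' , y'∈ , qy' , s' = y' , y'∈ , without-intro _≟_ q qy' (λ { refl → All-lookup fresh m (inj px px' sxy s') }) , s'

card-inject : {X Y : Set} (E : Enum X) (E' : Enum Y) {p : X → Bool} {q : Y → Bool} (S : X → Y → Set) →
  (∀ {x} → p x ≡ true → ∃ λ y → q y ≡ true × S x y) →
  (∀ {x x' y} → p x ≡ true → p x' ≡ true → S x y → S x' y → x ≡ x') →
  card E p ≤ card E' q
card-inject E E' S f inj = cnt-inject (Enum._≡?_ E') (Enum.elems E) (Enum.elems E') S (Enum.unique E)
  (λ px → let y , r = f px in y , Enum.complete E' y , r) inj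

card-mono : {X : Set} (E : Enum X) {p q : X → Bool} → (∀ {x} → p x ≡ true → q x ≡ true) → card E p ≤ card E q
card-mono E f = card-inject E E _≡_ (λ {x} px → x , f px , refl) λ { _ _ refl refl → refl }

card-cong : {X : Set} (E : Enum X) {p q : X → Bool} → (∀ x → p x ≡ q x) → card E p ≡ card E q
card-cong E e = cnt-cong (Enum.elems E) λ {x} _ → e x

card-without : {X : Set} (E : Enum X) (p : X → Bool) {a : X} → p a ≡ true → card E p ≡ suc (card E (without (Enum._≡?_ E) p a))
card-without E p {a} pa = cnt-without (Enum._≡?_ E) p (Enum.elems E) (Enum.unique E) (Enum.complete E a) pa

card-insert : {X : Set} (E : Enum X) (p q : X → Bool) (a : X) → p a ≡ false → q a ≡ true → (∀ x → x ≢ a → q x ≡ p x) →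
  card E q ≡ suc (card E p)
card-insert E p q a pa qa e = trans (card-without E q qa) (cong suc (card-cong E same))
  where
  open Enum E
  same : ∀ x → without _≡?_ q a x ≡ p x
  same x with x ≡? a
  ... | yes refl = trans (bool-ext (λ w → proj₂ (∧-true {q a} w)) λ ()) (sym pa)
  ... | no ne = trans (bool-ext (λ w → proj₁ (∧-true w)) λ w → ∧-intro w refl) (e x ne)

card-witness : {X : Set} (E : Enum X) (p : X → Bool) → 1 ≤ card E p → ∃ λ x → p x ≡ true
card-witness E p = go (Enum.elems E)
  where
  go : ∀ xs → 1 ≤ cnt p xs → ∃ λ x → p x ≡ true
  go (x ∷ xs) h with p x in px
  ... | true = x , px
  ... | false = go xs h

card-positive : {X : Set} (E : Enum X) (p : X → Bool) {a : X} → p a ≡ true → 1 ≤ card E p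
card-positive E p pa = subst (1 ≤_) (sym (card-without E p pa)) (s≤s z≤n)

vertices : ∀ n → Enum (Fin n)
vertices n = record
  { _≡?_ = _≟_ ; elems = allFin n ; unique = allFin⁺ n ; complete = ∈-allFin
  ; size = n ; rank = toℕ ; rank-injective = toℕ-injective ; rank<size = toℕ<n }

-- Equivalence classes and orbits of permutations

cnt-++ : {X : Set} (p : X → Bool) (xs ys : List X) → cnt p (xs ++ ys) ≡ cnt p xs + cnt p ys
cnt-++ p [] ys = refl
cnt-++ p (x ∷ xs) ys = trans (cong (_ +_) (cnt-++ p xs ys)) (sym (+-assoc _ (cnt p xs) (cnt p ys)))

cnt-map : {X Y : Set} (p : Y → Bool) (f : X → Y) (xs : List X) → cnt p (map f xs) ≡ cnt (p ∘ f) xs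
cnt-map p f [] = refl
cnt-map p f (x ∷ xs) = cong (_ +_) (cnt-map p f xs)

cnt-product : {X Y : Set} (p : X × Y → Bool) (xs : List X) (ys : List Y) →
  cnt p (cartesianProduct xs ys) ≡ sum (map (λ x → cnt (λ y → p (x , y)) ys) xs)
cnt-product p [] ys = refl
cnt-product p (x ∷ xs) ys = trans (cnt-++ p (map (x ,_) ys) (cartesianProduct xs ys))
  (cong₂ _+_ (cnt-map p (x ,_) ys) (cnt-product p xs ys))

darts : ∀ n → Enum (Dart n)
darts n = record
  { _≡?_ = ≡-dec _≟_ _≟_
  ; elems = cartesianProduct (allFin n) (allFin n)
  ; unique = cartesianProduct⁺ (allFin⁺ n) (allFin⁺ n)
  ; complete = λ { (u , v) → ∈-cartesianProduct⁺ (∈-allFin u) (∈-allFin v) }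
  ; size = n * n
  ; rank = dartCode
  ; rank-injective = λ { {u , v} {u' , v'} e →
      let i , j = combine-injective u v u' v' (toℕ-injective (trans (code u v) (trans e (sym (code u' v'))))) in cong₂ _,_ i j }
  ; rank<size = λ { (u , v) → subst (_< n * n) (code u v) (toℕ<n (combine u v)) } }
  where
  code : ∀ u v → toℕ (combine u v) ≡ dartCode (u , v)
  code u v = trans (toℕ-combine u v) (cong (_+ toℕ v) (*-comm n (toℕ u)))

record Transversal {X : Set} (R : X → X → Set) (t : X → Bool) : Set where
  field
    indep : ∀ {x y} → t x ≡ true → t y ≡ true → R x y → x ≡ y
    rep : ∀ x → ∃ λ y → t y ≡ true × R x y

Classes : {X : Set} → Enum X → (X → X → Set) → ℕ → Set
Classes E R k = ∃ λ t → Transversal R t × card E t ≡ k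

independent-≤ : {X : Set} (E : Enum X) {R : X → X → Set} → IsEquivalence R → (p : X → Bool) →
  (∀ {x y} → p x ≡ true → p y ≡ true → R x y → x ≡ y) → ∀ {k} → Classes E R k → card E p ≤ k
independent-≤ E {R} eq p ind (t , tr , refl) = card-inject E E R (λ {x} _ → Transversal.rep tr x)
  λ px px' r r' → ind px px' (IsEquivalence.trans eq r (IsEquivalence.sym eq r'))

classes-≤ : {X : Set} (E : Enum X) {R R' : X → X → Set} → IsEquivalence R' → (∀ {x y} → R' x y → R x y) →
  ∀ {k k'} → Classes E R k → Classes E R' k' → k ≤ k'
classes-≤ E eq sub (t , tr , refl) c' = independent-≤ E eq t (λ tx ty r → Transversal.indep tr tx ty (sub r)) c'

classes-unique : {X : Set} (E : Enum X) {R : X → X → Set} → IsEquivalence R → ∀ {k k'} → Classes E R k → Classes E R k' → k ≡ k'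
classes-unique E eq c c' = ≤-antisym (classes-≤ E eq (λ r → r) c c') (classes-≤ E eq (λ r → r) c' c)

classes-cong : {X : Set} (E : Enum X) {R R' : X → X → Set} → (∀ {x y} → R x y → R' x y) → (∀ {x y} → R' x y → R x y) →
  ∀ {k} → Classes E R k → Classes E R' k
classes-cong E to from (t , tr , e) = t , record
  { indep = λ tx ty r → Transversal.indep tr tx ty (from r)
  ; rep = λ x → let y , ty , r = Transversal.rep tr x in y , ty , to r } , e

classes-dec : {X : Set} (E : Enum X) {R : X → X → Set} → IsEquivalence R → ∀ {k} → Classes E R k → ∀ x y → Dec (R x y)
classes-dec E eq (t , tr , _) x y with Transversal.rep tr x | Transversal.rep tr y
... | x' , tx' , rx | y' , ty' , ry with Enum._≡?_ E x' y'
...   | yes refl = yes (IsEquivalence.trans eq rx (IsEquivalence.sym eq ry))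
...   | no ne = no λ r → ne (Transversal.indep tr tx' ty'
          (IsEquivalence.trans eq (IsEquivalence.sym eq rx) (IsEquivalence.trans eq r ry)))

Merge : {X : Set} → (X → X → Set) → X → X → X → X → Set
Merge R a b x y = R x y ⊎ ((R x a × R y b) ⊎ (R x b × R y a))

merge-equiv : {X : Set} {R : X → X → Set} → IsEquivalence R → ∀ a b → IsEquivalence (Merge R a b)
merge-equiv {X} {R} eq a b = record { refl = inj₁ E.refl ; sym = symm ; trans = tran }
  where
  module E = IsEquivalence eq
  symm : ∀ {x y} → Merge R a b x y → Merge R a b y x
  symm (inj₁ r) = inj₁ (E.sym r)
  symm (inj₂ (inj₁ (p , q))) = inj₂ (inj₂ (q , p))
  symm (inj₂ (inj₂ (p , q))) = inj₂ (inj₁ (q , p))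
  tran : ∀ {x y z} → Merge R a b x y → Merge R a b y z → Merge R a b x z
  tran (inj₁ r) (inj₁ s) = inj₁ (E.trans r s)
  tran (inj₁ r) (inj₂ (inj₁ (p , q))) = inj₂ (inj₁ (E.trans r p , q))
  tran (inj₁ r) (inj₂ (inj₂ (p , q))) = inj₂ (inj₂ (E.trans r p , q))
  tran (inj₂ (inj₁ (p , q))) (inj₁ s) = inj₂ (inj₁ (p , E.trans (E.sym s) q))
  tran (inj₂ (inj₂ (p , q))) (inj₁ s) = inj₂ (inj₂ (p , E.trans (E.sym s) q))
  tran (inj₂ (inj₁ (p , q))) (inj₂ (inj₁ (p' , q'))) = inj₁ (E.trans p (E.trans (E.sym p') (E.trans q (E.sym q'))))
  tran (inj₂ (inj₁ (p , q))) (inj₂ (inj₂ (p' , q'))) = inj₁ (E.trans p (E.sym q'))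
  tran (inj₂ (inj₂ (p , q))) (inj₂ (inj₁ (p' , q'))) = inj₁ (E.trans p (E.sym q'))
  tran (inj₂ (inj₂ (p , q))) (inj₂ (inj₂ (p' , q'))) = inj₁ (E.trans p (E.trans (E.sym p') (E.trans q (E.sym q'))))

merge-classes : {X : Set} (E : Enum X) {R : X → X → Set} → IsEquivalence R → ∀ {a b} → ¬ R a b →
  ∀ {k} → Classes E R k → ∃ λ k' → k ≡ suc k' × Classes E (Merge R a b) k'
merge-classes {X} E {R} eq {a} {b} a≁b (t , tr , refl) with Transversal.rep tr b
... | rb , trb , b~rb = card E t' , card-without E t trb , t' , record { indep = ind ; rep = rep' } , refl
  where
  open Enum E
  module Q = IsEquivalence eq
  open Transversal tr
  t' : X → Bool
  t' = without _≡?_ t rb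
  ind : ∀ {x y} → t' x ≡ true → t' y ≡ true → Merge R a b x y → x ≡ y
  ind tx ty m with without-elim _≡?_ t tx | without-elim _≡?_ t ty | m
  ... | px , _ | py , _ | inj₁ r = indep px py r
  ... | _ | py , y≢ | inj₂ (inj₁ (_ , q)) = ⊥-elim (y≢ (indep py trb (Q.trans q b~rb)))
  ... | px , x≢ | _ | inj₂ (inj₂ (p , _)) = ⊥-elim (x≢ (indep px trb (Q.trans p b~rb)))
  rep' : ∀ x → ∃ λ y → t' y ≡ true × Merge R a b x y
  rep' x with rep x
  ... | y , ty , xy with y ≡? rb
  ...   | no y≢ = y , without-intro _≡?_ t ty y≢ , inj₁ xy
  ...   | yes refl with rep a
  ...     | ra , tra , a~ra = ra ,
    without-intro _≡?_ t tra (λ { refl → a≁b (Q.trans a~ra (Q.sym b~rb)) }) ,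
    inj₂ (inj₂ (Q.trans xy (Q.sym b~rb) , Q.sym a~ra))

least-transversal : {X : Set} (E : Enum X) (R : X → X → Set) → IsEquivalence R → (t : X → Bool) →
  (∀ {x y} → t x ≡ true → R x y → Enum.rank E x ≤ Enum.rank E y) →
  (∀ {x} → t x ≡ false → ∃ λ y → R x y × Enum.rank E y < Enum.rank E x) → Transversal R t
least-transversal {X} E R eq t least smaller = record
  { indep = λ tx ty r → rank-injective (≤-antisym (least tx r) (least ty (Q.sym r)))
  ; rep = λ x → go (suc (rank x)) x ≤-refl }
  where
  open Enum E
  module Q = IsEquivalence eq
  go : ∀ m x → rank x < m → ∃ λ y → t y ≡ true × R x y
  go (suc m) x (s≤s h) with bool-cases (t x)
  ... | inj₁ tx = x , tx , Q.refl
  ... | inj₂ tx with smaller tx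
  ...   | y , xy , y<x with go m y (≤-trans y<x h)
  ...     | z , tz , yz = z , tz , Q.trans xy yz

Orb : {X : Set} → (X → X) → X → X → Set
Orb f x y = ∃ λ k → iter f k x ≡ y

Injective : {X : Set} → (X → X) → Set
Injective f = ∀ {x y} → f x ≡ f y → x ≡ y

iter-+ : {X : Set} (f : X → X) (a b : ℕ) (x : X) → iter f (a + b) x ≡ iter f a (iter f b x)
iter-+ f zero b x = refl
iter-+ f (suc a) b x = cong f (iter-+ f a b x)

iter-suc : {X : Set} (f : X → X) (k : ℕ) (x : X) → iter f k (f x) ≡ f (iter f k x)
iter-suc f zero x = refl
iter-suc f (suc k) x = cong f (iter-suc f k x)

iter-injective : {X : Set} (f : X → X) → Injective f → ∀ k → Injective (iter f k)
iter-injective f inj zero e = e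
iter-injective f inj (suc k) e = iter-injective f inj k (inj e)

orb-refl : {X : Set} {f : X → X} {x : X} → Orb f x x
orb-refl = 0 , refl

orb-step : {X : Set} {f : X → X} {x y : X} → Orb f x y → Orb f x (f y)
orb-step {f = f} (k , e) = suc k , cong f e

orb-trans : {X : Set} {f : X → X} {x y z : X} → Orb f x y → Orb f y z → Orb f x z
orb-trans {f = f} {x} (j , refl) (k , refl) = k + j , iter-+ f k j x

orb-one : {X : Set} {f : X → X} (x : X) → Orb f x (f x)
orb-one x = 1 , refl

orb-least : {X : Set} (f : X → X) {S : X → Set} {x : X} → S x → (∀ {y} → S y → S (f y)) → ∀ {y} → Orb f x y → S y
orb-least f sx step (zero , refl) = sx
orb-least f {S} sx step (suc k , refl) = step (orb-least f {S} sx step (k , refl))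

period : {X : Set} (E : Enum X) (f : X → X) → Injective f → ∀ x → ∃ λ p → p < Enum.size E × iter f (suc p) x ≡ x
period {X} E f inj x with pigeonhole (n<1+n size) (λ i → fromℕ< (rank<size (iter f (toℕ i) x)))
  where open Enum E
... | i , j , i<j , e with m≤n⇒∃[o]m+o≡n i<j
...   | d , i+d = d , d<size , iter-injective f inj (toℕ i) (trans (sym (iter-+ f (toℕ i) (suc d) x))
          (trans (cong (λ k → iter f k x) (trans (+-suc (toℕ i) d) i+d)) (sym same)))
  where
  open Enum E
  same : iter f (toℕ i) x ≡ iter f (toℕ j) x
  same = rank-injective (fromℕ<-injective _ _ _ _ e)
  d<size : d < size
  d<size = ≤-trans (s≤s (m≤n+m d (toℕ i))) (subst (_≤ size) (sym i+d) (≤-pred (toℕ<n j)))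

orb-bounded : {X : Set} (E : Enum X) (f : X → X) → Injective f → ∀ {x y} → Orb f x y → ∃ λ k → k < Enum.size E × iter f k x ≡ y
orb-bounded E f inj {x} o with period E f inj x
... | p , p<size , back with orb-least f {λ y → ∃ λ k → k ≤ p × iter f k x ≡ y} (0 , z≤n , refl) next o
  where
  next : ∀ {y} → (∃ λ k → k ≤ p × iter f k x ≡ y) → ∃ λ k → k ≤ p × iter f k x ≡ f y
  next (k , k≤p , refl) with m≤n⇒m<n∨m≡n k≤p
  ... | inj₁ k<p = suc k , k<p , refl
  ... | inj₂ refl = 0 , z≤n , sym back
...   | k , k≤p , e = k , ≤-<-trans k≤p p<size , e

orb-back : {X : Set} (E : Enum X) (f : X → X) → Injective f → ∀ x → Orb f (f x) x
orb-back E f inj x with period E f inj x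
... | p , _ , back = p , trans (iter-suc f p x) back

orb-sym : {X : Set} (E : Enum X) (f : X → X) → Injective f → ∀ {x y} → Orb f x y → Orb f y x
orb-sym E f inj {x} = orb-least f {λ y → Orb f y x} orb-refl λ {y} o → orb-trans (orb-back E f inj y) o

orb-equiv : {X : Set} (E : Enum X) (f : X → X) → Injective f → IsEquivalence (Orb f)
orb-equiv E f inj = record { refl = orb-refl ; sym = orb-sym E f inj ; trans = orb-trans }

leastInOrbit : {X : Set} → Enum X → (X → X) → X → Bool
leastInOrbit E f x = all (λ k → Enum.rank E x ≤ᵇ Enum.rank E (iter f k x)) (upTo (Enum.size E))

leastInOrbit-transversal : {X : Set} (E : Enum X) (f : X → X) → Injective f → Transversal (Orb f) (leastInOrbit E f)
leastInOrbit-transversal E f inj = least-transversal E (Orb f) (orb-equiv E f inj) (leastInOrbit E f)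
  (λ {x} tx o → let k , k< , e = orb-bounded E f inj o in
    subst (λ y → rank x ≤ rank y) e (≤ᵇ-true (all-elim _ (upTo size) tx (∈-upTo⁺ k<))))
  (λ {x} fx → let k , _ , e = all-false _ (upTo size) fx in iter f k x , (k , refl) , ≤ᵇ-false e)
  where open Enum E

orbit-classes : {X : Set} (E : Enum X) (f : X → X) → Injective f → ∃ λ k → Classes E (Orb f) k
orbit-classes E f inj = _ , leastInOrbit E f , leastInOrbit-transversal E f inj , refl

-- φ is ψ precomposed with the transposition of a and b.
record Swapped {X : Set} (φ ψ : X → X) (a b : X) : Set where
  field
    at-a : φ a ≡ ψ b
    at-b : φ b ≡ ψ a
    off : ∀ x → x ≢ a → x ≢ b → φ x ≡ ψ x

swapped-sym : {X : Set} {φ ψ : X → X} {a b : X} → Swapped φ ψ a b → Swapped ψ φ a b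
swapped-sym s = record { at-a = sym (Swapped.at-b s) ; at-b = sym (Swapped.at-a s) ; off = λ x p q → sym (Swapped.off s x p q) }

swapped⇒merge : {X : Set} (E : Enum X) {φ ψ : X → X} → Injective ψ → ∀ {a b} → Swapped φ ψ a b →
  ∀ {x y} → Orb φ x y → Merge (Orb ψ) a b x y
swapped⇒merge {X} E {φ} {ψ} inj {a} {b} s {x} = orb-least φ {Merge (Orb ψ) a b x} (inj₁ orb-refl) next
  where
  open Enum E
  module M = IsEquivalence (merge-equiv (orb-equiv E ψ inj) a b)
  next : ∀ {y} → Merge (Orb ψ) a b x y → Merge (Orb ψ) a b x (φ y)
  next {y} m with y ≡? a
  ... | yes refl = subst (Merge (Orb ψ) a b x) (sym (Swapped.at-a s))
        (M.trans m (M.trans (inj₂ (inj₁ (orb-refl , orb-refl))) (inj₁ (orb-one b))))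
  ... | no y≢a with y ≡? b
  ...   | yes refl = subst (Merge (Orb ψ) a b x) (sym (Swapped.at-b s))
          (M.trans m (M.trans (inj₂ (inj₂ (orb-refl , orb-refl))) (inj₁ (orb-one a))))
  ...   | no y≢b = subst (Merge (Orb ψ) a b x) (sym (Swapped.off s y y≢a y≢b)) (M.trans m (inj₁ (orb-one y)))

-- Under φ, the point a is followed by the ψ-cycle through b, which avoids a and hence ends in b.
swapped-joins : {X : Set} (E : Enum X) {φ ψ : X → X} → Injective ψ → ∀ {a b} → Swapped φ ψ a b → ¬ Orb ψ a b → Orb φ a b
swapped-joins E {φ} {ψ} inj {a} {b} s a≁b = finish (orb-least ψ {λ y → Orb ψ b y × (Orb φ a b ⊎ Orb φ a y)}
    (orb-one b , inj₂ (subst (Orb φ a) (Swapped.at-a s) (orb-one a))) next (orb-back E ψ inj b))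
  where
  open Enum E
  finish : (Orb ψ b b × (Orb φ a b ⊎ Orb φ a b)) → Orb φ a b
  finish (_ , inj₁ o) = o
  finish (_ , inj₂ o) = o
  next : ∀ {y} → Orb ψ b y × (Orb φ a b ⊎ Orb φ a y) → Orb ψ b (ψ y) × (Orb φ a b ⊎ Orb φ a (ψ y))
  next (by , inj₁ done) = orb-step by , inj₁ done
  next {y} (by , inj₂ ay) with y ≡? b
  ... | yes refl = orb-step by , inj₁ ay
  ... | no y≢b = orb-step by , inj₂ (subst (Orb φ a) (Swapped.off s y y≢a y≢b) (orb-step ay))
    where
    y≢a : y ≢ a
    y≢a refl = a≁b (orb-sym E ψ inj by)

merge⇒swapped : {X : Set} (E : Enum X) {φ ψ : X → X} → Injective φ → Injective ψ → ∀ {a b} → Swapped φ ψ a b → ¬ Orb ψ a b →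
  ∀ {x y} → Merge (Orb ψ) a b x y → Orb φ x y
merge⇒swapped E {φ} {ψ} injφ injψ {a} {b} s a≁b = go
  where
  open Enum E
  ab : Orb φ a b
  ab = swapped-joins E injψ s a≁b
  ba : Orb φ b a
  ba = orb-sym E φ injφ ab
  incl : ∀ {x y} → Orb ψ x y → Orb φ x y
  incl o with swapped⇒merge E injφ (swapped-sym s) o
  ... | inj₁ r = r
  ... | inj₂ (inj₁ (p , q)) = orb-trans p (orb-trans ab (orb-sym E φ injφ q))
  ... | inj₂ (inj₂ (p , q)) = orb-trans p (orb-trans ba (orb-sym E φ injφ q))
  go : ∀ {x y} → Merge (Orb ψ) a b x y → Orb φ x y
  go (inj₁ r) = incl r
  go (inj₂ (inj₁ (p , q))) = orb-trans (incl p) (orb-trans ab (orb-sym E φ injφ (incl q)))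
  go (inj₂ (inj₂ (p , q))) = orb-trans (incl p) (orb-trans ba (orb-sym E φ injφ (incl q)))

swapped-merges : {X : Set} (E : Enum X) {φ ψ : X → X} → Injective φ → Injective ψ → ∀ {a b} → Swapped φ ψ a b → ¬ Orb ψ a b →
  ∀ {k} → Classes E (Orb ψ) k → ∃ λ k' → k ≡ suc k' × Classes E (Orb φ) k'
swapped-merges E {φ} {ψ} injφ injψ s a≁b c with merge-classes E (orb-equiv E ψ injψ) a≁b c
... | k' , e , c' = k' , e , classes-cong E (merge⇒swapped E injφ injψ s a≁b) (swapped⇒merge E injψ s) c'

swapped-≤ : {X : Set} (E : Enum X) {φ ψ : X → X} → Injective φ → Injective ψ → ∀ {a b} → Swapped φ ψ a b →
  ∀ {k l} → Classes E (Orb φ) k → Classes E (Orb ψ) l → k ≤ suc l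
swapped-≤ E {φ} {ψ} injφ injψ {a} {b} s c d with classes-dec E (orb-equiv E φ injφ) c a b
... | no a≁b with merge-classes E (orb-equiv E φ injφ) a≁b c
...   | k' , refl , c' = s≤s (classes-≤ E (orb-equiv E ψ injψ) (swapped⇒merge E injφ (swapped-sym s)) c' d)
swapped-≤ E {φ} {ψ} injφ injψ {a} {b} s c d | yes ab = m≤n⇒m≤1+n (classes-≤ E (orb-equiv E ψ injψ) (λ o → collapse (swapped⇒merge E injφ (swapped-sym s) o)) c d)
  where
  collapse : ∀ {x y} → Merge (Orb φ) a b x y → Orb φ x y
  collapse (inj₁ r) = r
  collapse (inj₂ (inj₁ (p , q))) = orb-trans p (orb-trans ab (orb-sym E φ injφ q))
  collapse (inj₂ (inj₂ (p , q))) = orb-trans p (orb-trans (orb-sym E φ injφ ab) (orb-sym E φ injφ q))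

swapAt : {X : Set} → DecidableEquality X → (X → X) → X → X → X → X
swapAt _≟_ f a b x = if ⌊ x ≟ a ⌋ then f b else if ⌊ x ≟ b ⌋ then f a else f x

swapAt-swapped : {X : Set} (_≟_ : DecidableEquality X) (f : X → X) (a b : X) → Swapped (swapAt _≟_ f a b) f a b
swapAt-swapped _≟_ f a b = record { at-a = at-a ; at-b = at-b ; off = off }
  where
  at-a : swapAt _≟_ f a b a ≡ f b
  at-a rewrite isYes⁺ (a ≟ a) refl = refl
  at-b : swapAt _≟_ f a b b ≡ f a
  at-b with b ≟ a
  ... | yes refl = refl
  ... | no _ rewrite isYes⁺ (b ≟ b) refl = refl
  off : ∀ x → x ≢ a → x ≢ b → swapAt _≟_ f a b x ≡ f x
  off x x≢a x≢b rewrite isNo⁺ (x ≟ a) x≢a | isNo⁺ (x ≟ b) x≢b = refl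

swapped-injective : {X : Set} (_≟_ : DecidableEquality X) {φ f : X → X} → Injective f → ∀ {a b} → Swapped φ f a b → Injective φ
swapped-injective {X} _≟_ {φ} {f} inj {a} {b} s {x} {y} e = cancel (inj (trans (sym (at x)) (trans e (at y))))
  where
  open Swapped s
  τ : X → X
  τ = swapAt _≟_ (λ z → z) a b
  module T = Swapped (swapAt-swapped _≟_ (λ z → z) a b)
  at : ∀ z → φ z ≡ f (τ z)
  at z with z ≟ a
  ... | yes refl = at-a
  ... | no z≢a with z ≟ b
  ...   | yes refl = at-b
  ...   | no z≢b = off z z≢a z≢b
  ττ : ∀ z → τ (τ z) ≡ z
  ττ z with z ≟ a
  ... | yes refl = T.at-b
  ... | no z≢a with z ≟ b
  ...   | yes refl = T.at-a
  ...   | no z≢b = T.off z z≢a z≢b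
  cancel : τ x ≡ τ y → x ≡ y
  cancel q = trans (sym (ττ x)) (trans (cong τ q) (ττ y))

-- Components of graphs

Symmetric : ∀ {n} → Adj n → Set
Symmetric H = ∀ u v → H u v ≡ H v u

_⊆_ : ∀ {n} → Adj n → Adj n → Set
H ⊆ K = ∀ u v → H u v ≡ true → K u v ≡ true

reach-trans : ∀ {n} {H : Adj n} {u v w} → Reach H u v → Reach H v w → Reach H u w
reach-trans here r = r
reach-trans (there e s) r = there e (reach-trans s r)

reach-edge : ∀ {n} {H : Adj n} {u v} → H u v ≡ true → Reach H u v
reach-edge e = there e here

reach-sym : ∀ {n} {H : Adj n} → Symmetric H → ∀ {u v} → Reach H u v → Reach H v u
reach-sym s here = here
reach-sym s (there {u} {w} e r) = reach-trans (reach-sym s r) (reach-edge (trans (s w u) e))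

reach-mono : ∀ {n} {H K : Adj n} → H ⊆ K → ∀ {u v} → Reach H u v → Reach K u v
reach-mono sub here = here
reach-mono sub (there e r) = there (sub _ _ e) (reach-mono sub r)

reach-equiv : ∀ {n} {H : Adj n} → Symmetric H → IsEquivalence (Reach H)
reach-equiv s = record { refl = here ; sym = reach-sym s ; trans = reach-trans }

data Path {n} (H : Adj n) : Fin n → Fin n → List (Fin n) → Set where
  single : ∀ {v} → Path H v v (v ∷ [])
  step : ∀ {u w v l} → H u w ≡ true → u ∉ l → Path H w v l → Path H u v (u ∷ l)

path-unique : ∀ {n} {H : Adj n} {u v l} → Path H u v l → Unique l
path-unique single = [] ∷ []
path-unique (step _ u∉l p) = ¬Any⇒All¬ _ u∉l ∷ path-unique p

path-suffix : ∀ {n} {H : Adj n} {u v w l} → Path H w v l → u ∈ l → ∃ λ l' → Path H u v l'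
path-suffix single (here refl) = _ , single
path-suffix p@(step _ _ _) (here refl) = _ , p
path-suffix (step _ _ p) (there m) = path-suffix p m

reach⇒path : ∀ {n} {H : Adj n} {u v} → Reach H u v → ∃ λ l → Path H u v l
reach⇒path here = _ , single
reach⇒path {n} (there {u} e r) with reach⇒path r
... | l , p with u ∈? l
  where open Data.List.Membership.DecPropositional (_≟_ {n})
...   | yes m = path-suffix p m
...   | no u∉l = u ∷ l , step e u∉l p

unique-length : ∀ {n} (l : List (Fin n)) → Unique l → length l ≤ n
unique-length {n} l u = subst (_≤ n) (cnt-all l)
  (≤-trans (cnt-inject _≟_ {q = λ _ → true} l (allFin n) _≡_ u (λ {x} _ → x , ∈-allFin x , refl , refl) λ { _ _ refl refl → refl })
    (≤-reflexive (trans (cnt-all (allFin n)) (length-tabulate {n = n} (λ i → i)))))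

reachB-refl : ∀ {n} (H : Adj n) k v → reachB H k v v ≡ true
reachB-refl H zero v = isYes⁺ (v ≟ v) refl
reachB-refl H (suc k) v = ∨-introˡ (reachB-refl H k v)

path⇒reachB : ∀ {n} {H : Adj n} {u v l} k → Path H u v l → length l ≤ k → reachB H k u v ≡ true
path⇒reachB {H = H} k (single {v}) _ = reachB-refl H k v
path⇒reachB {H = H} (suc k) (step {u} {w} {v} e _ p) (s≤s h) =
  ∨-introʳ {reachB H k u v} (any-intro (λ w → H u w ∧ reachB H k w v) (allFin _) (∈-allFin w) (∧-intro e (path⇒reachB k p h)))

reach⇒reachB : ∀ {n} {H : Adj n} {u v} → Reach H u v → reachB H n u v ≡ true
reach⇒reachB {n} r = let l , p = reach⇒path r in path⇒reachB n p (unique-length l (path-unique p))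

reachB⇒reach : ∀ {n} (H : Adj n) k {u v} → reachB H k u v ≡ true → Reach H u v
reachB⇒reach H zero {u} {v} e with isYes⁻ (u ≟ v) e
... | refl = here
reachB⇒reach H (suc k) {u} {v} e with ∨-true {reachB H k u v} e
... | inj₁ e' = reachB⇒reach H k e'
... | inj₂ e' with any-elim (λ w → H u w ∧ reachB H k w v) (allFin _) e'
...   | w , _ , e'' = there (proj₁ (∧-true e'')) (reachB⇒reach H k (proj₂ (∧-true {H u w} e'')))

reach? : ∀ {n} (H : Adj n) u v → Dec (Reach H u v)
reach? {n} H u v with bool-cases (reachB H n u v)
... | inj₁ e = yes (reachB⇒reach H n e)
... | inj₂ e = no λ r → true≢false (reach⇒reachB r) e

components-classes : ∀ {n} (H : Adj n) → Symmetric H → Classes (vertices n) (Reach H) (#components H)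
components-classes {n} H s = t , least-transversal (vertices n) (Reach H) (reach-equiv s) t least smaller , refl
  where
  t : Fin n → Bool
  t v = all (λ w → not ((toℕ w <ᵇ toℕ v) ∧ reachB H n w v)) (allFin n)
  least : ∀ {x y} → t x ≡ true → Reach H x y → toℕ x ≤ toℕ y
  least {x} {y} tx r = ≮⇒≥ λ y<x → true≢false
    (∧-intro (<ᵇ-intro y<x) (reach⇒reachB (reach-sym s r))) (not-true (all-elim _ (allFin n) tx (∈-allFin y)))
  smaller : ∀ {x} → t x ≡ false → ∃ λ y → Reach H x y × toℕ y < toℕ x
  smaller {x} fx with all-false _ (allFin n) fx
  ... | w , _ , e with ∧-true {toℕ w <ᵇ toℕ x} (not-false e)
  ...   | w<x , r = w , reach-sym s (reachB⇒reach H n r) , <ᵇ-true w<x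

components-mono : ∀ {n} {H K : Adj n} → Symmetric H → Symmetric K → (∀ {u v} → Reach H u v → Reach K u v) → #components K ≤ #components H
components-mono {n} {H} {K} sH sK sub = classes-≤ (vertices n) (reach-equiv sH) sub (components-classes K sK) (components-classes H sH)

edgeB : ∀ {n} → Fin n → Fin n → Fin n → Fin n → Bool
edgeB u v x y = (⌊ x ≟ u ⌋ ∧ ⌊ y ≟ v ⌋) ∨ (⌊ x ≟ v ⌋ ∧ ⌊ y ≟ u ⌋)

edgeB-elim : ∀ {n} {u v x y : Fin n} → edgeB u v x y ≡ true → (x ≡ u × y ≡ v) ⊎ (x ≡ v × y ≡ u)
edgeB-elim {u = u} {v} {x} {y} e with ∨-true {⌊ x ≟ u ⌋ ∧ ⌊ y ≟ v ⌋} e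
... | inj₁ e' = let p , q = ∧-true e' in inj₁ (isYes⁻ (x ≟ u) p , isYes⁻ (y ≟ v) q)
... | inj₂ e' = let p , q = ∧-true e' in inj₂ (isYes⁻ (x ≟ v) p , isYes⁻ (y ≟ u) q)

edgeB-intro : ∀ {n} {u v x y : Fin n} → (x ≡ u × y ≡ v) ⊎ (x ≡ v × y ≡ u) → edgeB u v x y ≡ true
edgeB-intro {x = x} {y} (inj₁ (refl , refl)) = ∨-introˡ (∧-intro (isYes⁺ (x ≟ x) refl) (isYes⁺ (y ≟ y) refl))
edgeB-intro {u = u} {v} {x} {y} (inj₂ (refl , refl)) = ∨-introʳ {⌊ x ≟ y ⌋ ∧ ⌊ y ≟ x ⌋} (∧-intro (isYes⁺ (x ≟ x) refl) (isYes⁺ (y ≟ y) refl))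

edgeB-symmetric : ∀ {n} (u v : Fin n) → Symmetric (edgeB u v)
edgeB-symmetric u v x y = bool-ext (mirror x y) (mirror y x)
  where
  flip : ∀ {x y} → (x ≡ u × y ≡ v) ⊎ (x ≡ v × y ≡ u) → (y ≡ u × x ≡ v) ⊎ (y ≡ v × x ≡ u)
  flip (inj₁ (p , q)) = inj₂ (q , p)
  flip (inj₂ (p , q)) = inj₁ (q , p)
  mirror : ∀ x y → edgeB u v x y ≡ true → edgeB u v y x ≡ true
  mirror x y e = edgeB-intro {x = y} (flip (edgeB-elim {x = x} e))

addEdge-elim : ∀ {n} (H : Adj n) {u v x y} → addEdge H u v x y ≡ true → H x y ≡ true ⊎ ((x ≡ u × y ≡ v) ⊎ (x ≡ v × y ≡ u))
addEdge-elim H {u} {v} {x} {y} e with ∨-true {H x y} e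
... | inj₁ e' = inj₁ e'
... | inj₂ e' = inj₂ (edgeB-elim e')

addEdge-⊇ : ∀ {n} (H : Adj n) u v → H ⊆ addEdge H u v
addEdge-⊇ H u v x y e = ∨-introˡ e

addEdge-new : ∀ {n} (H : Adj n) u v → addEdge H u v u v ≡ true
addEdge-new H u v = ∨-introʳ {H u v} (edgeB-intro {u = u} {v} (inj₁ (refl , refl)))

addEdge-new' : ∀ {n} (H : Adj n) u v → addEdge H u v v u ≡ true
addEdge-new' H u v = ∨-introʳ {H v u} (edgeB-intro {u = u} {v} (inj₂ (refl , refl)))

addEdge-⊆ : ∀ {n} {H K : Adj n} → Symmetric K → H ⊆ K → ∀ {u v} → K u v ≡ true → addEdge H u v ⊆ K
addEdge-⊆ {H = H} sK sub {u} {v} k x y e with addEdge-elim H {u} {v} {x} {y} e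
... | inj₁ h = sub x y h
... | inj₂ (inj₁ (refl , refl)) = k
... | inj₂ (inj₂ (refl , refl)) = trans (sK x y) k

addEdge-symmetric : ∀ {n} {H : Adj n} → Symmetric H → ∀ u v → Symmetric (addEdge H u v)
addEdge-symmetric s u v x y = cong₂ _∨_ (s x y) (edgeB-symmetric u v x y)

addEdge-simple : ∀ {n} {H : Adj n} → SimpleGraph H → ∀ {u v} → u ≢ v → SimpleGraph (addEdge H u v)
addEdge-simple {H = H} (s , irr) {u} {v} u≢v = addEdge-symmetric s u v , λ x → ≢true λ e → no-loop x (addEdge-elim H e)
  where
  no-loop : ∀ x → H x x ≡ true ⊎ ((x ≡ u × x ≡ v) ⊎ (x ≡ v × x ≡ u)) → ⊥
  no-loop x (inj₁ e) = true≢false e (irr x)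
  no-loop x (inj₂ (inj₁ (refl , e))) = u≢v e
  no-loop x (inj₂ (inj₂ (refl , e))) = u≢v (sym e)

addEdge-reach⇒merge : ∀ {n} {H : Adj n} → Symmetric H → ∀ {u v x y} → Reach (addEdge H u v) x y → Merge (Reach H) u v x y
addEdge-reach⇒merge {H = H} s here = inj₁ here
addEdge-reach⇒merge {H = H} s {u} {v} (there {x} {w} e r) = M.trans (one (addEdge-elim H e)) (addEdge-reach⇒merge s r)
  where
  module M = IsEquivalence (merge-equiv (reach-equiv s) u v)
  one : H x w ≡ true ⊎ ((x ≡ u × w ≡ v) ⊎ (x ≡ v × w ≡ u)) → Merge (Reach H) u v x w
  one (inj₁ h) = inj₁ (reach-edge h)
  one (inj₂ (inj₁ (refl , refl))) = inj₂ (inj₁ (here , here))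
  one (inj₂ (inj₂ (refl , refl))) = inj₂ (inj₂ (here , here))

merge⇒addEdge-reach : ∀ {n} {H : Adj n} → Symmetric H → ∀ {u v x y} → Merge (Reach H) u v x y → Reach (addEdge H u v) x y
merge⇒addEdge-reach {H = H} s {u} {v} = go
  where
  up : ∀ {x y} → Reach H x y → Reach (addEdge H u v) x y
  up = reach-mono (addEdge-⊇ H u v)
  go : ∀ {x y} → Merge (Reach H) u v x y → Reach (addEdge H u v) x y
  go (inj₁ r) = up r
  go (inj₂ (inj₁ (p , q))) = reach-trans (up p) (there (addEdge-new H u v) (up (reach-sym s q)))
  go (inj₂ (inj₂ (p , q))) = reach-trans (up p) (there (addEdge-new' H u v) (up (reach-sym s q)))

components-join : ∀ {n} {H : Adj n} → Symmetric H → ∀ {u v} → ¬ Reach H u v → #components H ≡ suc (#components (addEdge H u v))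
components-join {n} {H} s {u} {v} u≁v with merge-classes (vertices n) (reach-equiv s) u≁v (components-classes H s)
... | k , e , c = trans e (cong suc (classes-unique (vertices n) (reach-equiv s')
    (classes-cong (vertices n) (merge⇒addEdge-reach s) (addEdge-reach⇒merge s) c) (components-classes (addEdge H u v) s')))
  where
  s' = addEdge-symmetric s u v

components-same : ∀ {n} {H : Adj n} → Symmetric H → ∀ {u v} → Reach H u v → #components (addEdge H u v) ≡ #components H
components-same {n} {H} s {u} {v} r = ≤-antisym
    (components-mono s s' (reach-mono (addEdge-⊇ H u v)))
    (components-mono s' s (λ q → collapse (addEdge-reach⇒merge s q)))
  where
  s' = addEdge-symmetric s u v
  collapse : ∀ {x y} → Merge (Reach H) u v x y → Reach H x y
  collapse (inj₁ q) = q
  collapse (inj₂ (inj₁ (p , q))) = reach-trans p (reach-trans r (reach-sym s q))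
  collapse (inj₂ (inj₂ (p , q))) = reach-trans p (reach-trans (reach-sym s r) (reach-sym s q))

components-≤suc : ∀ {n} {H : Adj n} → Symmetric H → ∀ u v → #components H ≤ suc (#components (addEdge H u v))
components-≤suc {H = H} s u v with reach? H u v
... | yes r = m≤n⇒m≤1+n (≤-reflexive (sym (components-same s r)))
... | no ¬r = ≤-reflexive (components-join s ¬r)

connected-components : ∀ {n} {H : Adj n} → Symmetric H → Connected H → Fin n → #components H ≡ 1
connected-components {n} {H} s conn v = classes-unique (vertices n) (reach-equiv s) (components-classes H s) (t , record { indep = λ tx ty _ → trans (is tx) (sym (is ty)) ; rep = λ x → v , isYes⁺ (v ≟ v) refl , conn x v } ,
    trans (card-insert (vertices n) (λ _ → false) t v refl (isYes⁺ (v ≟ v) refl) (λ x x≢v → isNo⁺ (x ≟ v) x≢v)) (cong suc (none (allFin n))))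
  where
  t : Fin n → Bool
  t x = ⌊ x ≟ v ⌋
  is : ∀ {x} → t x ≡ true → x ≡ v
  is {x} = isYes⁻ (x ≟ v)
  none : ∀ (xs : List (Fin n)) → cnt (λ _ → false) xs ≡ 0
  none [] = refl
  none (_ ∷ xs) = none xs

components-positive : ∀ {n} {H : Adj n} → Symmetric H → Fin n → 1 ≤ #components H
components-positive {n} {H} s v with components-classes H s
... | t , tr , e = subst (1 ≤_) e (card-positive (vertices n) t (proj₁ (proj₂ (Transversal.rep tr v))))

components≤1⇒connected : ∀ {n} {H : Adj n} → Symmetric H → #components H ≤ 1 → Connected H
components≤1⇒connected {n} {H} s c u v with reach? H u v
... | yes r = r
... | no ¬r = ⊥-elim (1+n≰n (≤-trans (s≤s (components-positive (addEdge-symmetric s u v) u)) (≤-trans (≤-reflexive (sym (components-join s ¬r))) c)))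

ascending : ∀ {n} → (Fin n → Fin n → Bool) → Dart n → Bool
ascending p (u , v) = (toℕ u <ᵇ toℕ v) ∧ p u v

countPairs-card : ∀ {n} (p : Fin n → Fin n → Bool) → countPairs p ≡ card (darts n) (ascending p)
countPairs-card {n} p = sym (cnt-product (ascending p) (allFin n) (allFin n))

countPairs-cong : ∀ {n} {p q : Fin n → Fin n → Bool} → (∀ u v → p u v ≡ q u v) → countPairs p ≡ countPairs q
countPairs-cong {n} {p} {q} e = trans (countPairs-card p)
  (trans (card-cong (darts n) λ { (u , v) → cong ((toℕ u <ᵇ toℕ v) ∧_) (e u v) }) (sym (countPairs-card q)))

countPairs-mono : ∀ {n} {p q : Fin n → Fin n → Bool} → (∀ u v → p u v ≡ true → q u v ≡ true) → countPairs p ≤ countPairs q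
countPairs-mono {n} {p} {q} sub = subst (_≤ countPairs q) (sym (countPairs-card p)) (subst (card (darts n) (ascending p) ≤_) (sym (countPairs-card q))
  (card-mono (darts n) λ { {u , v} e → let l , r = ∧-true {toℕ u <ᵇ toℕ v} e in ∧-intro l (sub u v r) }))

countPairs-split : ∀ {n} (p q : Fin n → Fin n → Bool) →
  countPairs p ≡ countPairs (λ u v → p u v ∧ q u v) + countPairs (λ u v → p u v ∧ not (q u v))
countPairs-split {n} p q = trans (countPairs-card p) (trans (cnt-split (ascending p) (λ { (u , v) → q u v }) (Enum.elems (darts n)))
  (cong₂ _+_ (trans (card-cong (darts n) (λ { (u , v) → assoc (toℕ u <ᵇ toℕ v) (p u v) (q u v) })) (sym (countPairs-card (λ u v → p u v ∧ q u v))))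
             (trans (card-cong (darts n) (λ { (u , v) → assoc (toℕ u <ᵇ toℕ v) (p u v) (not (q u v)) })) (sym (countPairs-card (λ u v → p u v ∧ not (q u v)))))))
  where
  assoc : ∀ a b c → (a ∧ b) ∧ c ≡ a ∧ (b ∧ c)
  assoc true b c = refl
  assoc false b c = refl

edges-addEdge : ∀ {n} (H : Adj n) → Symmetric H → ∀ {u v} → u ≢ v → H u v ≡ false → #edges (addEdge H u v) ≡ suc (#edges H)
edges-addEdge {n} H s {u} {v} u≢v h with <-cmp (toℕ u) (toℕ v)
... | tri≈ _ e _ = ⊥-elim (u≢v (toℕ-injective e))
... | tri< u<v _ _ = trans (countPairs-card (addEdge H u v)) (trans (card-insert (darts n) (ascending H) (ascending (addEdge H u v)) (u , v)
    (≢true λ e → true≢false (proj₂ (∧-true {toℕ u <ᵇ toℕ v} e)) h)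
    (∧-intro (<ᵇ-intro u<v) (addEdge-new H u v))
    (λ { (x , y) ne → bool-ext (λ e → let l , r = ∧-true {toℕ x <ᵇ toℕ y} e in ∧-intro l (old ne (<ᵇ-true l) (addEdge-elim H r)))
                      (λ e → let l , r = ∧-true {toℕ x <ᵇ toℕ y} e in ∧-intro l (addEdge-⊇ H u v x y r)) }))
    (cong suc (sym (countPairs-card H))))
  where
  old : ∀ {x y} → (x , y) ≢ (u , v) → toℕ x < toℕ y → H x y ≡ true ⊎ ((x ≡ u × y ≡ v) ⊎ (x ≡ v × y ≡ u)) → H x y ≡ true
  old ne l (inj₁ e) = e
  old ne l (inj₂ (inj₁ (refl , refl))) = ⊥-elim (ne refl)
  old ne l (inj₂ (inj₂ (refl , refl))) = ⊥-elim (<-irrefl refl (<-trans u<v l))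
... | tri> _ _ v<u = trans (countPairs-card (addEdge H u v)) (trans (card-insert (darts n) (ascending H) (ascending (addEdge H u v)) (v , u)
    (≢true λ e → true≢false (trans (s u v) (proj₂ (∧-true {toℕ v <ᵇ toℕ u} e))) h)
    (∧-intro (<ᵇ-intro v<u) (addEdge-new' H u v))
    (λ { (x , y) ne → bool-ext (λ e → let l , r = ∧-true {toℕ x <ᵇ toℕ y} e in ∧-intro l (old ne (<ᵇ-true l) (addEdge-elim H r)))
                      (λ e → let l , r = ∧-true {toℕ x <ᵇ toℕ y} e in ∧-intro l (addEdge-⊇ H u v x y r)) }))
    (cong suc (sym (countPairs-card H))))
  where
  old : ∀ {x y} → (x , y) ≢ (v , u) → toℕ x < toℕ y → H x y ≡ true ⊎ ((x ≡ u × y ≡ v) ⊎ (x ≡ v × y ≡ u)) → H x y ≡ true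
  old ne l (inj₁ e) = e
  old ne l (inj₂ (inj₁ (refl , refl))) = ⊥-elim (<-irrefl refl (<-trans v<u l))
  old ne l (inj₂ (inj₂ (refl , refl))) = ⊥-elim (ne refl)

arc : ∀ {n} → Adj n → Dart n → Bool
arc H (u , v) = H u v

simple-≢ : ∀ {n} {H : Adj n} → SimpleGraph H → ∀ {u v} → H u v ≡ true → u ≢ v
simple-≢ (_ , irr) e refl = true≢false e (irr _)

arcs-twice : ∀ {n} (H : Adj n) → SimpleGraph H → card (darts n) (arc H) ≡ #edges H + #edges H
arcs-twice {n} H (s , irr) = trans (cnt-split (arc H) up (Enum.elems (darts n))) (cong₂ _+_
    (trans (card-cong (darts n) λ { (u , v) → ∧-comm (H u v) (toℕ u <ᵇ toℕ v) }) (sym (countPairs-card H)))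
    (trans (≤-antisym (card-inject (darts n) (darts n) Flip down⇒up flip-inj) (card-inject (darts n) (darts n) Flip up⇒down flip-inj)) (sym (countPairs-card H))))
  where
  up : Dart n → Bool
  up (u , v) = toℕ u <ᵇ toℕ v
  Flip : Dart n → Dart n → Set
  Flip (u , v) d = d ≡ (v , u)
  flip-inj : ∀ {P Q : Set} {x x' y} → P → Q → Flip x y → Flip x' y → x ≡ x'
  flip-inj _ _ refl refl = refl
  down⇒up : ∀ {d} → arc H d ∧ not (up d) ≡ true → ∃ λ d' → ascending H d' ≡ true × Flip d d'
  down⇒up {u , v} e with ∧-true {H u v} e
  ... | h , d = (v , u) , ∧-intro (<ᵇ-intro v<u) (trans (s v u) h) , refl
    where
    v<u : toℕ v < toℕ u
    v<u = ≤∧≢⇒< (≮⇒≥ (λ l → true≢false (<ᵇ-intro {toℕ u} l) (not-true d))) (λ v≡u → simple-≢ (s , irr) h (sym (toℕ-injective v≡u)))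
  up⇒down : ∀ {d} → ascending H d ≡ true → ∃ λ d' → arc H d' ∧ not (up d') ≡ true × Flip d d'
  up⇒down {u , v} e with ∧-true {toℕ u <ᵇ toℕ v} e
  ... | l , h = (v , u) , ∧-intro (trans (s v u) h) (not-intro (≢true λ l' → <-irrefl refl (<-trans (<ᵇ-true l) (<ᵇ-true {toℕ v} l')))) , refl

edge-exists : ∀ {n} {H : Adj n} → 1 ≤ #edges H → ∃ λ u → ∃ λ v → H u v ≡ true
edge-exists {n} {H} h with card-witness (darts n) (ascending H) (subst (1 ≤_) (countPairs-card H) h)
... | (u , v) , e = u , v , proj₂ (∧-true {toℕ u <ᵇ toℕ v} e)

delEdge : ∀ {n} → Adj n → Fin n → Fin n → Adj n
delEdge H u v x y = H x y ∧ not (edgeB u v x y)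

delEdge-⊆ : ∀ {n} (H : Adj n) u v → delEdge H u v ⊆ H
delEdge-⊆ H u v x y e = proj₁ (∧-true e)

delEdge-intro : ∀ {n} (H : Adj n) {u v x y} → H x y ≡ true → ¬ ((x ≡ u × y ≡ v) ⊎ (x ≡ v × y ≡ u)) → delEdge H u v x y ≡ true
delEdge-intro H {u} {v} {x} {y} h ne = ∧-intro h (not-intro (≢true λ e → ne (edgeB-elim {u = u} {v} {x} {y} e)))

delEdge-absent : ∀ {n} (H : Adj n) u v → delEdge H u v u v ≡ false
delEdge-absent H u v = ≢true λ e → true≢false (edgeB-intro {u = u} {v} (inj₁ (refl , refl))) (not-true (proj₂ (∧-true {H u v} e)))

delEdge-simple : ∀ {n} {H : Adj n} → SimpleGraph H → ∀ u v → SimpleGraph (delEdge H u v)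
delEdge-simple (s , irr) u v = (λ x y → cong₂ (λ a b → a ∧ not b) (s x y) (edgeB-symmetric u v x y)) , λ x → ≢true λ e → true≢false (proj₁ (∧-true e)) (irr x)

addEdge-delEdge : ∀ {n} {H : Adj n} → Symmetric H → ∀ {u v} → H u v ≡ true → ∀ x y → addEdge (delEdge H u v) u v x y ≡ H x y
addEdge-delEdge {H = H} s {u} {v} h x y = bool-ext (addEdge-⊆ s (delEdge-⊆ H u v) h x y) back
  where
  back : H x y ≡ true → addEdge (delEdge H u v) u v x y ≡ true
  back e with bool-cases (edgeB u v x y)
  ... | inj₁ t = ∨-introʳ {delEdge H u v x y} t
  ... | inj₂ f = ∨-introˡ (∧-intro e (not-intro f))

#edges-cong : ∀ {n} {H K : Adj n} → (∀ u v → H u v ≡ K u v) → #edges H ≡ #edges K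
#edges-cong {n} e = countPairs-cong e

#components-cong : ∀ {n} {H K : Adj n} → Symmetric H → Symmetric K → (∀ u v → H u v ≡ K u v) → #components H ≡ #components K
#components-cong sH sK e = ≤-antisym
  (components-mono sK sH (reach-mono λ u v k → trans (e u v) k))
  (components-mono sH sK (reach-mono λ u v h → trans (sym (e u v)) h))

edges-delEdge : ∀ {n} {H : Adj n} → SimpleGraph H → ∀ {u v} → H u v ≡ true → #edges H ≡ suc (#edges (delEdge H u v))
edges-delEdge {n} {H} sg {u} {v} h = trans (#edges-cong {n} {H} {addEdge (delEdge H u v) u v} (λ x y → sym (addEdge-delEdge (proj₁ sg) {u} {v} h x y)))
  (edges-addEdge (delEdge H u v) (proj₁ (delEdge-simple sg u v)) (simple-≢ sg h) (delEdge-absent H u v))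

missing : ∀ {n} → Adj n → Adj n → Dart n → Bool
missing H K (u , v) = H u v ∧ not (K u v)

-- Induction along the insertion of the edges of H into a subgraph K, one at a time.
grow : ∀ {n} (H : Adj n) → SimpleGraph H → (P : Adj n → Set) →
  (∀ K u v → SimpleGraph K → K ⊆ H → H u v ≡ true → K u v ≡ false → P K → P (addEdge K u v)) →
  ∀ K → SimpleGraph K → K ⊆ H → P K → ∃ λ L → SimpleGraph L × (∀ u v → L u v ≡ H u v) × P L
grow {n} H sH P next K sK sub pK = go (suc (card (darts n) (missing H K))) K ≤-refl sK sub pK
  where
  go : ∀ m K → card (darts n) (missing H K) < m → SimpleGraph K → K ⊆ H → P K → ∃ λ L → SimpleGraph L × (∀ u v → L u v ≡ H u v) × P L
  go (suc m) K (s≤s bound) sK sub pK with any? (λ u → any? (λ v → missing H K (u , v) ≟ᵇ true))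
  ... | no none = K , sK , (λ u v → bool-ext (sub u v) λ h → full u v h (bool-cases (K u v))) , pK
    where
    full : ∀ u v → H u v ≡ true → K u v ≡ true ⊎ K u v ≡ false → K u v ≡ true
    full u v h (inj₁ k) = k
    full u v h (inj₂ k) = ⊥-elim (none (u , v , ∧-intro h (not-intro k)))
  ... | yes (u , v , e) with ∧-true {H u v} e
  ...   | h , k = go m (addEdge K u v) (≤-trans (≤-trans (s≤s (card-mono (darts n) shrink)) (≤-reflexive (sym (card-without (darts n) (missing H K) e)))) bound)
          (addEdge-simple sK (simple-≢ sH h)) (addEdge-⊆ (proj₁ sH) sub h) (next K u v sK sub h (not-true k) pK)
    where
    shrink : ∀ {d} → missing H (addEdge K u v) d ≡ true → without (Enum._≡?_ (darts n)) (missing H K) (u , v) d ≡ true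
    shrink {x , y} e' with ∧-true {H x y} e'
    ... | h' , k' = without-intro (Enum._≡?_ (darts n)) (missing H K)
      (∧-intro h' (not-intro (≢true λ t → true≢false (addEdge-⊇ K u v x y t) (not-true k'))))
      λ { refl → true≢false (addEdge-new K u v) (not-true k') }

edgeless : ∀ {n} → Adj n
edgeless _ _ = false

edgeless-simple : ∀ {n} → SimpleGraph (edgeless {n})
edgeless-simple = (λ _ _ → refl) , λ _ → refl

card-false : {X : Set} (E : Enum X) → card E (λ _ → false) ≡ 0
card-false E = go (Enum.elems E)
  where
  go : ∀ xs → cnt (λ _ → false) xs ≡ 0
  go [] = refl
  go (_ ∷ xs) = go xs

card-vertices : ∀ n → card (vertices n) (λ _ → true) ≡ n
card-vertices n = trans (cnt-all (allFin n)) (length-tabulate {n = n} (λ i → i))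

edgeless-edges : ∀ n → #edges (edgeless {n}) ≡ 0
edgeless-edges n = trans (countPairs-card (edgeless {n})) (trans (card-cong (darts n) (λ { (u , v) → bool-ext (λ e → proj₂ (∧-true {toℕ u <ᵇ toℕ v} e)) λ () })) (card-false (darts n)))

edgeless-components : ∀ n → #components (edgeless {n}) ≡ n
edgeless-components n = trans (classes-unique (vertices n) (reach-equiv (λ _ _ → refl)) (components-classes edgeless (λ _ _ → refl))
  ((λ _ → true) , record { indep = λ _ _ → still ; rep = λ x → x , refl , here } , refl)) (card-vertices n)
  where
  still : ∀ {x y} → Reach (edgeless {n}) x y → x ≡ y
  still here = refl
  still (there () _)

edges+components : ∀ {n} (H : Adj n) → SimpleGraph H → n ≤ #edges H + #components H
edges+components {n} H sH with grow H sH (λ K → n ≤ #edges K + #components K) next edgeless edgeless-simple (λ _ _ ())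
    (≤-trans (≤-reflexive (sym (edgeless-components n))) (m≤n+m _ _))
  where
  next : ∀ K u v → SimpleGraph K → K ⊆ H → H u v ≡ true → K u v ≡ false → n ≤ #edges K + #components K → n ≤ #edges (addEdge K u v) + #components (addEdge K u v)
  next K u v sK sub h k ih = ≤-trans ih (≤-trans (+-monoʳ-≤ (#edges K) (components-≤suc (proj₁ sK) u v))
    (≤-reflexive (trans (+-suc _ _) (cong (_+ #components (addEdge K u v)) (sym (edges-addEdge K (proj₁ sK) (simple-≢ sH h) k))))))
... | L , sL , e , r = subst (n ≤_) (cong₂ _+_ (#edges-cong {n} {L} {H} e) (#components-cong (proj₁ sL) (proj₁ sH) e)) r

-- Boundary walks and the Euler genus

orb-cong : {X : Set} {f g : X → X} → (∀ x → f x ≡ g x) → ∀ {x y} → Orb f x y → Orb g x y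
orb-cong {f = f} {g} e {x} = orb-least f {Orb g x} orb-refl λ {y} o → subst (Orb g x) (sym (e y)) (orb-step o)

orb-classes-cong : {X : Set} (E : Enum X) {f g : X → X} → (∀ x → f x ≡ g x) → ∀ {k} → Classes E (Orb f) k → Classes E (Orb g) k
orb-classes-cong E e = classes-cong E (orb-cong e) (orb-cong (λ x → sym (e x)))

Rotation : ℕ → Set
Rotation n = Fin n → Fin n → Fin n

-- A rotation system made total: vertices outside the neighbourhood of u are fixed by ρ u.
record TotalRotation {n} (A : Adj n) (ρ : Rotation n) : Set where
  field
    off : ∀ {u v} → A u v ≡ false → ρ u v ≡ v
    injective : ∀ u → Injective (ρ u)
    closed : ∀ {u v} → A u v ≡ true → A u (ρ u v) ≡ true
    cyclic : ∀ {u v w} → A u v ≡ true → A u w ≡ true → Orb (ρ u) v w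

-- The boundary walks of the subgraph H inside the surface of ρ: a dart in H is followed to its
-- head, a dart outside H is turned past. A vertex without edges in H contributes one orbit.
ribbon : ∀ {n} → Rotation n → Adj n → Dart n → Dart n
ribbon ρ H (u , v) = if H u v then (v , ρ v u) else (u , ρ u v)

ribbon-in : ∀ {n} (ρ : Rotation n) (H : Adj n) {u v} → H u v ≡ true → ribbon ρ H (u , v) ≡ (v , ρ v u)
ribbon-in ρ H {u} {v} e = cong (λ b → if b then (v , ρ v u) else (u , ρ u v)) e

ribbon-out : ∀ {n} (ρ : Rotation n) (H : Adj n) {u v} → H u v ≡ false → ribbon ρ H (u , v) ≡ (u , ρ u v)
ribbon-out ρ H {u} {v} e = cong (λ b → if b then (v , ρ v u) else (u , ρ u v)) e

ribbon-cong : ∀ {n} (ρ : Rotation n) {H K : Adj n} → (∀ u v → H u v ≡ K u v) → ∀ d → ribbon ρ H d ≡ ribbon ρ K d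
ribbon-cong ρ e (u , v) = cong (λ b → if b then (v , ρ v u) else (u , ρ u v)) (e u v)

ribbon-injective : ∀ {n} {ρ : Rotation n} → (∀ u → Injective (ρ u)) → ∀ {H} → Symmetric H → Injective (ribbon ρ H)
ribbon-injective {ρ = ρ} inj {H} s {u , v} {u' , v'} e with bool-cases (H u v) | bool-cases (H u' v')
... | inj₁ h | inj₁ h' with trans (sym (ribbon-in ρ H h)) (trans e (ribbon-in ρ H h'))
...   | q with cong proj₁ q
...     | refl = cong (_, v) (inj v (cong proj₂ q))
ribbon-injective {ρ = ρ} inj {H} s {u , v} {u' , v'} e | inj₂ h | inj₂ h' with trans (sym (ribbon-out ρ H h)) (trans e (ribbon-out ρ H h'))
...   | q with cong proj₁ q
...     | refl = cong (u ,_) (inj u (cong proj₂ q))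
ribbon-injective {ρ = ρ} inj {H} s {u , v} {u' , v'} e | inj₁ h | inj₂ h' with trans (sym (ribbon-in ρ H h)) (trans e (ribbon-out ρ H h'))
...   | q with cong proj₁ q
...     | refl with inj v (cong proj₂ q)
...       | refl = true≢false (trans (s v u) h) h'
ribbon-injective {ρ = ρ} inj {H} s {u , v} {u' , v'} e | inj₂ h | inj₁ h' with trans (sym (ribbon-out ρ H h)) (trans e (ribbon-in ρ H h'))
...   | q with cong proj₁ q
...     | refl with inj u (cong proj₂ q)
...       | refl = true≢false (trans (s u v) h') h

ribbon-addEdge : ∀ {n} (ρ : Rotation n) {H : Adj n} → Symmetric H → ∀ {u v} → H u v ≡ false →
  Swapped (ribbon ρ (addEdge H u v)) (ribbon ρ H) (u , v) (v , u)
ribbon-addEdge ρ {H} s {u} {v} h = record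
  { at-a = trans (ribbon-in ρ (addEdge H u v) (addEdge-new H u v)) (sym (ribbon-out ρ H (trans (s v u) h)))
  ; at-b = trans (ribbon-in ρ (addEdge H u v) (addEdge-new' H u v)) (sym (ribbon-out ρ H h))
  ; off = λ { (x , y) ne ne' → cong (λ b → if b then (y , ρ y x) else (x , ρ x y))
      (bool-ext (λ e → old ne ne' (addEdge-elim H e)) (addEdge-⊇ H u v x y)) } }
  where
  old : ∀ {x y} → (x , y) ≢ (u , v) → (x , y) ≢ (v , u) → H x y ≡ true ⊎ ((x ≡ u × y ≡ v) ⊎ (x ≡ v × y ≡ u)) → H x y ≡ true
  old ne ne' (inj₁ e) = e
  old ne ne' (inj₂ (inj₁ (refl , refl))) = ⊥-elim (ne refl)
  old ne ne' (inj₂ (inj₂ (refl , refl))) = ⊥-elim (ne' refl)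

ribbon-tail : ∀ {n} (ρ : Rotation n) (H : Adj n) {d d'} → Orb (ribbon ρ H) d d' → Reach H (proj₁ d) (proj₁ d')
ribbon-tail ρ H {u , v} = orb-least (ribbon ρ H) {λ d → Reach H u (proj₁ d)} here next
  where
  next : ∀ {d} → Reach H u (proj₁ d) → Reach H u (proj₁ (ribbon ρ H d))
  next {x , y} r with bool-cases (H x y)
  ... | inj₁ h = subst (λ d → Reach H u (proj₁ d)) (sym (ribbon-in ρ H h)) (reach-trans r (reach-edge h))
  ... | inj₂ h = subst (λ d → Reach H u (proj₁ d)) (sym (ribbon-out ρ H h)) r

record EulerBound {n} (a b : ℕ) (H : Adj n) (k : ℕ) : Set where
  constructor eulerBound
  field bound : #edges H + 2 * #components H + a ≤ b + k

eulerBound-cong : ∀ {n a b} {H K : Adj n} {k} → Symmetric H → Symmetric K → (∀ u v → H u v ≡ K u v) → EulerBound a b H k → EulerBound a b K k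
eulerBound-cong {n} {a} {b} {H} {K} {k} sH sK e (eulerBound h) = eulerBound
  (subst (_≤ b + k) (cong₂ (λ x y → x + 2 * y + a) (#edges-cong {n} {H} {K} e) (#components-cong {n} {H} {K} sH sK e)) h)

euler-nonbridge : ∀ {e e' c c' k k'} a b → e' ≡ suc e → c' ≡ c → k' ≤ suc k → e' + 2 * c' + a ≤ b + k' → e + 2 * c + a ≤ b + k
euler-nonbridge {e} {c = c} {k = k} a b refl refl h ineq = ≤-pred (≤-trans ineq (≤-trans (+-monoʳ-≤ b h) (≤-reflexive (+-suc b k))))

euler-bridge : ∀ {e e' c c' k k'} a b → e' ≡ suc e → c ≡ suc c' → k ≡ suc k' → e' + 2 * c' + a ≤ b + k' → e + 2 * c + a ≤ b + k
euler-bridge {e} {c' = c'} {k' = k'} a b refl refl refl ineq = ≤-trans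
  (≤-reflexive (solve 3 (λ e c a → e :+ con 2 :* (con 1 :+ c) :+ a := con 1 :+ (con 1 :+ e :+ con 2 :* c :+ a)) refl e c' a))
  (≤-trans (s≤s ineq) (≤-reflexive (sym (+-suc b k'))))
  where open +-*-Solver

-- Deleting an edge does not increase the Euler genus E + 2C - V - F, whether or not it is a bridge.
euler-delete : ∀ {n} (ρ : Rotation n) → (∀ u → Injective (ρ u)) → (H : Adj n) → Symmetric H → ∀ {u v} → u ≢ v → H u v ≡ false →
  ∀ {k k' a b} → Classes (darts n) (Orb (ribbon ρ (addEdge H u v))) k' → Classes (darts n) (Orb (ribbon ρ H)) k →
  EulerBound a b (addEdge H u v) k' → EulerBound a b H k
euler-delete {n} ρ inj H s {u} {v} u≢v h {k} {k'} {a} {b} c' c (eulerBound ineq) with reach? H u v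
... | yes r = eulerBound (euler-nonbridge a b (edges-addEdge H s u≢v h) (components-same s r)
      (swapped-≤ (darts n) (ribbon-injective inj (addEdge-symmetric s u v)) (ribbon-injective inj s) (ribbon-addEdge ρ s h) c' c) ineq)
... | no ¬r with swapped-merges (darts n) (ribbon-injective inj (addEdge-symmetric s u v)) (ribbon-injective inj s)
      (ribbon-addEdge ρ s h) (λ o → ¬r (ribbon-tail ρ H o)) c
...   | l , e , c'' = eulerBound (euler-bridge a b (edges-addEdge H s u≢v h) (components-join s ¬r)
      (trans e (cong suc (classes-unique (darts n) (orb-equiv (darts n) _ (ribbon-injective inj (addEdge-symmetric s u v))) c'' c'))) ineq)

euler-subgraph : ∀ {n} (ρ : Rotation n) → (∀ u → Injective (ρ u)) → (A : Adj n) → SimpleGraph A →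
  ∀ {k a b} → Classes (darts n) (Orb (ribbon ρ A)) k → EulerBound a b A k →
  ∀ H → SimpleGraph H → H ⊆ A → ∀ {l} → Classes (darts n) (Orb (ribbon ρ H)) l → EulerBound a b H l
euler-subgraph {n} ρ inj A sA {k} {a} {b} c ineq H sH sub {l} cH = finish (grow A sA P next H sH sub start)
  where
  P : Adj n → Set
  P K = ∀ {m} → Classes (darts n) (Orb (ribbon ρ K)) m → EulerBound a b K m → EulerBound a b H l
  start : P H
  start cK le = subst (EulerBound a b H) (classes-unique (darts n) (orb-equiv (darts n) _ (ribbon-injective inj (proj₁ sH))) cK cH) le
  next : ∀ K u v → SimpleGraph K → K ⊆ A → A u v ≡ true → K u v ≡ false → P K → P (addEdge K u v)
  next K u v sK _ e k' pK cK le with orbit-classes (darts n) (ribbon ρ K) (ribbon-injective inj (proj₁ sK))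
  ... | m , cm = pK cm (euler-delete ρ inj K (proj₁ sK) (simple-≢ {H = A} sA e) k' cK cm le)
  finish : (∃ λ L → SimpleGraph L × (∀ u v → L u v ≡ A u v) × P L) → EulerBound a b H l
  finish (L , sL , e , pL) = pL (orb-classes-cong (darts n) (ribbon-cong ρ (λ u v → sym (e u v))) c)
    (eulerBound-cong (proj₁ sA) (proj₁ sL) (λ u v → sym (e u v)) ineq)

absent : ∀ {n} → Adj n → Dart n → Bool
absent A d = not (arc A d)

faceStep-ribbon : ∀ {n} {A : Adj n} {ρ ρ' : Rotation n} → Symmetric A → (∀ {u v} → A u v ≡ true → ρ u v ≡ ρ' u v) →
  (∀ {u v} → A u v ≡ true → A u (ρ' u v) ≡ true) →
  ∀ d → arc A d ≡ true → ∀ k → iter (faceStep ρ) k d ≡ iter (ribbon ρ' A) k d × arc A (iter (ribbon ρ' A) k d) ≡ true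
faceStep-ribbon s agree closed d e zero = refl , e
faceStep-ribbon {A = A} {ρ} {ρ'} s agree closed d e (suc k) with faceStep-ribbon {A = A} {ρ} {ρ'} s agree closed d e k
... | q , e' with iter (ribbon ρ' A) k d
...   | x , y = trans (cong (faceStep ρ) q) (trans (cong (y ,_) (agree back)) (sym (ribbon-in ρ' A e'))) ,
        trans (cong (arc A) (ribbon-in ρ' A e')) (closed back)
  where
  back : A y x ≡ true
  back = trans (s y x) e'

#faces-least : ∀ {n} {A : Adj n} {ρ ρ' : Rotation n} → SimpleGraph A → (∀ {u v} → A u v ≡ true → ρ u v ≡ ρ' u v) → TotalRotation A ρ' →
  #faces A ρ ≡ card (darts n) (λ d → leastInOrbit (darts n) (ribbon ρ' A) d ∧ arc A d)
#faces-least {n} {A} {ρ} {ρ'} (s , irr) agree rot = sym (trans (card-cong (darts n) same) (cnt-product (λ d → arc A d ∧ faceLeast d) (allFin n) (allFin n)))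
  where
  open TotalRotation rot
  t = leastInOrbit (darts n) (ribbon ρ' A)
  faceLeast : Dart n → Bool
  faceLeast d = all (λ k → dartCode d ≤ᵇ dartCode (iter (faceStep ρ) k d)) (upTo (n * n))
  same : ∀ d → t d ∧ arc A d ≡ arc A d ∧ faceLeast d
  same d with bool-cases (arc A d)
  ... | inj₂ e rewrite e = ∧-comm (t d) false
  ... | inj₁ e = trans (∧-comm (t d) (arc A d)) (cong (arc A d ∧_) (bool-ext
      (λ l → all-intro _ (upTo (n * n)) λ {k} m → subst (λ d' → (dartCode d ≤ᵇ dartCode d') ≡ true) (sym (proj₁ (faceStep-ribbon s agree closed d e k))) (all-elim _ (upTo (n * n)) l m))
      (λ l → all-intro _ (upTo (n * n)) λ {k} m → subst (λ d' → (dartCode d ≤ᵇ dartCode d') ≡ true) (proj₁ (faceStep-ribbon s agree closed d e k)) (all-elim _ (upTo (n * n)) l m))))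

#faces-classes : ∀ {n} {A : Adj n} {ρ ρ' : Rotation n} → SimpleGraph A → (∀ {u v} → A u v ≡ true → ρ u v ≡ ρ' u v) → TotalRotation A ρ' →
  Classes (darts n) (Orb (ribbon ρ' A)) (#faces A ρ + card (darts n) (absent A))
#faces-classes {n} {A} {ρ} {ρ'} sA@(s , _) agree rot = t , leastInOrbit-transversal D f (ribbon-injective injective s) ,
  trans (cnt-split t (arc A) (Enum.elems D)) (cong₂ _+_ (sym (#faces-least {A = A} {ρ} sA agree rot)) outside)
  where
  open TotalRotation rot
  D = darts n
  f = ribbon ρ' A
  t = leastInOrbit D f
  fixed : ∀ d → arc A d ≡ false → ∀ k → iter f k d ≡ d
  fixed d e zero = refl
  fixed d@(u , v) e (suc k) = trans (cong f (fixed d e k)) (trans (ribbon-out ρ' A e) (cong (u ,_) (off e)))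
  outside : card D (λ d → t d ∧ not (arc A d)) ≡ card D (absent A)
  outside = card-cong D λ d → bool-ext (λ e → proj₂ (∧-true {t d} e))
    λ e → ∧-intro (all-intro _ (upTo (n * n)) λ {k} _ → ≤ᵇ-intro (≤-reflexive (cong dartCode (sym (fixed d (not-true e) k))))) e

total : ∀ {n} → Adj n → Rotation n → Rotation n
total A ρ u v = if A u v then ρ u v else v

total-in : ∀ {n} (A : Adj n) (ρ : Rotation n) {u v} → A u v ≡ true → total A ρ u v ≡ ρ u v
total-in A ρ {u} {v} e = cong (λ b → if b then ρ u v else v) e

total-out : ∀ {n} (A : Adj n) (ρ : Rotation n) {u v} → A u v ≡ false → total A ρ u v ≡ v
total-out A ρ {u} {v} e = cong (λ b → if b then ρ u v else v) e

total-rotation : ∀ {n} {A : Adj n} {ρ : Rotation n} → IsRotation A ρ → TotalRotation A (total A ρ)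
total-rotation {n} {A} {ρ} rot = record { off = total-out A ρ ; injective = inj ; closed = closed ; cyclic = cyc }
  where
  closed : ∀ {u v} → A u v ≡ true → A u (total A ρ u v) ≡ true
  closed {u} {v} e = trans (cong (A u) (total-in A ρ e)) (proj₁ (rot u) v e)
  inj : ∀ u → Injective (total A ρ u)
  inj u {x} {y} e with bool-cases (A u x) | bool-cases (A u y)
  ... | inj₁ p | inj₁ q = proj₁ (proj₂ (rot u)) x y p q (trans (sym (total-in A ρ p)) (trans e (total-in A ρ q)))
  ... | inj₂ p | inj₂ q = trans (sym (total-out A ρ p)) (trans e (total-out A ρ q))
  ... | inj₁ p | inj₂ q = true≢false (trans (cong (A u) (trans (sym (total-out A ρ q)) (sym e))) (closed p)) q
  ... | inj₂ p | inj₁ q = true≢false (trans (cong (A u) (trans (sym (total-out A ρ p)) e)) (closed q)) p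
  walk : ∀ {u x} → A u x ≡ true → ∀ k → iter (total A ρ u) k x ≡ iter (ρ u) k x × A u (iter (ρ u) k x) ≡ true
  walk e zero = refl , e
  walk {u} {x} e (suc k) with walk {u} {x} e k
  ... | q , e' = trans (cong (total A ρ u) q) (total-in A ρ e') , proj₁ (rot u) _ e'
  cyc : ∀ {u v w} → A u v ≡ true → A u w ≡ true → Orb (total A ρ u) v w
  cyc {u} {v} {w} p q with proj₂ (proj₂ (rot u)) v w p q
  ... | k , e = k , trans (proj₁ (walk p k)) e

total⇒isRotation : ∀ {n} {A : Adj n} {ρ : Rotation n} → TotalRotation A ρ → IsRotation A ρ
total⇒isRotation rot v = (λ u → closed) , (λ u w _ _ → injective v) , λ u w → cyclic
  where open TotalRotation rot

true-irrelevant : {b : Bool} (p q : b ≡ true) → p ≡ q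
true-irrelevant refl refl = refl

first-hit : (p : ℕ → Bool) → ∀ k → p k ≡ true → ∃ λ j → p j ≡ true × (∀ i → i < j → p i ≡ false)
first-hit p zero e = 0 , e , λ _ ()
first-hit p (suc k) e with bool-cases (p 0)
... | inj₁ e₀ = 0 , e₀ , λ _ ()
... | inj₂ e₀ with first-hit (p ∘ suc) k e
...   | j , ej , before = suc j , ej , λ { zero _ → e₀ ; (suc i) (s≤s l) → before i l }

cnt-triple : {X : Set} (p : X → Bool) (xs : List X) → cnt (λ { (x , _) → p x }) (cartesianProduct xs (allFin 3)) ≡ 3 * cnt p xs
cnt-triple p xs = trans (cnt-product (λ { (x , _) → p x }) xs (allFin 3)) (go xs)
  where
  go : ∀ xs → sum (map (λ x → cnt (λ (_ : Fin 3) → p x) (allFin 3)) xs) ≡ 3 * cnt p xs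
  go [] = refl
  go (x ∷ xs) rewrite go xs with p x
  ... | false = refl
  ... | true = solve 1 (λ c → con 3 :+ con 3 :* c := con 3 :* (con 1 :+ c)) refl (cnt p xs)
    where open +-*-Solver

card-triple : {X Y : Set} (E : Enum X) (E' : Enum Y) {p : X → Bool} {q : Y → Bool} (R : X → Y → Set) →
  (∀ {x x' y} → p x ≡ true → p x' ≡ true → R x y → R x' y → x ≡ x') →
  (∀ x → p x ≡ true → Σ (Fin 3 → Y) λ g → (∀ {i j} → g i ≡ g j → i ≡ j) × (∀ i → q (g i) ≡ true × R x (g i))) →
  3 * card E p ≤ card E' q
card-triple {X} {Y} E E' {p} {q} R functional triple = subst (_≤ card E' q) (cnt-triple p (Enum.elems E))
  (cnt-inject (Enum._≡?_ E') (cartesianProduct (Enum.elems E) (allFin 3)) (Enum.elems E') S (cartesianProduct⁺ (Enum.unique E) (allFin⁺ 3)) image inj)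
  where
  S : X × Fin 3 → Y → Set
  S (x , i) y = Σ (p x ≡ true) λ e → proj₁ (triple x e) i ≡ y
  image : ∀ {xi} → p (proj₁ xi) ≡ true → ∃ λ y → y ∈ Enum.elems E' × q y ≡ true × S xi y
  image {x , i} e = let g , _ , good = triple x e in g i , Enum.complete E' (g i) , proj₁ (good i) , e , refl
  inj : ∀ {xi xj y} → p (proj₁ xi) ≡ true → p (proj₁ xj) ≡ true → S xi y → S xj y → xi ≡ xj
  inj {x , i} {x' , j} px px' (e , refl) (e' , q) with functional px px' (proj₂ (proj₂ (proj₂ (triple x e)) i)) (subst (R x') q (proj₂ (proj₂ (proj₂ (triple x' e')) j)))
  ... | refl with true-irrelevant e e'
  ...   | refl = cong (x ,_) (sym (proj₁ (proj₂ (triple x e)) q))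

isolated : ∀ {n} → Adj n → Fin n → Bool
isolated {n} H v = all (λ w → not (H v w)) (allFin n)

isolated-elim : ∀ {n} (H : Adj n) {v} → isolated H v ≡ true → ∀ w → H v w ≡ false
isolated-elim {n} H e w = not-true (all-elim _ (allFin n) e (∈-allFin w))

isolated-false : ∀ {n} (H : Adj n) {v} → isolated H v ≡ false → ∃ λ w → H v w ≡ true
isolated-false {n} H {v} e with all-false (λ w → not (H v w)) (allFin n) e
... | w , _ , q = w , not-false q

module _ {n : ℕ} {A : Adj n} {ρ : Rotation n} (rot : TotalRotation A ρ) {H : Adj n} (sH : SimpleGraph H) (sub : H ⊆ A) where
  open TotalRotation rot

  turn : ∀ {v w} → ∀ j → (∀ i → i < j → H v (iter (ρ v) i w) ≡ false) → Orb (ribbon ρ H) (v , w) (v , iter (ρ v) j w)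
  turn zero _ = orb-refl
  turn {v} {w} (suc j) out = subst (Orb (ribbon ρ H) (v , w)) (ribbon-out ρ H (out j ≤-refl))
    (orb-step (turn j (λ i l → out i (m≤n⇒m≤1+n l))))

  record NextArc (v w : Fin n) : Set where
    field
      steps : ℕ
      hit : H v (iter (ρ v) steps w) ≡ true
      before : ∀ i → i < steps → H v (iter (ρ v) i w) ≡ false
    end : Fin n
    end = iter (ρ v) steps w
    orbit : Orb (ribbon ρ H) (v , w) (v , end)
    orbit = turn steps before

  nextArc : ∀ {v w z} → A v w ≡ true → H v z ≡ true → NextArc v w
  nextArc {v} {w} a h with cyclic a (sub _ _ h)
  ... | k , refl with first-hit (λ i → H v (iter (ρ v) i w)) k h
  ...   | j , hit , before = record { steps = j ; hit = hit ; before = before }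

  -- A boundary walk that arrives at v from u and leaves to u has passed every other neighbour of v.
  turn-back : ∀ {u v} → A v u ≡ true → (x : NextArc v (ρ v u)) → NextArc.end x ≡ u → ∀ {y} → H v y ≡ true → y ≡ u
  turn-back {u} {v} a x back {y} h = finish (orb-least (ρ v) {S} (inj₁ refl) next (cyclic a (sub _ _ h)))
    where
    open NextArc x
    S : Fin n → Set
    S z = z ≡ u ⊎ ∃ λ i → i < steps × z ≡ iter (ρ v) i (ρ v u)
    after : ∀ i → i < suc steps → S (iter (ρ v) i (ρ v u))
    after i (s≤s l) with m≤n⇒m<n∨m≡n l
    ... | inj₁ l' = inj₂ (i , l' , refl)
    ... | inj₂ refl = inj₁ back
    next : ∀ {z} → S z → S (ρ v z)
    next (inj₁ refl) = after 0 (s≤s z≤n)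
    next (inj₂ (i , l , refl)) = after (suc i) (s≤s l)
    finish : S y → y ≡ u
    finish (inj₁ e) = e
    finish (inj₂ (i , l , refl)) = true≢false h (before i l)

  NoSingleEdge : Set
  NoSingleEdge = ∀ u v → H u v ≡ true → (∃ λ w → w ≢ u × H v w ≡ true) ⊎ (∃ λ w → w ≢ v × H u w ≡ true)

  three-arcs : NoSingleEdge → ∀ v w → A v w ≡ true → isolated H v ≡ false →
    Σ (Fin 3 → Dart n) λ g → (∀ {i j} → g i ≡ g j → i ≡ j) × (∀ i → arc H (g i) ≡ true × Orb (ribbon ρ H) (v , w) (g i))
  three-arcs no-single v w a ne = g , (λ {i} {j} → inj i j) , good
    where
    n₁ = nextArc a (proj₂ (isolated-false H ne))
    w₁ = NextArc.end n₁
    h₁ = NextArc.hit n₁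
    back₁ : H w₁ v ≡ true
    back₁ = trans (proj₁ sH w₁ v) h₁
    n₂ = nextArc (closed (sub _ _ back₁)) back₁
    w₂ = NextArc.end n₂
    h₂ = NextArc.hit n₂
    back₂ : H w₂ w₁ ≡ true
    back₂ = trans (proj₁ sH w₂ w₁) h₂
    n₃ = nextArc (closed (sub _ _ back₂)) back₂
    w₃ = NextArc.end n₃
    h₃ = NextArc.hit n₃
    across : ∀ {x y z d} → H y z ≡ true → Orb (ribbon ρ H) d (y , z) → (x : NextArc z (ρ z y)) → Orb (ribbon ρ H) d (z , NextArc.end x)
    across h o x = orb-trans (subst (Orb (ribbon ρ H) _) (ribbon-in ρ H h) (orb-step o)) (NextArc.orbit x)
    o₁ : Orb (ribbon ρ H) (v , w) (v , w₁)
    o₁ = NextArc.orbit n₁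
    o₂ : Orb (ribbon ρ H) (v , w) (w₁ , w₂)
    o₂ = across {v} h₁ o₁ n₂
    o₃ : Orb (ribbon ρ H) (v , w) (w₂ , w₃)
    o₃ = across {v} h₂ o₂ n₃
    v≢w₁ : v ≢ w₁
    v≢w₁ = simple-≢ {H = H} sH h₁
    w₁≢w₂ : w₁ ≢ w₂
    w₁≢w₂ = simple-≢ {H = H} sH h₂
    closes : v ≡ w₂ → w₁ ≡ w₃ → ⊥
    closes v≡w₂ w₁≡w₃ with no-single v w₁ h₁
    ... | inj₁ (z , z≢v , h) = z≢v (turn-back (sub _ _ back₁) n₂ (sym v≡w₂) h)
    ... | inj₂ (z , z≢w₁ , h) = z≢w₁ (turn-back (sub _ _ back₂) n₃ (sym w₁≡w₃) (subst (λ x → H x z ≡ true) v≡w₂ h))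
    g : Fin 3 → Dart n
    g zero = v , w₁
    g (suc zero) = w₁ , w₂
    g (suc (suc zero)) = w₂ , w₃
    inj : ∀ i j → g i ≡ g j → i ≡ j
    inj zero zero _ = refl
    inj zero (suc zero) e = ⊥-elim (v≢w₁ (cong proj₁ e))
    inj zero (suc (suc zero)) e = ⊥-elim (closes (cong proj₁ e) (cong proj₂ e))
    inj (suc zero) zero e = ⊥-elim (v≢w₁ (sym (cong proj₁ e)))
    inj (suc zero) (suc zero) _ = refl
    inj (suc zero) (suc (suc zero)) e = ⊥-elim (w₁≢w₂ (cong proj₁ e))
    inj (suc (suc zero)) zero e = ⊥-elim (closes (sym (cong proj₁ e)) (sym (cong proj₂ e)))
    inj (suc (suc zero)) (suc zero) e = ⊥-elim (w₁≢w₂ (sym (cong proj₁ e)))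
    inj (suc (suc zero)) (suc (suc zero)) _ = refl
    good : ∀ i → arc H (g i) ≡ true × Orb (ribbon ρ H) (v , w) (g i)
    good zero = h₁ , o₁
    good (suc zero) = h₂ , o₂
    good (suc (suc zero)) = h₃ , o₃

  orbits-bound : NoSingleEdge → ∀ {k} → Classes (darts n) (Orb (ribbon ρ H)) k →
    3 * k ≤ (#edges H + #edges H) + 3 * (#isolated H + card (darts n) (absent A))
  orbits-bound no-single (t , tr , refl) = ≤-trans (≤-reflexive (trans (cong (3 *_) split) (*-distribˡ-+ 3 big rest))) (+-mono-≤ big-bound (*-monoʳ-≤ 3 rest-bound))
    where
    D = darts n
    open Transversal tr
    eq = orb-equiv D (ribbon ρ H) (ribbon-injective injective (proj₁ sH))
    alive : Dart n → Bool
    alive (v , w) = A v w ∧ not (isolated H v)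
    big = card D (λ d → t d ∧ alive d)
    rest = card D (λ d → t d ∧ not (alive d))
    split : card D t ≡ big + rest
    split = cnt-split t alive (Enum.elems D)
    big-bound : 3 * big ≤ #edges H + #edges H
    big-bound = subst (3 * big ≤_) (arcs-twice H sH) (card-triple D D {q = arc H} (Orb (ribbon ρ H))
      (λ {x} {x'} px px' o o' → indep (proj₁ (∧-true px)) (proj₁ (∧-true px')) (orb-trans o (IsEquivalence.sym eq o')))
      λ { (v , w) e → let a , i = ∧-true {A v w} (proj₂ (∧-true {t (v , w)} e)) in three-arcs no-single v w a (not-true i) })
    loose : Dart n → Bool
    loose d = t d ∧ not (alive d)
    S : Dart n → Fin n → Set
    S (v , w) x = v ≡ x
    lonely : ∀ {v w} → loose (v , w) ∧ arc A (v , w) ≡ true → t (v , w) ≡ true × A v w ≡ true × isolated H v ≡ true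
    lonely {v} {w} e with ∧-true {loose (v , w)} e
    ... | l , a with ∧-true {t (v , w)} l
    ...   | tv , ne with bool-cases (isolated H v)
    ...     | inj₁ i = tv , a , i
    ...     | inj₂ i = true≢false (∧-intro a (not-intro i)) (not-true ne)
    rest-bound : rest ≤ #isolated H + card D (absent A)
    rest-bound = ≤-trans (≤-reflexive (cnt-split loose (arc A) (Enum.elems D))) (+-mono-≤
      (card-inject D (vertices n) {q = isolated H} S (λ { {v , w} e → v , proj₂ (proj₂ (lonely e)) , refl }) same)
      (card-mono D λ {d} e → proj₂ (∧-true {loose d} e)))
      where
      same : ∀ {d d' x} → loose d ∧ arc A d ≡ true → loose d' ∧ arc A d' ≡ true → S d x → S d' x → d ≡ d'
      same {v , w} {.v , w'} e e' refl refl with lonely e | lonely e'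
      ... | td , a , i | td' , a' , _ with cyclic a a'
      ...   | k , refl = indep td td' (turn k λ j _ → isolated-elim H i _)

isolated-components : ∀ {n} (H : Adj n) → SimpleGraph H → ∀ {u v} → H u v ≡ true → suc (#isolated H) ≤ #components H
isolated-components {n} H (s , irr) {u} {v} h = subst (_≤ #components H)
    (card-insert (vertices n) (isolated H) p u (≢true λ i → true≢false h (isolated-elim H i v)) (∨-introʳ {isolated H u} (isYes⁺ (u ≟ u) refl))
      λ x x≢u → trans (cong (isolated H x ∨_) (isNo⁺ (x ≟ u) x≢u)) (∨-false (isolated H x)))
    (independent-≤ (vertices n) (reach-equiv s) p ind (components-classes H s))
  where
  p : Fin n → Bool
  p x = isolated H x ∨ ⌊ x ≟ u ⌋
  ∨-false : ∀ b → b ∨ false ≡ b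
  ∨-false true = refl
  ∨-false false = refl
  still : ∀ {x y} → isolated H x ≡ true → Reach H x y → x ≡ y
  still i here = refl
  still i (there e _) = true≢false e (isolated-elim H i _)
  ind : ∀ {x y} → p x ≡ true → p y ≡ true → Reach H x y → x ≡ y
  ind {x} {y} px py r with ∨-true {isolated H x} px | ∨-true {isolated H y} py
  ... | inj₁ i | _ = still i r
  ... | inj₂ _ | inj₁ j = sym (still j (reach-sym s r))
  ... | inj₂ e | inj₂ e' = trans (isYes⁻ (x ≟ u) e) (sym (isYes⁻ (y ≟ u) e'))

EdgeBound : ∀ {n} → Adj n → Set
EdgeBound {n} H = #edges H + 3 + 3 * #components H ≤ 3 * n

edge-bound-arith : ∀ {n l z e c i} → e + 2 * c + z ≤ n + l → 3 * l ≤ (e + e) + 3 * (i + z) → suc i ≤ c → e + 3 + 3 * c ≤ 3 * n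
edge-bound-arith {n} {l} {z} {e} {c} {i} h₁ h₂ h₃ = linear (e + e + 3 * z + 3 * c + 3 * l + 3 * i)
  (+-mono-≤ (+-mono-≤ (*-monoʳ-≤ 3 h₁) h₂) (*-monoʳ-≤ 3 h₃))
  (solve 6 (λ n l z e c i → e :+ con 3 :+ con 3 :* c :+ (e :+ e :+ con 3 :* z :+ con 3 :* c :+ con 3 :* l :+ con 3 :* i) :=
    con 3 :* (e :+ con 2 :* c :+ z) :+ con 3 :* l :+ con 3 :* (con 1 :+ i)) refl n l z e c i)
  (solve 6 (λ n l z e c i → con 3 :* (n :+ l) :+ (e :+ e :+ con 3 :* (i :+ z)) :+ con 3 :* c :=
    con 3 :* n :+ (e :+ e :+ con 3 :* z :+ con 3 :* c :+ con 3 :* l :+ con 3 :* i)) refl n l z e c i)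
  where open +-*-Solver

edge-bound-no-single : ∀ {n} {A : Adj n} → SimpleGraph A → Connected A → Planar A → ∀ {H} (sH : SimpleGraph H) (sub : H ⊆ A) →
  ∀ {u v} → H u v ≡ true → (∀ {ρ} (rot : TotalRotation A ρ) → NoSingleEdge rot sH sub) → EdgeBound H
edge-bound-no-single {n} {A} sA conn (ρ , isRot , euler) {H} sH sub {u} {v} h no-single =
  finish (orbit-classes (darts n) (ribbon ρ' H) (ribbon-injective (TotalRotation.injective rot) (proj₁ sH)))
  where
  ρ' = total A ρ
  rot : TotalRotation A ρ'
  rot = total-rotation isRot
  Z = card (darts n) (absent A)
  not-isolated : #isolated A ≡ 0
  not-isolated = ≤-antisym (≤-pred (subst (suc (#isolated A) ≤_) (connected-components (proj₁ sA) conn u) (isolated-components A sA (sub u v h)))) z≤n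
  start : EulerBound Z n A (#faces A ρ + Z)
  start = eulerBound (≤-reflexive (trans (cong (_+ Z) (trans (sym euler) (cong (λ i → n + (#faces A ρ + i)) not-isolated)))
    (trans (cong (λ f → n + f + Z) (+-identityʳ (#faces A ρ))) (+-assoc n (#faces A ρ) Z))))
  finish : (∃ λ k → Classes (darts n) (Orb (ribbon ρ' H)) k) → EdgeBound H
  finish (l , c) = edge-bound-arith {n} {l} {Z} {#edges H} {#components H} {#isolated H}
    (EulerBound.bound (euler-subgraph ρ' (TotalRotation.injective rot) A sA
      (#faces-classes sA (λ e → sym (total-in A ρ e)) rot) start H sH sub c))
    (orbits-bound rot sH sub (no-single rot) c) (isolated-components H sH h)

components<vertices : ∀ {n} {K : Adj n} → SimpleGraph K → ∀ {x y} → K x y ≡ true → suc (#components K) ≤ n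
components<vertices {n} {K} sK {x} {y} k = ≤-trans (s≤s (components-mono (addEdge-symmetric {H = edgeless} (λ _ _ → refl) x y) (proj₁ sK)
    (reach-mono (addEdge-⊆ {H = edgeless} {K} (proj₁ sK) (λ _ _ ()) k))))
  (≤-reflexive (trans (sym (components-join {H = edgeless} (λ _ _ → refl) apart)) (edgeless-components n)))
  where
  apart : ¬ Reach (edgeless {n}) x y
  apart here = simple-≢ {H = K} sK k refl
  apart (there () _)

-- An edge that is a component of its own is deleted first, so that afterwards every boundary walk has length at least three.
edge-bound : ∀ {n} {A : Adj n} → SimpleGraph A → Connected A → Planar A → ∀ H → SimpleGraph H → H ⊆ A → 2 ≤ #edges H → EdgeBound H
edge-bound {n} {A} sA conn pl H sH sub two = go (suc (#edges H)) H ≤-refl sH sub two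
  where
  singleB : Adj n → Fin n → Fin n → Bool
  singleB H u v = H u v ∧ (all (λ w → ⌊ w ≟ u ⌋ ∨ not (H v w)) (allFin n) ∧ all (λ w → ⌊ w ≟ v ⌋ ∨ not (H u w)) (allFin n))
  only : ∀ (H : Adj n) {u v} → all (λ w → ⌊ w ≟ u ⌋ ∨ not (H v w)) (allFin n) ≡ true → ∀ {w} → H v w ≡ true → w ≡ u
  only H {u} e {w} h with ∨-true {⌊ w ≟ u ⌋} (all-elim _ (allFin n) e (∈-allFin w))
  ... | inj₁ y = isYes⁻ (w ≟ u) y
  ... | inj₂ x = true≢false h (not-true x)
  other : ∀ (H : Adj n) {u v} → all (λ w → ⌊ w ≟ u ⌋ ∨ not (H v w)) (allFin n) ≡ false → ∃ λ w → w ≢ u × H v w ≡ true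
  other H {u} {v} e with all-false (λ w → ⌊ w ≟ u ⌋ ∨ not (H v w)) (allFin n) e
  ... | w , _ , q with bool-cases (H v w)
  ...   | inj₂ h = true≢false (∨-introʳ {⌊ w ≟ u ⌋} (not-intro h)) q
  ...   | inj₁ h = w , (λ w≡u → true≢false (∨-introˡ {b = not (H v w)} (isYes⁺ (w ≟ u) w≡u)) q) , h
  arith : ∀ {e e' c c'} → e ≡ suc e' → c' ≡ suc c → e' + 3 + 3 * c' ≤ 3 * n → e + 3 + 3 * c ≤ 3 * n
  arith {e' = e'} {c = c} refl refl ih = ≤-trans (m≤n+m _ 2) (≤-trans (≤-reflexive
    (solve 2 (λ e c → con 2 :+ (con 1 :+ e :+ con 3 :+ con 3 :* c) := e :+ con 3 :+ con 3 :* (con 1 :+ c)) refl e' c)) ih)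
    where open +-*-Solver
  arith' : ∀ {e e' c c'} → e ≡ suc e' → c' ≡ suc c → e' ≤ 1 → suc c' ≤ n → e + 3 + 3 * c ≤ 3 * n
  arith' {e' = e'} {c = c} refl refl small rank = ≤-trans (+-monoˡ-≤ (3 * c) (+-monoˡ-≤ 3 (s≤s small))) (≤-trans (m≤n+m _ 1) (≤-trans (≤-reflexive
    (solve 1 (λ c → con 1 :+ (con 2 :+ con 3 :+ con 3 :* c) := con 3 :* (con 2 :+ c)) refl c)) (*-monoʳ-≤ 3 rank)))
    where open +-*-Solver
  go : ∀ m H → #edges H < m → SimpleGraph H → H ⊆ A → 2 ≤ #edges H → EdgeBound H
  go (suc m) H (s≤s bound) sH sub two with any? (λ u → any? (λ v → singleB H u v ≟ᵇ true))
  ... | no none = let u , v , h = edge-exists {H = H} (≤-trans (s≤s z≤n) two) in edge-bound-no-single sA conn pl sH sub h λ _ → no-single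
    where
    no-single : ∀ u v → H u v ≡ true → (∃ λ w → w ≢ u × H v w ≡ true) ⊎ (∃ λ w → w ≢ v × H u w ≡ true)
    no-single u v h with bool-cases (all (λ w → ⌊ w ≟ u ⌋ ∨ not (H v w)) (allFin n)) | bool-cases (all (λ w → ⌊ w ≟ v ⌋ ∨ not (H u w)) (allFin n))
    ... | inj₂ f | _ = inj₁ (other H f)
    ... | inj₁ _ | inj₂ f = inj₂ (other H f)
    ... | inj₁ t | inj₁ t' = ⊥-elim (none (u , v , ∧-intro h (∧-intro t t')))
  ... | yes (u , v , e) = case 2 ≤? #edges K of λ
      { (yes two') → arith (edges-delEdge {H = H} sH h) comps (go m K (≤-trans (≤-reflexive (sym (edges-delEdge {H = H} sH h))) bound) sK (λ x y k → sub x y (delEdge-⊆ H u v x y k)) two')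
      ; (no small) → arith' (edges-delEdge {H = H} sH h) comps (≤-pred (≰⇒> small))
          (let x , y , k = edge-exists {H = K} (≤-pred (≤-trans two (≤-reflexive (edges-delEdge {H = H} sH h)))) in components<vertices {K = K} sK k) }
    where
    K = delEdge H u v
    sK : SimpleGraph K
    sK = delEdge-simple sH u v
    h : H u v ≡ true
    h = proj₁ (∧-true e)
    apart : ¬ Reach K u v
    apart here = simple-≢ {H = H} sH h refl
    apart (there {w = w} k _) with only H (proj₂ (∧-true {all (λ w → ⌊ w ≟ u ⌋ ∨ not (H v w)) (allFin n)} (proj₂ (∧-true {H u v} e)))) (delEdge-⊆ H u v u w k)
    ... | refl = true≢false k (delEdge-absent H u v)
    comps : #components K ≡ suc (#components H)
    comps = trans (components-join (proj₁ sK) apart) (cong suc (#components-cong (addEdge-symmetric (proj₁ sK) u v) (proj₁ sH) (addEdge-delEdge (proj₁ sH) h)))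

-- Joining two components

ind : Bool → ℕ
ind b = if b then 1 else 0

card-ind : {X : Set} (E : Enum X) (p : X → Bool) (a : X) → card E p ≡ ind (p a) + card E (without (Enum._≡?_ E) p a)
card-ind E p a with bool-cases (p a)
... | inj₁ e = trans (card-without E p e) (cong (λ b → ind b + card E (without (Enum._≡?_ E) p a)) (sym e))
... | inj₂ e = trans (card-cong E (λ x → sym (without-absent (Enum._≡?_ E) p e x))) (cong (λ b → ind b + card E (without (Enum._≡?_ E) p a)) (sym e))

record LocalRotation {n} (N : Fin n → Bool) (r : Fin n → Fin n) : Set where
  field
    off : ∀ {x} → N x ≡ false → r x ≡ x
    injective : Injective r
    closed : ∀ {x} → N x ≡ true → N (r x) ≡ true
    cyclic : ∀ {x y} → N x ≡ true → N y ≡ true → Orb r x y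

local : ∀ {n} {A : Adj n} {ρ : Rotation n} → TotalRotation A ρ → ∀ u → LocalRotation (A u) (ρ u)
local rot u = record { off = off ; injective = injective u ; closed = closed ; cyclic = cyclic }
  where open TotalRotation rot

unlocal : ∀ {n} {A : Adj n} {ρ : Rotation n} → (∀ u → LocalRotation (A u) (ρ u)) → TotalRotation A ρ
unlocal rot = record
  { off = λ {u} → LocalRotation.off (rot u) ; injective = λ u → LocalRotation.injective (rot u)
  ; closed = λ {u} → LocalRotation.closed (rot u) ; cyclic = λ {u} → LocalRotation.cyclic (rot u) }

local-cong : ∀ {n} {N N' : Fin n → Bool} {r : Fin n → Fin n} → (∀ x → N x ≡ N' x) → LocalRotation N r → LocalRotation N' r
local-cong e rot = record
  { off = λ {x} q → off (trans (e x) q) ; injective = injective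
  ; closed = λ {x} q → trans (sym (e _)) (closed (trans (e x) q)) ; cyclic = λ p q → cyclic (trans (e _) p) (trans (e _) q) }
  where open LocalRotation rot

local-first : ∀ {n} {N : Fin n → Bool} {r : Fin n → Fin n} → LocalRotation N r → (∀ x → N x ≡ false) → ∀ {N' : Fin n → Bool} {z} →
  (∀ x → x ≢ z → N' x ≡ N x) → N' z ≡ true → LocalRotation N' r
local-first {N = N} {r} rot empty {N'} {z} same new = record
  { off = λ {x} _ → off (empty x) ; injective = injective
  ; closed = λ {x} e → trans (cong N' (off (empty x))) e
  ; cyclic = λ e e' → subst (Orb r _) (trans (only e) (sym (only e'))) orb-refl }
  where
  open LocalRotation rot
  only : ∀ {x} → N' x ≡ true → x ≡ z
  only {x} e with x ≟ z
  ... | yes x≡z = x≡z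
  ... | no x≢z = true≢false e (trans (same x x≢z) (empty x))

local-insert : ∀ {n} {N : Fin n → Bool} {r : Fin n → Fin n} → LocalRotation N r → ∀ {p z} → N p ≡ true → N z ≡ false → ∀ {N' : Fin n → Bool} →
  (∀ x → x ≢ z → N' x ≡ N x) → N' z ≡ true → LocalRotation N' (swapAt _≟_ r p z)
local-insert {n} {N} {r} rot {p} {z} np nz {N'} same new = record
  { off = off' ; injective = inj' ; closed = closed' ; cyclic = λ {x} {y} e e' → merge⇒swapped (vertices n) inj' injective s apart (cyc x y e e') }
  where
  open LocalRotation rot
  s = swapAt-swapped _≟_ r p z
  inj' : Injective (swapAt _≟_ r p z)
  inj' = swapped-injective _≟_ injective s
  old : ∀ {x} → N x ≡ true → N' x ≡ true
  old {x} e = trans (same x λ { refl → true≢false e nz }) e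
  off' : ∀ {x} → N' x ≡ false → swapAt _≟_ r p z x ≡ x
  off' {x} e = trans (Swapped.off s x (λ { refl → true≢false (old np) e }) x≢z) (off (trans (sym (same x x≢z)) e))
    where
    x≢z : x ≢ z
    x≢z refl = true≢false new e
  closed' : ∀ {x} → N' x ≡ true → N' (swapAt _≟_ r p z x) ≡ true
  closed' {x} e with x ≟ p | x ≟ z
  ... | yes refl | _ = trans (cong N' (off nz)) new
  ... | no x≢p | yes refl = old (closed np)
  ... | no x≢p | no x≢z = old (closed (trans (sym (same x x≢z)) e))
  apart : ¬ Orb r p z
  apart o = true≢false (orb-least r {λ x → N x ≡ true} np closed o) nz
  cyc : ∀ x y → N' x ≡ true → N' y ≡ true → Merge (Orb r) p z x y
  cyc x y e e' with x ≟ z | y ≟ z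
  ... | yes refl | yes refl = inj₁ orb-refl
  ... | yes refl | no y≢z = inj₂ (inj₂ (orb-refl , cyclic (trans (sym (same y y≢z)) e') np))
  ... | no x≢z | yes refl = inj₂ (inj₁ (cyclic (trans (sym (same x x≢z)) e) np , orb-refl))
  ... | no x≢z | no y≢z = inj₁ (cyclic (trans (sym (same x x≢z)) e) (trans (sym (same y y≢z)) e'))

update : ∀ {n} → Rotation n → Fin n → (Fin n → Fin n) → Rotation n
update ρ u r x = if ⌊ x ≟ u ⌋ then r else ρ x

update-at : ∀ {n} (ρ : Rotation n) u r → update ρ u r u ≡ r
update-at ρ u r rewrite isYes⁺ (u ≟ u) refl = refl

update-off : ∀ {n} (ρ : Rotation n) u r {x} → x ≢ u → update ρ u r x ≡ ρ x
update-off ρ u r {x} x≢u rewrite isNo⁺ (x ≟ u) x≢u = refl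

-- Before the insertion (u , z) is a fixed point; placing it after p in the rotation at u is the transposition of (p , u) and (u , z).
attach : ∀ {n} {A : Adj n} → SimpleGraph A → (ρ : Rotation n) → (∀ x → Injective (ρ x)) → ∀ {u z} → A u z ≡ false → LocalRotation (A u) (ρ u) →
  ∀ {N' : Fin n → Bool} → (∀ x → x ≢ z → N' x ≡ A u x) → N' z ≡ true → ∀ {k} → Classes (darts n) (Orb (ribbon ρ A)) k →
  ∃ λ r → LocalRotation N' r × (∃ λ k' → suc k' ≡ k + ind (isolated A u) × Classes (darts n) (Orb (ribbon (update ρ u r) A)) k')
attach {n} {A} sA@(s , _) ρ inj {u} {z} e loc {N'} same new {k} c with bool-cases (isolated A u)
... | inj₁ i = ρ u , local-first loc (isolated-elim A i) same new , k ,
    trans (+-comm 1 k) (cong (λ b → k + ind b) (sym i)) , orb-classes-cong (darts n) unchanged c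
  where
  trivial : ∀ x y → update ρ u (ρ u) x y ≡ ρ x y
  trivial x y with x ≟ u
  ... | yes refl = refl
  ... | no _ = refl
  unchanged : ∀ d → ribbon ρ A d ≡ ribbon (update ρ u (ρ u)) A d
  unchanged (x , y) = cong₂ (λ a b → if A x y then (y , a) else (x , b)) (sym (trivial y x)) (sym (trivial x y))
... | inj₂ i with isolated-false A i
...   | p , up = r , local-insert loc up e same new , finish (swapped-merges (darts n) (swapped-injective (Enum._≡?_ (darts n)) injρ swapped) injρ swapped apart c)
  where
  r = swapAt _≟_ (ρ u) p z
  S = swapAt-swapped _≟_ (ρ u) p z
  ρ' = update ρ u r
  injρ : Injective (ribbon ρ A)
  injρ = ribbon-injective inj s
  pu : A p u ≡ true
  pu = trans (s p u) up
  r-at : ∀ y → ρ' u y ≡ r y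
  r-at y = cong (λ f → f y) (update-at ρ u r)
  fixed : ribbon ρ A (u , z) ≡ (u , z)
  fixed = trans (ribbon-out ρ A e) (cong (u ,_) (LocalRotation.off loc e))
  off : ∀ d → d ≢ (p , u) → d ≢ (u , z) → ribbon ρ' A d ≡ ribbon ρ A d
  off (x , y) ne ne' with bool-cases (A x y)
  ... | inj₁ a = trans (ribbon-in ρ' A a) (trans (cong (y ,_) step-at) (sym (ribbon-in ρ A a)))
    where
    step-at : ρ' y x ≡ ρ y x
    step-at with y ≟ u
    ... | no _ = refl
    ... | yes refl = Swapped.off S x (λ { refl → ne refl }) (λ { refl → true≢false (trans (s y x) a) e })
  ... | inj₂ a = trans (ribbon-out ρ' A a) (trans (cong (x ,_) step-at) (sym (ribbon-out ρ A a)))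
    where
    step-at : ρ' x y ≡ ρ x y
    step-at with x ≟ u
    ... | no _ = refl
    ... | yes refl = Swapped.off S y (λ { refl → true≢false up a }) (λ { refl → ne' refl })
  swapped : Swapped (ribbon ρ' A) (ribbon ρ A) (p , u) (u , z)
  swapped = record
    { at-a = trans (ribbon-in ρ' A pu) (trans (cong (u ,_) (trans (r-at p) (Swapped.at-a S))) (sym (ribbon-out ρ A e)))
    ; at-b = trans (ribbon-out ρ' A e) (trans (cong (u ,_) (trans (r-at z) (Swapped.at-b S))) (sym (ribbon-in ρ A pu)))
    ; off = off }
  apart : ¬ Orb (ribbon ρ A) (p , u) (u , z)
  apart o = simple-≢ {H = A} sA pu (cong proj₁ (orb-least (ribbon ρ A) {λ d → d ≡ (u , z)} refl (λ { refl → fixed }) (orb-sym (darts n) (ribbon ρ A) injρ o)))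
  finish : (∃ λ k' → k ≡ suc k' × Classes (darts n) (Orb (ribbon ρ' A)) k') → ∃ λ k' → suc k' ≡ k + ind (isolated A u) × Classes (darts n) (Orb (ribbon ρ' A)) k'
  finish (k' , refl , c') = k' , trans (sym (+-identityʳ (suc k'))) (cong (λ b → suc k' + ind b) (sym i)) , c'

join-arith : ∀ {n F F' Z Z' k₁ k₂ k' I I' iu iv E E' C C'} →
  suc k₁ ≡ F + Z + iu → suc k₂ ≡ k₁ + iv → k₂ ≡ suc k' → F' + Z' ≡ k' → Z ≡ suc (suc Z') → I ≡ iu + (iv + I') → E' ≡ suc E → C ≡ suc C' →
  n + (F + I) ≡ E + 2 * C → n + (F' + I') ≡ E' + 2 * C'
join-arith {n} {F} {F'} {Z' = Z'} {k₁} {k' = k'} {I' = I'} {iu} {iv} {E} {C' = C'} e₁ e₂ refl refl refl refl refl refl euler =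
  +-cancelʳ-≡ (k₁ + iu + iv + F + Z' + 3) _ _ (trans
    (solve 9 (λ n F F' Z' k₁ I' iu iv E → n :+ (F' :+ I') :+ (k₁ :+ iu :+ iv :+ F :+ Z' :+ con 3) :=
      (con 1 :+ (con 1 :+ (F' :+ Z'))) :+ (con 1 :+ k₁) :+ (n :+ (F :+ (iu :+ (iv :+ I'))))) refl n F F' Z' k₁ I' iu iv E)
    (trans (cong₂ _+_ (cong₂ _+_ e₂ e₁) euler)
    (solve 7 (λ F Z' k₁ iu iv E C' → k₁ :+ iv :+ (F :+ (con 2 :+ Z') :+ iu) :+ (E :+ con 2 :* (con 1 :+ C')) :=
      con 1 :+ E :+ con 2 :* C' :+ (k₁ :+ iu :+ iv :+ F :+ Z' :+ con 3)) refl F Z' k₁ iu iv E C')))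
  where open +-*-Solver

edgeB-other : ∀ {n} {u v x y : Fin n} → ¬ ((x ≡ u × y ≡ v) ⊎ (x ≡ v × y ≡ u)) → edgeB u v x y ≡ false
edgeB-other ne = ≢true λ e → ne (edgeB-elim e)

∨-falseʳ : ∀ {a b} → b ≡ false → a ∨ b ≡ a
∨-falseʳ {true} _ = refl
∨-falseʳ {false} e = e

addEdge-off : ∀ {n} (A : Adj n) {u v x y} → ¬ ((x ≡ u × y ≡ v) ⊎ (x ≡ v × y ≡ u)) → addEdge A u v x y ≡ A x y
addEdge-off A {u} {v} {x} {y} ne = ∨-falseʳ {A x y} (edgeB-other {u = u} {v} ne)

planar-join : ∀ {n} {A : Adj n} → SimpleGraph A → Planar A → ∀ {u v} → ¬ Reach A u v → Planar (addEdge A u v)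
planar-join {n} {A} sA@(s , _) (ρ₀ , isRot , euler) {u} {v} u≁v = build
    (attach sA ρ injective {u} {v} uv (local rot u) {A' u}
      (λ x x≢v → addEdge-off A λ { (inj₁ (_ , q)) → x≢v q ; (inj₂ (p , _)) → u≢v p }) (addEdge-new A u v) c₀)
  where
  ρ = total A ρ₀
  rot : TotalRotation A ρ
  rot = total-rotation isRot
  open TotalRotation rot
  A' = addEdge A u v
  D = darts n
  Z = card D (absent A)
  u≢v : u ≢ v
  u≢v refl = u≁v here
  uv : A u v ≡ false
  uv = ≢true λ e → u≁v (reach-edge e)
  vu : A v u ≡ false
  vu = trans (s v u) uv
  sA' : SimpleGraph A'
  sA' = addEdge-simple sA u≢v
  c₀ : Classes D (Orb (ribbon ρ A)) (#faces A ρ₀ + Z)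
  c₀ = #faces-classes sA (λ e → sym (total-in A ρ₀ e)) rot
  isolated-count : #isolated A ≡ ind (isolated A u) + (ind (isolated A v) + #isolated A')
  isolated-count = trans (card-ind V (isolated A) u) (cong (ind (isolated A u) +_) (trans (card-ind V p v)
      (cong₂ (λ b m → ind b + m) (bool-ext (λ e → proj₁ (without-elim _≟_ (isolated A) {u} {v} e)) (λ e → without-intro _≟_ (isolated A) e (u≢v ∘ sym)))
        (card-cong V λ x → bool-ext (to x) (from x)))))
    where
    V = vertices n
    p = without _≟_ (isolated A) u
    to : ∀ x → without _≟_ p v x ≡ true → isolated A' x ≡ true
    to x e with without-elim _≟_ p {v} {x} e
    ... | e' , x≢v with without-elim _≟_ (isolated A) {u} {x} e'
    ...   | i , x≢u = all-intro _ (allFin n) λ {w} _ → not-intro (trans (addEdge-off A λ { (inj₁ (q , _)) → x≢u q ; (inj₂ (q , _)) → x≢v q }) (isolated-elim A i w))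
    from : ∀ x → isolated A' x ≡ true → without _≟_ p v x ≡ true
    from x i = without-intro _≟_ p (without-intro _≟_ (isolated A)
        (all-intro _ (allFin n) λ {w} _ → not-intro (≢true λ e → true≢false (addEdge-⊇ A u v x w e) (isolated-elim A' i w)))
        λ { refl → true≢false (addEdge-new A u v) (isolated-elim A' i v) })
        λ { refl → true≢false (addEdge-new' A u v) (isolated-elim A' i u) }
  absent-count : Z ≡ suc (suc (card D (absent A')))
  absent-count = trans (card-without D (absent A) {u , v} (not-intro uv)) (cong suc (trans
      (card-without D p {v , u} (without-intro _≟ᵈ_ (absent A) (not-intro vu) (λ e → u≢v (sym (cong proj₁ e)))))
      (cong suc (card-cong D λ d → bool-ext (to d) (from d)))))
    where
    _≟ᵈ_ = Enum._≡?_ D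
    p = without _≟ᵈ_ (absent A) (u , v)
    to : ∀ d → without _≟ᵈ_ p (v , u) d ≡ true → absent A' d ≡ true
    to (x , y) e with without-elim _≟ᵈ_ p {v , u} {x , y} e
    ... | e' , ne with without-elim _≟ᵈ_ (absent A) {u , v} {x , y} e'
    ...   | a , ne' = not-intro (trans (addEdge-off A λ { (inj₁ (refl , refl)) → ne' refl ; (inj₂ (refl , refl)) → ne refl }) (not-true a))
    from : ∀ d → absent A' d ≡ true → without _≟ᵈ_ p (v , u) d ≡ true
    from (x , y) a = without-intro _≟ᵈ_ p (without-intro _≟ᵈ_ (absent A)
        (not-intro (≢true λ e → true≢false (addEdge-⊇ A u v x y e) (not-true a)))
        λ { refl → true≢false (addEdge-new A u v) (not-true a) })
        λ { refl → true≢false (addEdge-new' A u v) (not-true a) }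
  build : (∃ λ r → LocalRotation (A' u) r × (∃ λ k → suc k ≡ #faces A ρ₀ + Z + ind (isolated A u) × Classes D (Orb (ribbon (update ρ u r) A)) k)) → Planar A'
  build (r , loc , k₁ , e₁ , c₁) = build' (attach sA ρ₁ inj₁ᵣ {v} {u} vu (subst (LocalRotation (A v)) (sym at-v) (local rot v)) {A' v}
      (λ x x≢u → addEdge-off A λ { (inj₁ (p , _)) → u≢v (sym p) ; (inj₂ (_ , q)) → x≢u q }) (addEdge-new' A u v) c₁)
    where
    ρ₁ = update ρ u r
    at-v : ρ₁ v ≡ ρ v
    at-v = update-off ρ u r (u≢v ∘ sym)
    inj₁ᵣ : ∀ x → Injective (ρ₁ x)
    inj₁ᵣ x with x ≟ u
    ... | yes refl = LocalRotation.injective loc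
    ... | no _ = injective x
    build' : (∃ λ r' → LocalRotation (A' v) r' × (∃ λ k → suc k ≡ k₁ + ind (isolated A v) × Classes D (Orb (ribbon (update ρ₁ v r') A)) k)) → Planar A'
    build' (r' , loc' , k₂ , e₂ , c₂) = finish (swapped-merges D (ribbon-injective inj₂ᵣ (proj₁ sA')) (ribbon-injective inj₂ᵣ s)
          (ribbon-addEdge ρ₂ s uv) (λ o → u≁v (ribbon-tail ρ₂ A o)) c₂)
      where
      ρ₂ = update ρ₁ v r'
      at : ∀ x → Dec (x ≡ v) → Dec (x ≡ u) → LocalRotation (A' x) (ρ₂ x)
      at x (yes refl) _ = subst (LocalRotation (A' x)) (sym (update-at ρ₁ x r')) loc'
      at x (no x≢v) (yes refl) = subst (LocalRotation (A' x)) (sym (trans (update-off ρ₁ v r' x≢v) (update-at ρ x r))) loc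
      at x (no x≢v) (no x≢u) = subst (LocalRotation (A' x)) (sym (trans (update-off ρ₁ v r' x≢v) (update-off ρ u r x≢u)))
        (local-cong (λ y → sym (addEdge-off A λ { (inj₁ (p , _)) → x≢u p ; (inj₂ (p , _)) → x≢v p })) (local rot x))
      rot₂ : TotalRotation A' ρ₂
      rot₂ = unlocal λ x → at x (x ≟ v) (x ≟ u)
      inj₂ᵣ = TotalRotation.injective rot₂
      finish : (∃ λ k' → k₂ ≡ suc k' × Classes D (Orb (ribbon ρ₂ A')) k') → Planar A'
      finish (k' , e₃ , c₃) = ρ₂ , total⇒isRotation rot₂ ,
        join-arith {n} {#faces A ρ₀} {#faces A' ρ₂} {Z} {card D (absent A')} {k₁} {k₂} {k'} {#isolated A} {#isolated A'} {ind (isolated A u)} {ind (isolated A v)}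
          {#edges A} {#edges A'} {#components A} {#components A'} e₁ e₂ e₃
          (classes-unique D (orb-equiv D _ (ribbon-injective inj₂ᵣ (proj₁ sA'))) (#faces-classes sA' (λ _ → refl) rot₂) c₃)
          absent-count isolated-count (edges-addEdge A s u≢v uv) (components-join s u≁v) euler

maximal⇒connected : ∀ {n} {A : Adj n} → MaximalPlanar A → Connected A
maximal⇒connected {n} {A} (sA , pl , maximal) u v with reach? A u v
... | yes r = r
... | no ¬r = ⊥-elim (maximal u v (λ { refl → ¬r here }) (≢true λ e → ¬r (reach-edge e)) (planar-join sA pl ¬r))

-- Forests and spanning trees

Forest : ∀ {n} → Adj n → Set
Forest {n} H = #edges H + #components H ≤ n

forest-edges : ∀ {n} {H : Adj n} → SimpleGraph H → Forest H → #edges H + #components H ≡ n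
forest-edges {H = H} sH forest = ≤-antisym forest (edges+components H sH)

edgeless-forest : ∀ n → Forest (edgeless {n})
edgeless-forest n = ≤-reflexive (cong₂ _+_ (edgeless-edges n) (edgeless-components n))

forest-addEdge : ∀ {n} (H : Adj n) → SimpleGraph H → ∀ {u v} → ¬ Reach H u v → Forest H → Forest (addEdge H u v)
forest-addEdge {n} H sH {u} {v} ¬r forest = subst (_≤ n) (trans (cong (#edges H +_) (components-join (proj₁ sH) ¬r))
  (trans (+-suc (#edges H) _) (cong (_+ #components (addEdge H u v)) (sym (edges-addEdge H (proj₁ sH) (λ { refl → ¬r here }) (≢true λ e → ¬r (reach-edge e))))))) forest

forest-subgraph : ∀ {n} {H K : Adj n} → SimpleGraph H → SimpleGraph K → K ⊆ H → Forest H → Forest K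
forest-subgraph {n} {H} {K} sH sK sub forest = finish (grow H sH (λ L → Forest L → Forest K) next K sK sub λ r → r)
  where
  next : ∀ L u v → SimpleGraph L → L ⊆ H → H u v ≡ true → L u v ≡ false → (Forest L → Forest K) → Forest (addEdge L u v) → Forest K
  next L u v sL _ h l ih f = ih (≤-trans (+-monoʳ-≤ (#edges L) (components-≤suc (proj₁ sL) u v))
    (subst (_≤ n) (trans (cong (_+ #components (addEdge L u v)) (edges-addEdge L (proj₁ sL) (simple-≢ {H = H} sH h) l)) (sym (+-suc (#edges L) _))) f))
  finish : (∃ λ L → SimpleGraph L × (∀ u v → L u v ≡ H u v) × (Forest L → Forest K)) → Forest K
  finish (L , sL , e , f) = f (subst (_≤ n) (cong₂ _+_ (#edges-cong {H = H} {L} λ u v → sym (e u v)) (#components-cong (proj₁ sH) (proj₁ sL) λ u v → sym (e u v))) forest)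

path-linked : ∀ {n} {H T : Adj n} → H ⊆ T → ∀ {x y z l} → Path H x y l → T y z ≡ true → Linked (λ a b → T a b ≡ true) (l ∷ʳ z)
path-linked sub single e = e ∷ [-]
path-linked sub (step h _ single) e = sub _ _ h ∷ (e ∷ [-])
path-linked sub (step h _ p@(step _ _ _)) e = sub _ _ h ∷ path-linked sub p e

acyclic⇒forest : ∀ {n} {T : Adj n} → SimpleGraph T → Acyclic T → Forest T
acyclic⇒forest {n} {T} sT acyclic = finish (grow T sT Forest next edgeless edgeless-simple (λ _ _ ()) (edgeless-forest n))
  where
  apart : ∀ {K u v} → K ⊆ T → T u v ≡ true → K u v ≡ false → ¬ Reach K u v
  apart {K} {u} {v} sub t k r with reach⇒path r
  ... | _ , single = simple-≢ {H = T} sT t refl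
  ... | _ , step h _ single = true≢false h k
  ... | _ , p@(step _ _ (step _ _ single)) = acyclic _ (s≤s (s≤s z≤n) , path-unique p , path-linked sub p (trans (proj₁ sT v u) t))
  ... | _ , p@(step _ _ (step _ _ (step _ _ _))) = acyclic _ (s≤s (s≤s z≤n) , path-unique p , path-linked sub p (trans (proj₁ sT v u) t))
  next : ∀ K u v → SimpleGraph K → K ⊆ T → T u v ≡ true → K u v ≡ false → Forest K → Forest (addEdge K u v)
  next K u v sK sub t k = forest-addEdge K sK (apart sub t k)
  finish : (∃ λ L → SimpleGraph L × (∀ u v → L u v ≡ T u v) × Forest L) → Forest T
  finish (L , sL , e , f) = subst (_≤ n) (cong₂ _+_ (#edges-cong {H = L} {T} e) (#components-cong (proj₁ sL) (proj₁ sT) e)) f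

last : {X : Set} → X → List X → X
last a [] = a
last a (b ∷ bs) = last b bs

last-∈ : {X : Set} (a b : X) (bs : List X) → last a (b ∷ bs) ∈ b ∷ bs
last-∈ a b [] = here refl
last-∈ a b (c ∷ bs) = there (last-∈ b c bs)

closing-edge : ∀ {n} {T : Adj n} {x} a ys → Linked (λ a b → T a b ≡ true) ((a ∷ ys) ∷ʳ x) → T (last a ys) x ≡ true
closing-edge a [] (e ∷ _) = e
closing-edge a (b ∷ bs) (_ ∷ l) = closing-edge b bs l

avoiding-walk : ∀ {n} {T : Adj n} {x} z a ys → x ∉ (a ∷ ys) → Linked (λ a b → T a b ≡ true) ((a ∷ ys) ∷ʳ x) → Reach (delEdge T x z) a (last a ys)
avoiding-walk z a [] _ _ = here
avoiding-walk {T = T} {x} z a (b ∷ bs) x∉ (e ∷ l) = there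
  (delEdge-intro T e λ { (inj₁ (a≡x , _)) → x∉ (here (sym a≡x)) ; (inj₂ (_ , b≡x)) → x∉ (there (here (sym b≡x))) })
  (avoiding-walk z b bs (x∉ ∘ there) l)

-- Deleting an edge of a cycle keeps the number of components, so a graph with a cycle has more than n - C edges.
forest⇒acyclic : ∀ {n} {T : Adj n} → SimpleGraph T → Forest T → Acyclic T
forest⇒acyclic {n} {T} sT forest (x ∷ y ∷ w ∷ ws) (_ , (x-fresh ∷ (y-fresh ∷ _)) , (e ∷ l)) = 1+n≰n (≤-trans (s≤s (edges+components K sK)) (≤-trans (≤-reflexive tally) forest))
  where
  z = last y (w ∷ ws)
  K = delEdge T x z
  sK : SimpleGraph K
  sK = delEdge-simple sT x z
  zx : T z x ≡ true
  zx = closing-edge {T = T} y (w ∷ ws) l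
  xz : T x z ≡ true
  xz = trans (proj₁ sT x z) zx
  around : Reach K x z
  around = there (delEdge-intro T e λ { (inj₁ (_ , y≡z)) → All-lookup y-fresh (last-∈ y w ws) y≡z ; (inj₂ (_ , y≡x)) → All-lookup x-fresh (here refl) (sym y≡x) })
    (avoiding-walk {T = T} z y (w ∷ ws) (λ m → All-lookup x-fresh m refl) l)
  tally : suc (#edges K + #components K) ≡ #edges T + #components T
  tally = sym (cong₂ _+_ (edges-delEdge {H = T} sT xz) (trans (#components-cong (proj₁ sT) (addEdge-symmetric (proj₁ sK) x z) (λ u v → sym (addEdge-delEdge (proj₁ sT) xz u v)))
    (components-same (proj₁ sK) around)))
forest⇒acyclic sT forest (x ∷ []) (() , _)
forest⇒acyclic sT forest (x ∷ y ∷ []) (s≤s () , _)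

forest-extend : ∀ {n} {H : Adj n} → SimpleGraph H → ∀ P → SimpleGraph P → P ⊆ H → Forest P → ∀ j → #components H ≤ j → j ≤ #components P →
  ∃ λ Q → SimpleGraph Q × P ⊆ Q × Q ⊆ H × Forest Q × #components Q ≡ j
forest-extend {n} {H} sH P sP sub forest j low high with m≤n⇒∃[o]m+o≡n high
... | m , e = go m P sP sub forest (trans (sym e) (+-comm j m))
  where
  go : ∀ m P → SimpleGraph P → P ⊆ H → Forest P → #components P ≡ m + j → ∃ λ Q → SimpleGraph Q × P ⊆ Q × Q ⊆ H × Forest Q × #components Q ≡ j
  go zero P sP sub forest e = P , sP , (λ _ _ p → p) , sub , forest , e
  go (suc m) P sP sub forest e with any? (λ u → any? (λ v → (H u v ∧ not (reachB P n u v)) ≟ᵇ true))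
  ... | yes (u , v , q) = let Q , sQ , up , r = go m (addEdge P u v) (addEdge-simple sP (λ { refl → ¬r here })) (addEdge-⊆ (proj₁ sH) sub h) (forest-addEdge P sP ¬r forest)
                                (suc-injective (trans (sym (components-join (proj₁ sP) ¬r)) e))
                          in Q , sQ , (λ x y p → up x y (addEdge-⊇ P u v x y p)) , r
    where
    h : H u v ≡ true
    h = proj₁ (∧-true q)
    ¬r : ¬ Reach P u v
    ¬r r = true≢false (reach⇒reachB r) (not-true (proj₂ (∧-true {H u v} q)))
  ... | no none = ⊥-elim (1+n≰n (≤-trans (s≤s (m≤n+m j m)) (≤-trans (≤-reflexive (sym e)) (≤-trans (components-mono (proj₁ sH) (proj₁ sP) incl) low))))
    where
    incl : ∀ {u v} → Reach H u v → Reach P u v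
    incl here = here
    incl (there {u} {w} h r) with bool-cases (reachB P n u w)
    ... | inj₁ b = reach-trans (reachB⇒reach P n b) (incl r)
    ... | inj₂ b = ⊥-elim (none (u , w , ∧-intro h (not-intro b)))

ℤsum : List ℤ → ℤ
ℤsum = foldr ℤ._+_ (ℤ.+ 0)

difference-+ : ∀ p q r s → (p ℤ.- q) ℤ.+ (r ℤ.- s) ≡ (p ℤ.+ r) ℤ.- (q ℤ.+ s)
difference-+ = solve 4 (λ p q r s → (p :- q) :+ (r :- s) := (p :+ r) :- (q :+ s)) refl
  where open ℤ-Solver

ℤsum-difference : {X : Set} (g : X → ℤ) (a b : X → ℕ) → (∀ x → g x ≡ ℤ.+ (a x) ℤ.- ℤ.+ (b x)) → ∀ xs →
  ℤsum (map g xs) ≡ ℤ.+ sum (map a xs) ℤ.- ℤ.+ sum (map b xs)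
ℤsum-difference g a b e [] = refl
ℤsum-difference g a b e (x ∷ xs) = trans (cong₂ ℤ._+_ (e x) (ℤsum-difference g a b e xs))
  (difference-+ (ℤ.+ (a x)) (ℤ.+ (b x)) (ℤ.+ sum (map a xs)) (ℤ.+ sum (map b xs)))

colourClass : ∀ {n} → Adj n → Colouring n → Sign → Adj n
colourClass H f s u v = H u v ∧ ⌊ f u v ≟ₛ s ⌋

fSum-difference : ∀ {n} (f : Colouring n) (H : Adj n) → fSum f H ≡ eCount H f Sign.+ ℤ.⊖ eCount H f Sign.-
fSum-difference {n} f H = trans (ℤsum-difference _ (row Sign.+) (row Sign.-)
    (λ u → ℤsum-difference _ (entry Sign.+ u) (entry Sign.- u) (λ v → one ((toℕ u <ᵇ toℕ v)) (H u v) (f u v)) (allFin n)) (allFin n))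
  (m-n≡m⊖n (eCount H f Sign.+) (eCount H f Sign.-))
  where
  entry : Sign → Fin n → Fin n → ℕ
  entry s u v = if (toℕ u <ᵇ toℕ v) ∧ colourClass H f s u v then 1 else 0
  row : Sign → Fin n → ℕ
  row s u = count (λ v → (toℕ u <ᵇ toℕ v) ∧ colourClass H f s u v)
  one : ∀ a b s → (if a ∧ b then signℤ s else ℤ.+ 0) ≡
    ℤ.+ (if a ∧ (b ∧ ⌊ s ≟ₛ Sign.+ ⌋) then 1 else 0) ℤ.- ℤ.+ (if a ∧ (b ∧ ⌊ s ≟ₛ Sign.- ⌋) then 1 else 0)
  one false b s = refl
  one true false s = refl
  one true true Sign.+ = refl
  one true true Sign.- = refl

⊖-small : ∀ p q → p ≤ suc q → q ≤ suc p → ∣ p ℤ.⊖ q ∣ ≤ 1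
⊖-small p q p≤ q≤ with ≤-total p q
... | inj₁ le = subst (_≤ 1) (sym (∣⊖∣-≤ le)) (m≤n+o⇒m∸n≤o q p (≤-trans q≤ (≤-reflexive (+-comm 1 p))))
... | inj₂ le = subst (_≤ 1) (sym (trans (∣m⊖n∣≡∣n⊖m∣ p q) (∣⊖∣-≤ le))) (m≤n+o⇒m∸n≤o p q (≤-trans p≤ (≤-reflexive (+-comm 1 q))))

⊖-large : ∀ p q → p + 2 ≤ q → 1 < ∣ p ℤ.⊖ q ∣
⊖-large p q h with m≤n⇒∃[o]m+o≡n h
... | o , refl = subst (1 <_) (sym (trans (∣⊖∣-≤ (≤-trans (m≤m+n p 2) (m≤m+n (p + 2) o))) (trans (cong (_∸ p) (+-assoc p 2 o)) (m+n∸m≡n p (2 + o))))) (s≤s (s≤s z≤n))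

half-bounds : ∀ k → 2 * (k / 2) ≤ k × k ≤ suc (2 * (k / 2))
half-bounds k = ≤-trans (m≤n+m _ (k % 2)) (≤-reflexive (sym split)) , ≤-trans (≤-reflexive split) (+-monoˡ-≤ (2 * (k / 2)) (≤-pred (m%n<n k 2)))
  where
  split : k ≡ k % 2 + 2 * (k / 2)
  split = trans (m≡m%n+[m/n]*n k 2) (cong (k % 2 +_) (*-comm (k / 2) 2))

sign-cases : ∀ s → ⌊ s ≟ₛ Sign.- ⌋ ≡ not ⌊ s ≟ₛ Sign.+ ⌋
sign-cases Sign.+ = refl
sign-cases Sign.- = refl

eCount-total : ∀ {n} (H : Adj n) (f : Colouring n) → #edges H ≡ eCount H f Sign.+ + eCount H f Sign.-
eCount-total {n} H f = trans (countPairs-split H (λ u v → ⌊ f u v ≟ₛ Sign.+ ⌋))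
  (cong (eCount H f Sign.+ +_) (countPairs-cong {p = λ u v → H u v ∧ not ⌊ f u v ≟ₛ Sign.+ ⌋} {q = colourClass H f Sign.-} λ u v → cong (H u v ∧_) (sym (sign-cases (f u v)))))

colourClass-simple : ∀ {n} {H : Adj n} → SimpleGraph H → ∀ {f : Colouring n} → SymColouring f → ∀ s → SimpleGraph (colourClass H f s)
colourClass-simple (sym' , irr) sf s = (λ u v → cong₂ (λ a b → a ∧ ⌊ b ≟ₛ s ⌋) (sym' u v) (sf u v)) , λ u → cong (_∧ _) (irr u)

colourClass-⊆ : ∀ {n} (H : Adj n) (f : Colouring n) s → colourClass H f s ⊆ H
colourClass-⊆ H f s u v e = proj₁ (∧-true e)

_∪_ : ∀ {n} → Adj n → Adj n → Adj n
(H ∪ K) u v = H u v ∨ K u v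

∪-simple : ∀ {n} {H K : Adj n} → SimpleGraph H → SimpleGraph K → SimpleGraph (H ∪ K)
∪-simple (s , irr) (s' , irr') = (λ u v → cong₂ _∨_ (s u v) (s' u v)) , λ u → cong₂ _∨_ (irr u) (irr' u)

tree-with-arith : ∀ {n p q b t c} → b ≤ q → t ≡ p + q → t + 1 ≡ n → b + c ≡ n → suc p ≤ c
tree-with-arith {p = p} {q} {b} {c = c} h refl refl e = linear (q + b) (+-mono-≤ h (≤-reflexive (sym e)))
    (solve 3 (λ p q b → con 1 :+ p :+ (q :+ b) := b :+ (p :+ q :+ con 1)) refl p q b)
    (solve 3 (λ q b c → q :+ (b :+ c) := c :+ (q :+ b)) refl q b c)
  where open +-*-Solver

tree-with : ∀ {n} {A : Adj n} → Fin n → SimpleGraph A → Connected A → ∀ {f : Colouring n} → SymColouring f →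
  Σ (Adj n) λ P → SimpleGraph P × P ⊆ colourClass A f Sign.+ × Forest P × suc (#edges P) ≤ #components (colourClass A f Sign.-) × Connected (P ∪ colourClass A f Sign.-)
tree-with {n} {A} v sA conn {f} sf with forest-extend {H = G⁻} s⁻ edgeless edgeless-simple (λ _ _ ()) (edgeless-forest n) (#components G⁻) ≤-refl
      (components-mono {H = edgeless} (λ _ _ → refl) (proj₁ s⁻) (reach-mono {H = edgeless} λ _ _ ()))
  where
  G⁻ = colourClass A f Sign.-
  s⁻ : SimpleGraph G⁻
  s⁻ = colourClass-simple {H = A} sA sf Sign.-
... | B , sB , _ , B⊆ , fB , cB with forest-extend sA B sB (λ x y b → colourClass-⊆ A f Sign.- x y (B⊆ x y b)) fB 1 (≤-reflexive (connected-components (proj₁ sA) conn v)) (components-positive (proj₁ sB) v)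
...   | T , sT , B⊆T , T⊆ , fT , cT = P , sP , P⊆ , forest-subgraph sT sP (colourClass-⊆ T f Sign.+) fT , small ,
        λ x y → reach-mono cover (components≤1⇒connected (proj₁ sT) (≤-reflexive cT) x y)
  where
  G⁻ = colourClass A f Sign.-
  P = colourClass T f Sign.+
  sP : SimpleGraph P
  sP = colourClass-simple {H = T} sT sf Sign.+
  P⊆ : P ⊆ colourClass A f Sign.+
  P⊆ x y e = ∧-intro (T⊆ x y (proj₁ (∧-true e))) (proj₂ (∧-true {T x y} e))
  cover : T ⊆ (P ∪ G⁻)
  cover x y t with bool-cases ⌊ f x y ≟ₛ Sign.+ ⌋
  ... | inj₁ p = ∨-introˡ (∧-intro t p)
  ... | inj₂ q = ∨-introʳ {P x y} (∧-intro (T⊆ x y t) (trans (sign-cases (f x y)) (not-intro q)))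
  B-edges : #edges B ≤ eCount T f Sign.-
  B-edges = countPairs-mono {p = B} {q = colourClass T f Sign.-} λ x y b → ∧-intro (B⊆T x y b) (proj₂ (∧-true {A x y} (B⊆ x y b)))
  small : suc (#edges P) ≤ #components G⁻
  small = tree-with-arith {p = #edges P} {eCount T f Sign.-} {#edges B} {#edges T} B-edges (eCount-total T f)
    (trans (cong (#edges T +_) (sym cT)) (forest-edges sT fT)) (trans (cong (#edges B +_) (sym cB)) (forest-edges sB fB))

minus-arith : ∀ {n p q t} → t ≡ p + q → t + 1 ≡ n → q + suc p ≡ n
minus-arith {p = p} {q} refl refl = solve 2 (λ p q → q :+ (con 1 :+ p) := p :+ q :+ con 1) refl p q
  where open +-*-Solver

exact-tree : ∀ {n} {A : Adj n} → Fin n → SimpleGraph A → ∀ {f : Colouring n} → SymColouring f →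
  ∀ P → SimpleGraph P → P ⊆ colourClass A f Sign.+ → Forest P → Connected (P ∪ colourClass A f Sign.-) →
  ∀ k c → k + c ≡ n → #edges P ≤ k → #components (colourClass A f Sign.+) ≤ c →
  Σ (Adj n) λ T → SpanningTree A T × eCount T f Sign.+ ≡ k × eCount T f Sign.- + suc k ≡ n
exact-tree {n} {A} v sA {f} sf P sP P⊆ fP conn k c k+c le low =
  finish (forest-extend {H = G⁺} s⁺ P sP P⊆ fP c low
    (linear (#edges P) (+-monoˡ-≤ c le) (+-comm c (#edges P)) (trans k+c (trans (sym (forest-edges {H = P} sP fP)) (+-comm (#edges P) (#components P))))))
  where
  G⁺ G⁻ : Adj n
  G⁺ = colourClass A f Sign.+
  G⁻ = colourClass A f Sign.-
  s⁺ : SimpleGraph G⁺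
  s⁺ = colourClass-simple {H = A} sA sf Sign.+
  s⁻ : SimpleGraph G⁻
  s⁻ = colourClass-simple {H = A} sA sf Sign.-
  Goal : Set
  Goal = Σ (Adj n) λ T → SpanningTree A T × eCount T f Sign.+ ≡ k × eCount T f Sign.- + suc k ≡ n
  finish : (∃ λ Q → SimpleGraph Q × P ⊆ Q × Q ⊆ G⁺ × Forest Q × #components Q ≡ c) → Goal
  finish (Q , sQ , P⊆Q , Q⊆ , fQ , cQ) = finish' (forest-extend {H = Q ∪ G⁻} s∪ Q sQ (λ x y q → ∨-introˡ q) fQ 1
      (≤-reflexive (connected-components {H = Q ∪ G⁻} (proj₁ s∪) (λ x y → reach-mono {H = P ∪ G⁻} {Q ∪ G⁻} grown (conn x y)) v))
      (components-positive {H = Q} (proj₁ sQ) v))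
    where
    s∪ : SimpleGraph (Q ∪ G⁻)
    s∪ = ∪-simple {H = Q} {G⁻} sQ s⁻
    grown : (P ∪ G⁻) ⊆ (Q ∪ G⁻)
    grown a b e = [ (λ p → ∨-introˡ (P⊆Q a b p)) , (λ g → ∨-introʳ {Q a b} g) ]′ (∨-true {P a b} e)
    finish' : (∃ λ T → SimpleGraph T × Q ⊆ T × T ⊆ (Q ∪ G⁻) × Forest T × #components T ≡ 1) → Goal
    finish' (T , sT , Q⊆T , T⊆ , fT , cT) = T , (sT , inA , components≤1⇒connected {H = T} (proj₁ sT) (≤-reflexive cT) , forest⇒acyclic {T = T} sT fT) , plus , minus
      where
      inA : ∀ x y → T x y ≡ true → A x y ≡ true
      inA x y t with ∨-true {Q x y} (T⊆ x y t)
      ... | inj₁ q = proj₁ (∧-true (Q⊆ x y q))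
      ... | inj₂ g = proj₁ (∧-true g)
      only-Q : ∀ x y → colourClass T f Sign.+ x y ≡ Q x y
      only-Q x y = bool-ext to λ q → ∧-intro (Q⊆T x y q) (proj₂ (∧-true {A x y} (Q⊆ x y q)))
        where
        to : colourClass T f Sign.+ x y ≡ true → Q x y ≡ true
        to e with ∨-true {Q x y} (T⊆ x y (proj₁ (∧-true e)))
        ... | inj₁ q = q
        ... | inj₂ g = true≢false (proj₂ (∧-true {T x y} e)) (not-true (trans (sym (sign-cases (f x y))) (proj₂ (∧-true {A x y} g))))
      plus : eCount T f Sign.+ ≡ k
      plus = trans (countPairs-cong {p = colourClass T f Sign.+} {q = Q} only-Q)
        (+-cancelʳ-≡ c (#edges Q) k (trans (trans (cong (#edges Q +_) (sym cQ)) (forest-edges {H = Q} sQ fQ)) (sym k+c)))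
      minus : eCount T f Sign.- + suc k ≡ n
      minus = subst (λ m → eCount T f Sign.- + suc m ≡ n) plus (minus-arith {t = #edges T} (eCount-total T f) (trans (cong (#edges T +_) (sym cT)) (forest-edges {H = T} sT fT)))

balanced-tree : ∀ {n'} m → 3 ≤ m → 2 * m ≤ n' → n' ≤ suc (2 * m) → (A : Adj (suc n')) → MaximalPlanar A → (f : Colouring (suc n')) → SymColouring f →
  3 * m ∸ 5 ≤ eCount A f Sign.- ⊓ eCount A f Sign.+ → Σ (Adj (suc n')) λ T → SpanningTree A T × ∣ fSum f T ∣ ≤ 1
balanced-tree {n'} m 3≤m low high A maxA@(sA , pl , _) f sf many = choose (tree-with zero sA conn sf)
  where
  n = suc n'
  conn : Connected A
  conn = maximal⇒connected maxA
  rank-arith : ∀ {c e} → 3 * m ≤ 5 + e → e + 3 + 3 * c ≤ 3 * n → suc n ≤ c + m → 6 ≤ 5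
  rank-arith {c} {e} h₁ h₂ h₃ = linear (3 * n + e + 3 * c + 3 * m) (+-mono-≤ (+-mono-≤ h₁ h₂) (*-monoʳ-≤ 3 h₃))
    (solve 4 (λ n e c m → con 6 :+ (con 3 :* n :+ e :+ con 3 :* c :+ con 3 :* m) := con 3 :* m :+ (e :+ con 3 :+ con 3 :* c) :+ con 3 :* (con 1 :+ n)) refl n e c m)
    (solve 4 (λ n e c m → con 5 :+ e :+ con 3 :* n :+ con 3 :* (c :+ m) := con 5 :+ (con 3 :* n :+ e :+ con 3 :* c :+ con 3 :* m)) refl n e c m)
    where open +-*-Solver
  rank : ∀ s → 3 * m ∸ 5 ≤ eCount A f s → #components (colourClass A f s) + m ≤ n
  rank s h with #components (colourClass A f s) + m ≤? n
  ... | yes le = le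
  ... | no ¬le = ⊥-elim (1+n≰n (rank-arith {c = #components (colourClass A f s)} {eCount A f s} enough
      (edge-bound sA conn pl (colourClass A f s) (colourClass-simple {H = A} sA sf s) (colourClass-⊆ A f s)
        (≤-trans (s≤s (s≤s z≤n)) (+-cancelˡ-≤ 5 4 _ (≤-trans (*-monoʳ-≤ 3 3≤m) enough))))
      (≰⇒> ¬le)))
    where
    enough : 3 * m ≤ 5 + eCount A f s
    enough = ≤-trans (m≤n+m∸n (3 * m) 5) (+-monoʳ-≤ 5 h)
  rank⁻ = rank Sign.- (≤-trans many (m⊓n≤m _ _))
  rank⁺ = rank Sign.+ (≤-trans many (m⊓n≤n _ _))
  Result : Set
  Result = Σ (Adj n) λ T → SpanningTree A T × ∣ fSum f T ∣ ≤ 1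
  finish : ∀ k → (Σ (Adj n) λ T → SpanningTree A T × eCount T f Sign.+ ≡ k × eCount T f Sign.- + suc k ≡ n) →
    (∀ {q} → q + k ≡ n' → k ≤ suc q × q ≤ suc k) → Result
  finish k (T , tree , plus , minus) close = T , tree , subst (_≤ 1) (sym (cong ∣_∣ (fSum-difference f T)))
    (subst (λ p → ∣ p ℤ.⊖ eCount T f Sign.- ∣ ≤ 1) (sym plus) (⊖-small k (eCount T f Sign.-) (proj₁ near) (proj₂ near)))
    where
    near = close (suc-injective (trans (sym (+-suc (eCount T f Sign.-) k)) minus))
  choose : (Σ (Adj n) λ P → SimpleGraph P × P ⊆ colourClass A f Sign.+ × Forest P × suc (#edges P) ≤ #components (colourClass A f Sign.-) × Connected (P ∪ colourClass A f Sign.-)) → Result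
  choose (P , sP , P⊆ , fP , small , connP) with #edges P ≤? m
  ... | yes p≤m with m≤n⇒∃[o]m+o≡n (≤-trans (m≤n+m m (#components (colourClass A f Sign.+))) rank⁺)
  ...   | c , m+c = finish m (exact-tree zero sA sf P sP P⊆ fP connP m c m+c p≤m
            (+-cancelʳ-≤ m _ c (≤-trans rank⁺ (≤-reflexive (trans (sym m+c) (+-comm m c)))))) close
    where
    close : ∀ {q} → q + m ≡ n' → m ≤ suc q × q ≤ suc m
    close {q} e = m≤n⇒m≤1+n (linear m low (cong (m +_) (sym (+-identityʳ m))) (sym e)) ,
      linear m high e (cong (λ x → suc (m + x)) (+-identityʳ m))
  choose (P , sP , P⊆ , fP , small , connP) | no p≰m = finish p (exact-tree zero sA sf P sP P⊆ fP connP p (#components P) (forest-edges {H = P} sP fP) ≤-refl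
      (components-mono {H = P} (proj₁ sP) (proj₁ (colourClass-simple {H = A} sA sf Sign.+)) (reach-mono P⊆))) close
    where
    p = #edges P
    m<p : suc m ≤ p
    m<p = ≰⇒> p≰m
    p+m : p + m ≤ n'
    p+m = ≤-pred (≤-trans (+-monoˡ-≤ m small) rank⁻)
    close : ∀ {q} → q + p ≡ n' → p ≤ suc q × q ≤ suc p
    close {q} e = ≤-trans p≤1+m (s≤s m≤q) , m≤n⇒m≤1+n (≤-trans q≤m (<⇒≤ m<p))
      where
      p≤1+m : p ≤ suc m
      p≤1+m = linear m (≤-trans p+m high) refl (cong (λ x → suc (m + x)) (+-identityʳ m))
      m≤q : m ≤ q
      m≤q = linear p p+m (+-comm m p) (sym e)
      q≤m : q ≤ m
      q≤m = linear (suc m) (≤-trans (+-monoʳ-≤ q m<p) (≤-trans (≤-reflexive e) high)) refl (trans (cong (λ x → suc (m + x)) (+-identityʳ m)) (sym (+-suc m m)))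

half-≥3 : ∀ {k} → 6 ≤ k → 3 ≤ k / 2
half-≥3 {k} h = ≮⇒≥ λ l → 1+n≰n (≤-trans h (≤-trans (proj₂ (half-bounds k)) (s≤s (*-monoʳ-≤ 2 (≤-pred l)))))

sufficiency : (n : ℕ) → 7 ≤ n → (A : Adj n) → MaximalPlanar A → (f : Colouring n) → SymColouring f →
  3 * ((n ∸ 1) / 2) ∸ 5 ≤ eCount A f Sign.- ⊓ eCount A f Sign.+ → Σ (Adj n) λ T → SpanningTree A T × ∣ fSum f T ∣ ≤ 1
sufficiency (suc n') (s≤s h) A = balanced-tree (n' / 2) (half-≥3 h) (proj₁ (half-bounds n')) (proj₂ (half-bounds n')) A

-- The stacked triangulation

≡ᵇ-true : ∀ {m n} → (m ≡ᵇ n) ≡ true → m ≡ n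
≡ᵇ-true {zero} {zero} _ = refl
≡ᵇ-true {suc m} {suc n} e = cong suc (≡ᵇ-true e)

≡ᵇ-refl : ∀ m → (m ≡ᵇ m) ≡ true
≡ᵇ-refl zero = refl
≡ᵇ-refl (suc m) = ≡ᵇ-refl m

≡ᵇ-≢ : ∀ {m n} → m ≢ n → (m ≡ᵇ n) ≡ false
≡ᵇ-≢ {m} {n} ne = ≢true λ e → ne (≡ᵇ-true {m} e)

-- 0 and 1 are adjacent to each other and to all vertices of the path 2, 3, …, N.
near : ℕ → ℕ → Bool
near 0 0 = false
near 0 (suc _) = true
near 1 0 = true
near 1 1 = false
near 1 (suc (suc _)) = true
near (suc (suc _)) 0 = true
near (suc (suc _)) 1 = true
near (suc (suc v)) (suc (suc u)) = (suc v ≡ᵇ u) ∨ (suc u ≡ᵇ v)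

data Near : ℕ → ℕ → Set where
  hub₀ : ∀ {u} → Near 0 (suc u)
  hub₁₀ : Near 1 0
  hub₁ : ∀ {u} → Near 1 (2 + u)
  rim₀ : ∀ {v} → Near (2 + v) 0
  rim₁ : ∀ {v} → Near (2 + v) 1
  up : ∀ {v} → Near (2 + v) (3 + v)
  down : ∀ {v} → Near (3 + v) (2 + v)

near⇒ : ∀ v u → near v u ≡ true → Near v u
near⇒ 0 (suc _) _ = hub₀
near⇒ 1 0 _ = hub₁₀
near⇒ 1 (suc (suc _)) _ = hub₁
near⇒ (suc (suc _)) 0 _ = rim₀
near⇒ (suc (suc _)) 1 _ = rim₁
near⇒ (suc (suc v)) (suc (suc u)) e with ∨-true {suc v ≡ᵇ u} e
... | inj₁ q with ≡ᵇ-true {suc v} {u} q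
...   | refl = up
near⇒ (suc (suc v)) (suc (suc u)) e | inj₂ q with ≡ᵇ-true {suc u} {v} q
...   | refl = down

⇒near : ∀ {v u} → Near v u → near v u ≡ true
⇒near hub₀ = refl
⇒near hub₁₀ = refl
⇒near hub₁ = refl
⇒near rim₀ = refl
⇒near rim₁ = refl
⇒near (up {v}) = ∨-introˡ (≡ᵇ-refl (suc v))
⇒near (down {v}) = ∨-introʳ {suc (suc v) ≡ᵇ v} (≡ᵇ-refl (suc v))

Near-sym : ∀ {v u} → Near v u → Near u v
Near-sym (hub₀ {zero}) = hub₁₀
Near-sym (hub₀ {suc u}) = rim₀
Near-sym hub₁₀ = hub₀
Near-sym hub₁ = rim₁
Near-sym rim₀ = hub₀
Near-sym rim₁ = hub₁
Near-sym up = down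
Near-sym down = up

Near-irrefl : ∀ {v} → ¬ Near v v
Near-irrefl ()

-- The cyclic orders are 1 2 … N around 0, 0 N … 2 around 1, and 0 (v-1) 1 (v+1) around v ≥ 2.
next : ℕ → ℕ → ℕ → ℕ
next N 0 u = if u ≡ᵇ N then 1 else suc u
next N 1 0 = N
next N 1 1 = 1
next N 1 2 = 0
next N 1 (suc (suc (suc u))) = 2 + u
next N (suc (suc v)) 0 = suc v
next N (suc (suc v)) 1 = if 2 + v ≡ᵇ N then 0 else 3 + v
next N (suc (suc v)) (suc (suc u)) = if suc v ≡ᵇ u then 0 else 1

next-0-last : ∀ N → next N 0 N ≡ 1
next-0-last N rewrite ≡ᵇ-refl N = refl

next-0 : ∀ {N u} → u < N → next N 0 u ≡ suc u
next-0 {N} {u} l rewrite ≡ᵇ-≢ {u} {N} (λ { refl → <-irrefl refl l }) = refl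

next-last-1 : ∀ v → next (2 + v) (2 + v) 1 ≡ 0
next-last-1 v rewrite ≡ᵇ-refl v = refl

next-1 : ∀ {N v} → 2 + v < N → next N (2 + v) 1 ≡ 3 + v
next-1 {N} {v} l rewrite ≡ᵇ-≢ {2 + v} {N} (λ { refl → <-irrefl refl l }) = refl

next-up : ∀ N v → next N (2 + v) (3 + v) ≡ 0
next-up N v rewrite ≡ᵇ-refl v = refl

next-down : ∀ N v → next N (3 + v) (2 + v) ≡ 1
next-down N v rewrite ≡ᵇ-≢ {2 + v} {v} (λ e → 1+n≰n (≤-trans (m≤n+m (suc v) 1) (≤-reflexive e))) = refl

record Triangle (N v u : ℕ) : Set where
  constructor triangle
  field
    {w} : ℕ
    is-next : next N v u ≡ w
    bounded : w ≤ N
    adjacent : Near v w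
    back : next N w v ≡ u
    close : next N u w ≡ v

next-triangle : ∀ {N v u} → 2 ≤ N → v ≤ N → u ≤ N → Near v u → Triangle N v u
next-triangle {suc zero} (s≤s ())
next-triangle {suc (suc N)} _ _ u≤N (hub₀ {u}) with m≤n⇒m<n∨m≡n u≤N
... | inj₂ refl = triangle (next-0-last (2 + N)) (s≤s z≤n) hub₀ refl (next-last-1 N)
... | inj₁ l = triangle (next-0 l) l hub₀ refl (closing u)
  where
  closing : ∀ u → next (2 + N) (suc u) (2 + u) ≡ 0
  closing zero = refl
  closing (suc u) = next-up (2 + N) u
next-triangle {suc (suc N)} _ _ _ hub₁₀ = triangle refl ≤-refl hub₁ (next-last-1 N) (next-0-last (2 + N))
next-triangle {suc (suc N)} _ _ _ (hub₁ {zero}) = triangle refl z≤n hub₁₀ (next-0 {2 + N} {1} (s≤s (s≤s z≤n))) refl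
next-triangle {suc (suc N)} _ _ l (hub₁ {suc u}) = triangle refl (<⇒≤ l) hub₁ (next-1 l) (next-down (2 + N) u)
next-triangle {suc (suc N)} _ _ _ (rim₀ {zero}) = triangle refl (s≤s z≤n) rim₁ refl (next-0 {2 + N} {1} (s≤s (s≤s z≤n)))
next-triangle {suc (suc N)} _ l _ (rim₀ {suc v}) = triangle refl (<⇒≤ l) down (next-up (2 + N) v) (next-0 l)
next-triangle {suc (suc N)} _ l _ (rim₁ {v}) with m≤n⇒m<n∨m≡n l
... | inj₂ refl = triangle (next-last-1 v) z≤n rim₀ (next-0-last (2 + v)) refl
... | inj₁ l' = triangle (next-1 l') l' up (next-down (2 + N) v) refl
next-triangle {suc (suc N)} _ _ l (up {v}) = triangle (next-up (2 + N) v) z≤n rim₀ (next-0 l) refl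
next-triangle {suc (suc N)} _ l _ (down {v}) = triangle (next-down (2 + N) v) (s≤s z≤n) rim₁ refl (next-1 l)

clamp : ∀ {N} → ℕ → Fin (suc N)
clamp {N} k with k <? suc N
... | yes l = fromℕ< l
... | no _ = zero

toℕ-clamp : ∀ {N k} → k ≤ N → toℕ (clamp {N} k) ≡ k
toℕ-clamp {N} {k} l with k <? suc N
... | yes l' = toℕ-fromℕ< l'
... | no ¬l = ⊥-elim (¬l (s≤s l))

stacked : ∀ n → Adj n
stacked n u v = near (toℕ u) (toℕ v)

stacked-simple : ∀ n → SimpleGraph (stacked n)
stacked-simple n = (λ u v → bool-ext (λ e → ⇒near (Near-sym (near⇒ (toℕ u) (toℕ v) e))) (λ e → ⇒near (Near-sym (near⇒ (toℕ v) (toℕ u) e)))) ,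
  λ v → ≢true λ e → Near-irrefl (near⇒ (toℕ v) (toℕ v) e)

stacked-connected : ∀ n → Connected (stacked (suc n))
stacked-connected n u v = reach-trans (to-0 u) (reach-sym (proj₁ (stacked-simple (suc n))) (to-0 v))
  where
  to-0 : ∀ u → Reach (stacked (suc n)) u zero
  to-0 zero = here
  to-0 (suc u) = reach-edge (⇒near (Near-sym (hub₀ {toℕ u})))

module StackedRotation (N : ℕ) (2≤N : 2 ≤ N) where
  A = stacked (suc N)

  bound : (v : Fin (suc N)) → toℕ v ≤ N
  bound v = ≤-pred (toℕ<n v)

  turn-to : Rotation (suc N)
  turn-to v u = clamp (next N (toℕ v) (toℕ u))

  ρ : Rotation (suc N)
  ρ = total A turn-to

  triangle-at : ∀ v u → A v u ≡ true → Triangle N (toℕ v) (toℕ u)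
  triangle-at v u e = next-triangle 2≤N (bound v) (bound u) (near⇒ (toℕ v) (toℕ u) e)

  ρ-next : ∀ v u {w} → A v u ≡ true → next N (toℕ v) (toℕ u) ≡ toℕ w → ρ v u ≡ w
  ρ-next v u {w} e q = toℕ-injective (trans (cong toℕ (total-in A turn-to {v} {u} e)) (trans (cong (toℕ ∘ clamp {N}) q) (toℕ-clamp (bound w))))

  toℕ-ρ : ∀ v u (e : A v u ≡ true) → toℕ (ρ v u) ≡ Triangle.w (triangle-at v u e)
  toℕ-ρ v u e = trans (cong toℕ (ρ-next v u {clamp (Triangle.w T)} e (trans (Triangle.is-next T) (sym at)))) at
    where
    T = triangle-at v u e
    at : toℕ (clamp {N} (Triangle.w T)) ≡ Triangle.w T
    at = toℕ-clamp (Triangle.bounded T)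

  ρ-closed : ∀ v u → A v u ≡ true → A v (ρ v u) ≡ true
  ρ-closed v u e = trans (cong (near (toℕ v)) (toℕ-ρ v u e)) (⇒near (Triangle.adjacent (triangle-at v u e)))

  A-sym : ∀ u v → A u v ≡ true → A v u ≡ true
  A-sym u v e = trans (proj₁ (stacked-simple (suc N)) v u) e

  ρ-back : ∀ v u → A v u ≡ true → ρ (ρ v u) v ≡ u
  ρ-back v u e = ρ-next (ρ v u) v (A-sym v (ρ v u) (ρ-closed v u e)) (trans (cong (λ w → next N w (toℕ v)) (toℕ-ρ v u e)) (Triangle.back (triangle-at v u e)))

  ρ-adjacent : ∀ v u → A v u ≡ true → A (ρ v u) u ≡ true
  ρ-adjacent v u e = subst (λ x → A (ρ v u) x ≡ true) (ρ-back v u e) (ρ-closed (ρ v u) v (A-sym v (ρ v u) (ρ-closed v u e)))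

  ρ-close : ∀ v u → A v u ≡ true → ρ u (ρ v u) ≡ v
  ρ-close v u e = ρ-next u (ρ v u) (A-sym (ρ v u) u (ρ-adjacent v u e)) (trans (cong (next N (toℕ u)) (toℕ-ρ v u e)) (Triangle.close (triangle-at v u e)))

  ρ-injective : ∀ v → Injective (ρ v)
  ρ-injective v {x} {y} e with bool-cases (A v x) | bool-cases (A v y)
  ... | inj₁ p | inj₁ q = trans (sym (ρ-back v x p)) (trans (cong (λ w → ρ w v) e) (ρ-back v y q))
  ... | inj₂ p | inj₂ q = trans (sym (total-out A turn-to {v} {x} p)) (trans e (total-out A turn-to {v} {y} q))
  ... | inj₁ p | inj₂ q = true≢false (trans (cong (A v) (trans (sym (total-out A turn-to {v} {y} q)) (sym e))) (ρ-closed v x p)) q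
  ... | inj₂ p | inj₁ q = true≢false (trans (cong (A v) (trans (sym (total-out A turn-to {v} {x} p)) e)) (ρ-closed v y q)) p

  orbit-sym : ∀ v {x y} → Orb (ρ v) x y → Orb (ρ v) y x
  orbit-sym v = orb-sym (vertices (suc N)) (ρ v) (ρ-injective v)

  one : Fin (suc N)
  one = clamp 1

  toℕ-one : toℕ one ≡ 1
  toℕ-one = toℕ-clamp (≤-trans (s≤s z≤n) 2≤N)

  move : ∀ v y {x z} → A v y ≡ true → next N (toℕ v) (toℕ y) ≡ toℕ z → Orb (ρ v) x y → Orb (ρ v) x z
  move v y {x} a q o = subst (Orb (ρ v) x) (ρ-next v y a q) (orb-step o)

  centre : Fin (suc N) → Fin (suc N)
  centre zero = one
  centre (suc _) = zero

  at : ∀ k → k ≤ N → Fin (suc N)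
  at k l = fromℕ< (s≤s l)

  toℕ-at : ∀ {k} (l : k ≤ N) → toℕ (at k l) ≡ k
  toℕ-at l = toℕ-fromℕ< (s≤s l)

  from-one : ∀ k (l : suc k ≤ N) → Orb (ρ zero) one (at (suc k) l)
  from-one zero l = subst (Orb (ρ zero) one) (toℕ-injective (trans toℕ-one (sym (toℕ-at l)))) orb-refl
  from-one (suc k) l = move zero (at (suc k) (<⇒≤ l)) (trans (cong (near 0) (toℕ-at (<⇒≤ l))) refl) (trans (cong (next N 0) (toℕ-at (<⇒≤ l))) (trans (next-0 l) (sym (toℕ-at l)))) (from-one k (<⇒≤ l))

  to-zero-at-one : ∀ v → toℕ v ≡ 1 → ∀ k (l : 2 + k ≤ N) → Orb (ρ v) (at (2 + k) l) zero
  to-zero-at-one v e zero l = move v (at 2 l) (trans (cong₂ near e (toℕ-at l)) refl) (cong₂ (next N) e (toℕ-at l)) orb-refl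
  to-zero-at-one v e (suc k) l = orb-trans (move v (at (3 + k) l) (trans (cong₂ near e (toℕ-at l)) refl) (trans (cong₂ (next N) e (toℕ-at l)) (sym (toℕ-at (<⇒≤ l)))) orb-refl) (to-zero-at-one v e k (<⇒≤ l))

  from-succ : ∀ v {k u} → toℕ v ≡ 2 + k → toℕ u ≡ 3 + k → Orb (ρ v) u zero
  from-succ v {k} {u} e q = move v u (trans (cong₂ near e q) (⇒near (up {k}))) (trans (cong₂ (next N) e q) (next-up N k)) orb-refl

  from-1 : ∀ v {k u} → toℕ v ≡ 2 + k → toℕ u ≡ 1 → Orb (ρ v) u zero
  from-1 v {k} {u} e q with m≤n⇒m<n∨m≡n (subst (_≤ N) e (bound v))
  ... | inj₂ refl = move v u (trans (cong₂ near e q) refl) (trans (cong₂ (next N) e q) (next-last-1 k)) orb-refl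
  ... | inj₁ l = orb-trans (move v u (trans (cong₂ near e q) refl) (trans (cong₂ (next N) e q) (trans (next-1 l) (sym (toℕ-at l)))) orb-refl) (from-succ v e (toℕ-at l))

  to-zero : ∀ v {a b u} → toℕ v ≡ suc a → toℕ u ≡ b → Near (suc a) b → Orb (ρ v) u zero
  to-zero v e q hub₁₀ = subst (λ x → Orb (ρ v) x zero) (toℕ-injective (sym q)) orb-refl
  to-zero v {u = u} e q (hub₁ {k}) = subst (λ x → Orb (ρ v) x zero) (toℕ-injective (trans (toℕ-at l) (sym q))) (to-zero-at-one v e k l)
    where
    l = subst (_≤ N) q (bound u)
  to-zero v e q rim₀ = subst (λ x → Orb (ρ v) x zero) (toℕ-injective (sym q)) orb-refl
  to-zero v e q rim₁ = from-1 v e q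
  to-zero v e q up = from-succ v e q
  to-zero v {u = u} e q (down {k}) = orb-trans (move v u (trans (cong₂ near e q) (⇒near (down {k}))) (trans (cong₂ (next N) e q) (trans (next-down N k) (sym toℕ-one))) orb-refl) (from-1 v e toℕ-one)

  to-centre : ∀ v u → A v u ≡ true → Orb (ρ v) u (centre v)
  to-centre zero (suc u) e = orbit-sym zero (subst (Orb (ρ zero) one) (toℕ-injective (toℕ-at (bound (suc u)))) (from-one (toℕ u) (bound (suc u))))
  to-centre (suc v) u e = to-zero (suc v) refl refl (near⇒ (suc (toℕ v)) (toℕ u) e)

  rotation : TotalRotation A ρ
  rotation = record
    { off = λ {u} {v} → total-out A turn-to {u} {v} ; injective = ρ-injective ; closed = λ {u} {v} → ρ-closed u v
    ; cyclic = λ {v} {x} {y} p q → orb-trans (to-centre v x p) (orbit-sym v (to-centre v y q)) }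

-- If every boundary walk is a triangle, the faces cover all darts exactly three times over.
module StackedFaces (N : ℕ) (2≤N : 2 ≤ N) where
  open StackedRotation N 2≤N

  D = darts (suc N)
  face = ribbon ρ A

  face-1 : ∀ u v → A u v ≡ true → face (u , v) ≡ (v , ρ v u)
  face-1 u v e = ribbon-in ρ A e

  face-2 : ∀ u v → A u v ≡ true → face (v , ρ v u) ≡ (ρ v u , u)
  face-2 u v e = trans (ribbon-in ρ A (ρ-closed v u (A-sym u v e))) (cong (ρ v u ,_) (ρ-back v u (A-sym u v e)))

  face-3 : ∀ u v → A u v ≡ true → face (ρ v u , u) ≡ (u , v)
  face-3 u v e = trans (ribbon-in ρ A (ρ-adjacent v u (A-sym u v e))) (cong (u ,_) (ρ-close v u (A-sym u v e)))

  leader : Dart (suc N) → Bool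
  leader d = leastInOrbit D face d ∧ arc A d

  faces-leader : #faces A ρ ≡ card D leader
  faces-leader = #faces-least {A = A} {ρ} {ρ} (stacked-simple (suc N)) (λ _ → refl) rotation

  arcs≤ : card D (arc A) ≤ 3 * #faces A ρ
  arcs≤ = subst (card D (arc A) ≤_) (trans (cnt-triple leader (Enum.elems D)) (cong (3 *_) (sym faces-leader)))
    (cnt-inject (≡-dec (Enum._≡?_ D) _≟_) {arc A} {λ { (d , _) → leader d }} (Enum.elems D) (cartesianProduct (Enum.elems D) (allFin 3)) S (Enum.unique D) image λ { _ _ refl refl → refl })
    where
    S : Dart (suc N) → Dart (suc N) × Fin 3 → Set
    S d (e , i) = iter face (toℕ i) e ≡ d
    Found : Dart (suc N) → Set
    Found d = ∃ λ y → y ∈ cartesianProduct (Enum.elems D) (allFin 3) × leader (proj₁ y) ≡ true × S d y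
    found : ∀ d e i → leader e ≡ true → S d (e , i) → Found d
    found d e i l s = (e , i) , ∈-cartesianProduct⁺ (Enum.complete D e) (∈-allFin i) , l , s
    image : ∀ {d} → arc A d ≡ true → Found d
    image {u , v} e = choose (Transversal.rep (leastInOrbit-transversal D face (ribbon-injective ρ-injective (proj₁ (stacked-simple (suc N))))) (u , v))
      where
      On : Dart (suc N) → Set
      On d = d ≡ (u , v) ⊎ (d ≡ (v , ρ v u) ⊎ d ≡ (ρ v u , u))
      walk : ∀ {d} → On d → On (face d)
      walk (inj₁ refl) = inj₂ (inj₁ (face-1 u v e))
      walk (inj₂ (inj₁ refl)) = inj₂ (inj₂ (face-2 u v e))
      walk (inj₂ (inj₂ refl)) = inj₁ (face-3 u v e)
      choose' : ∀ d → leastInOrbit D face d ≡ true → On d → Found (u , v)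
      choose' _ l (inj₁ refl) = found _ (u , v) zero (∧-intro l e) refl
      choose' _ l (inj₂ (inj₁ refl)) = found _ (v , ρ v u) (suc (suc zero)) (∧-intro l (ρ-closed v u (A-sym u v e))) (trans (cong face (face-2 u v e)) (face-3 u v e))
      choose' _ l (inj₂ (inj₂ refl)) = found _ (ρ v u , u) (suc zero) (∧-intro l (ρ-adjacent v u (A-sym u v e))) (face-3 u v e)
      choose : (∃ λ d → leastInOrbit D face d ≡ true × Orb face (u , v) d) → Found (u , v)
      choose (d , l , o) = choose' d l (orb-least face {On} (inj₁ refl) walk o)

  no-single : NoSingleEdge rotation (stacked-simple (suc N)) (λ _ _ e → e)
  no-single u v e = inj₁ (ρ v u , (λ q → simple-≢ {H = A} (stacked-simple (suc N)) (ρ-adjacent v u (A-sym u v e)) q) , ρ-closed v u (A-sym u v e))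

  edge-01 : A zero one ≡ true
  edge-01 = trans (cong (near 0) toℕ-one) refl

  connected : Connected A
  connected = stacked-connected N

  components-1 : #components A ≡ 1
  components-1 = connected-components {H = A} (proj₁ (stacked-simple (suc N))) connected zero

  isolated-0 : #isolated A ≡ 0
  isolated-0 = ≤-antisym (≤-pred (subst (suc (#isolated A) ≤_) components-1 (isolated-components A (stacked-simple (suc N)) {zero} {one} edge-01))) z≤n

  faces≤ : 3 * #faces A ρ ≤ #edges A + #edges A
  faces≤ = cancel (#faces A ρ) (#edges A + #edges A) (card D (absent A)) isolated-0
    (orbits-bound rotation (stacked-simple (suc N)) (λ _ _ e → e) no-single (#faces-classes {A = A} {ρ} {ρ} (stacked-simple (suc N)) (λ _ → refl) rotation))
    where
    cancel : ∀ F E Z {i} → i ≡ 0 → 3 * (F + Z) ≤ E + 3 * (i + Z) → 3 * F ≤ E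
    cancel F E Z refl h = linear (3 * Z) h (sym (*-distribˡ-+ 3 F Z)) refl

  planar : #edges A + 6 ≡ 3 * suc N → Planar A
  planar e = ρ , total⇒isRotation rotation ,
      euler (suc N) (#faces A ρ) (#edges A) isolated-0 components-1 e (≤-antisym faces≤ (subst (_≤ 3 * #faces A ρ) (arcs-twice A (stacked-simple (suc N))) arcs≤))
    where
    euler : ∀ n F E {i c} → i ≡ 0 → c ≡ 1 → E + 6 ≡ 3 * n → 3 * F ≡ E + E → n + (F + i) ≡ E + 2 * c
    euler n F E refl refl h₁ h₂ = *-cancelˡ-≡ (n + (F + 0)) (E + 2) 3 (trans (solve 2 (λ n F → con 3 :* (n :+ (F :+ con 0)) := con 3 :* n :+ con 3 :* F) refl n F)
      (trans (cong₂ _+_ (sym h₁) h₂) (solve 1 (λ E → E :+ con 6 :+ (E :+ E) := con 3 :* (E :+ con 2)) refl E)))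
      where open +-*-Solver

first : ∀ n → ℕ → Adj n
first n k u v = stacked n u v ∧ ((toℕ u <ᵇ k) ∧ (toℕ v <ᵇ k))

first-elim : ∀ {n k} u v → first n k u v ≡ true → Near (toℕ u) (toℕ v) × toℕ u < k × toℕ v < k
first-elim {n} u v e with ∧-true {stacked n u v} e
... | a , b with ∧-true b
...   | l , r = near⇒ (toℕ u) (toℕ v) a , <ᵇ-true l , <ᵇ-true r

first-intro : ∀ {n k} u v → Near (toℕ u) (toℕ v) → toℕ u < k → toℕ v < k → first n k u v ≡ true
first-intro u v a l r = ∧-intro (⇒near a) (∧-intro (<ᵇ-intro l) (<ᵇ-intro r))

first-simple : ∀ n k → SimpleGraph (first n k)
first-simple n k = (λ u v → cong₂ _∧_ (proj₁ (stacked-simple n) u v) (∧-comm (toℕ u <ᵇ k) (toℕ v <ᵇ k))) , λ u → cong (_∧ ((toℕ u <ᵇ k) ∧ (toℕ u <ᵇ k))) (proj₂ (stacked-simple n) u)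

earlier-neighbour : ∀ {j b} → Near (2 + j) b → b < 3 + j → b ≡ 0 ⊎ (b ≡ 1 ⊎ b ≡ 1 + j)
earlier-neighbour rim₀ _ = inj₁ refl
earlier-neighbour rim₁ _ = inj₂ (inj₁ refl)
earlier-neighbour up l = ⊥-elim (<-irrefl refl l)
earlier-neighbour down _ = inj₂ (inj₂ refl)

edges-addEdge-old : ∀ {n} (H : Adj n) → Symmetric H → ∀ {u v} → H u v ≡ true → #edges (addEdge H u v) ≡ #edges H
edges-addEdge-old H s {u} {v} e = #edges-cong {H = addEdge H u v} {H} λ x y → bool-ext (addEdge-⊆ {H = H} {H} s (λ _ _ h → h) e x y) (addEdge-⊇ H u v x y)

module FirstStep (M j : ℕ) (l : 2 + j < 2 + M) where
  n = 2 + M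
  H = first n (2 + j)
  sH = first-simple n (2 + j)
  z o k p : Fin n
  z = zero
  o = suc zero
  k = fromℕ< l
  p = fromℕ< (<⇒≤ l)
  toℕ-k : toℕ k ≡ 2 + j
  toℕ-k = toℕ-fromℕ< l
  toℕ-p : toℕ p ≡ 1 + j
  toℕ-p = toℕ-fromℕ< (<⇒≤ l)
  H₁ = addEdge H z k
  H₂ = addEdge H₁ o k
  H₃ = addEdge H₂ p k

  z≢k : z ≢ k
  z≢k e with trans (cong toℕ e) toℕ-k
  ... | ()
  o≢k : o ≢ k
  o≢k e with trans (cong toℕ e) toℕ-k
  ... | ()
  p≢k : p ≢ k
  p≢k e = 1+n≰n (≤-reflexive (sym (trans (sym toℕ-p) (trans (cong toℕ e) toℕ-k))))

  new : ∀ x → H x k ≡ false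
  new x = ≢true λ e → <-irrefl refl (subst (_< 2 + j) toℕ-k (proj₂ (proj₂ (first-elim x k e))))

  edges-2 : #edges H₂ ≡ 2 + #edges H
  edges-2 = trans (edges-addEdge H₁ (addEdge-symmetric {H = H} (proj₁ sH) z k) o≢k
      (trans (addEdge-off H {z} {k} {o} {k} λ { (inj₁ (() , _)) ; (inj₂ (q , _)) → o≢k q }) (new o)))
    (cong suc (edges-addEdge H (proj₁ sH) z≢k (new z)))

  s₂ : Symmetric H₂
  s₂ = addEdge-symmetric {H = H₁} (addEdge-symmetric {H = H} (proj₁ sH) z k) o k

  near-0 : Near 0 (toℕ k)
  near-0 = subst (Near 0) (sym toℕ-k) hub₀
  near-1 : Near 1 (toℕ k)
  near-1 = subst (Near 1) (sym toℕ-k) hub₁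
  near-p : ∀ j → Near (1 + j) (2 + j)
  near-p zero = hub₁
  near-p (suc j) = up

  k< : toℕ k < 3 + j
  k< = s≤s (≤-reflexive toℕ-k)

  enlarge : H₃ ⊆ first n (3 + j)
  enlarge = addEdge-⊆ {H = H₂} {first n (3 + j)} s (addEdge-⊆ {H = H₁} {first n (3 + j)} s (addEdge-⊆ {H = H} {first n (3 + j)} s old (first-intro z k near-0 (s≤s z≤n) k<)) (first-intro o k near-1 (s≤s (s≤s z≤n)) k<))
      (first-intro p k (subst (λ x → Near x (toℕ k)) (sym toℕ-p) (subst (Near (1 + j)) (sym toℕ-k) (near-p j))) (subst (_< 3 + j) (sym toℕ-p) (s≤s (n≤1+n (1 + j)))) k<)
    where
    s : Symmetric (first n (3 + j))
    s = proj₁ (first-simple n (3 + j))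
    old : H ⊆ first n (3 + j)
    old x y e with first-elim x y e
    ... | a , b , c = first-intro x y a (m≤n⇒m≤1+n b) (m≤n⇒m≤1+n c)

  attached : ∀ x → Near (2 + j) (toℕ x) → toℕ x < 3 + j → H₃ x k ≡ true
  attached x a b with earlier-neighbour a b
  ... | inj₁ q = subst (λ y → H₃ y k ≡ true) (toℕ-injective {i = z} (sym q)) (addEdge-⊇ H₂ p k z k (addEdge-⊇ H₁ o k z k (addEdge-new H z k)))
  ... | inj₂ (inj₁ q) = subst (λ y → H₃ y k ≡ true) (toℕ-injective {i = o} (sym q)) (addEdge-⊇ H₂ p k o k (addEdge-new H₁ o k))
  ... | inj₂ (inj₂ q) = subst (λ y → H₃ y k ≡ true) (toℕ-injective {i = p} (trans toℕ-p (sym q))) (addEdge-new H₂ p k)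

  shrink : first n (3 + j) ⊆ H₃
  shrink x y e with first-elim x y e
  ... | a , b , c with m≤n⇒m<n∨m≡n (≤-pred b) | m≤n⇒m<n∨m≡n (≤-pred c)
  ...   | inj₁ b' | inj₁ c' = addEdge-⊇ H₂ p k x y (addEdge-⊇ H₁ o k x y (addEdge-⊇ H z k x y (first-intro x y a b' c')))
  ...   | _ | inj₂ q = subst (λ w → H₃ x w ≡ true) (toℕ-injective (trans toℕ-k (sym q))) (attached x (Near-sym (subst (Near (toℕ x)) q a)) b)
  ...   | inj₂ q | inj₁ _ = trans (addEdge-symmetric {H = H₂} s₂ p k x y)
          (subst (λ w → H₃ y w ≡ true) (toℕ-injective (trans toℕ-k (sym q))) (attached y (subst (λ w → Near w (toℕ y)) q a) c))

  edges-step : #edges (first n (3 + j)) ≡ #edges H₃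
  edges-step = #edges-cong {H = first n (3 + j)} {H₃} λ x y → bool-ext (shrink x y) (enlarge x y)

  p-attached : j ≡ 0 → H₂ p k ≡ true
  p-attached q = subst (λ y → H₂ y k ≡ true) (toℕ-injective {i = o} (sym (trans toℕ-p (cong suc q)))) (addEdge-new H₁ o k)

  p-new : 1 ≤ j → H₂ p k ≡ false
  p-new 1≤j = trans (addEdge-off H₁ {o} {k} {p} {k} λ { (inj₁ (q , _)) → far q ; (inj₂ (q , _)) → p≢k q })
      (trans (addEdge-off H {z} {k} {p} {k} λ { (inj₁ (q , _)) → far' q ; (inj₂ (q , _)) → p≢k q }) (new p))
    where
    far : p ≢ o
    far q = 1+n≰n (≤-trans (s≤s 1≤j) (≤-reflexive (trans (sym toℕ-p) (cong toℕ q))))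
    far' : p ≢ z
    far' q with trans (sym toℕ-p) (cong toℕ q)
    ... | ()

edges-first-2 : ∀ M → #edges (first (2 + M) 2) ≡ 1
edges-first-2 M = trans (#edges-cong {H = first (2 + M) 2} {addEdge edgeless zero (suc zero)} same)
  (trans (edges-addEdge (edgeless {2 + M}) (λ _ _ → refl) {zero} {suc zero} (λ ()) refl) (cong suc (edgeless-edges (2 + M))))
  where
  same : ∀ x y → first (2 + M) 2 x y ≡ addEdge edgeless zero (suc zero) x y
  same zero zero = refl
  same zero (suc zero) = refl
  same zero (suc (suc _)) = refl
  same (suc zero) zero = refl
  same (suc zero) (suc zero) = refl
  same (suc zero) (suc (suc _)) = refl
  same (suc (suc x)) y = bool-ext (λ e → absurd (proj₁ (proj₂ (first-elim (suc (suc x)) y e)))) (λ e → case addEdge-elim edgeless {zero} {suc zero} {suc (suc x)} {y} e of λ { (inj₁ ()) ; (inj₂ (inj₁ (() , _))) ; (inj₂ (inj₂ (() , _))) })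
    where
    absurd : {P : Set} → 2 + toℕ x < 2 → P
    absurd (s≤s (s≤s ()))

edges-first : ∀ M j → 3 + j ≤ 2 + M → #edges (first (2 + M) (3 + j)) + 6 ≡ 3 * (3 + j)
edges-first M zero l = cong (_+ 6) (trans edges-step (trans (edges-addEdge-old H₂ s₂ (p-attached refl)) (trans edges-2 (cong (2 +_) (edges-first-2 M)))))
  where open FirstStep M zero l
edges-first M (suc j) l = trans (cong (_+ 6) (trans edges-step (trans (edges-addEdge H₂ s₂ p≢k (p-new (s≤s z≤n))) (cong suc edges-2))))
    (trans (cong (3 +_) (edges-first M j (<⇒≤ l))) (solve 1 (λ j → con 3 :+ con 3 :* (con 3 :+ j) := con 3 :* (con 4 :+ j)) refl j))
  where
  open FirstStep M (suc j) l
  open +-*-Solver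

edges-stacked : ∀ M → #edges (stacked (3 + M)) + 6 ≡ 3 * (3 + M)
edges-stacked M = trans (cong (_+ 6) (#edges-cong {H = stacked (3 + M)} {first (3 + M) (3 + M)} λ x y → bool-ext
    (λ e → first-intro x y (near⇒ (toℕ x) (toℕ y) e) (toℕ<n x) (toℕ<n y)) (λ e → proj₁ (∧-true e))))
  (edges-first (suc M) M ≤-refl)

stacked-maximal : ∀ M → MaximalPlanar (stacked (3 + M))
stacked-maximal M = stacked-simple (3 + M) , planar (edges-stacked M) , maximal
  where
  open StackedFaces (2 + M) (s≤s (s≤s z≤n))
  G = stacked (3 + M)
  maximal : ∀ u v → u ≢ v → G u v ≡ false → ¬ Planar (addEdge G u v)
  maximal u v u≢v e pl = too-many {#edges G} {#edges (addEdge G u v)} {#components (addEdge G u v)} {3 + M} (edges-addEdge G (proj₁ (stacked-simple (3 + M))) u≢v e) (edges-stacked M) (connected-components {H = addEdge G u v} (proj₁ s') conn' zero)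
      (edge-bound s' conn' pl (addEdge G u v) s' (λ _ _ h → h) enough)
    where
    s' : SimpleGraph (addEdge G u v)
    s' = addEdge-simple {H = G} (stacked-simple (3 + M)) u≢v
    conn' : Connected (addEdge G u v)
    conn' x y = reach-mono {H = G} (addEdge-⊇ G u v) (stacked-connected (2 + M) x y)
    too-many : ∀ {e e' c n} → e' ≡ suc e → e + 6 ≡ 3 * n → c ≡ 1 → e' + 3 + 3 * c ≤ 3 * n → ⊥
    too-many {e} refl h refl le = 1+n≰n (≤-trans (≤-reflexive (solve 1 (λ e → con 1 :+ (e :+ con 6) := con 1 :+ e :+ con 3 :+ con 3) refl e)) (≤-trans le (≤-reflexive (sym h))))
      where open +-*-Solver
    enough : 2 ≤ #edges (addEdge G u v)
    enough = subst (2 ≤_) (sym (edges-addEdge G (proj₁ (stacked-simple (3 + M))) u≢v e)) (s≤s (+-cancelʳ-≤ 6 1 _ (≤-trans (s≤s (s≤s (s≤s (s≤s (s≤s (s≤s (s≤s z≤n))))))) (≤-trans (*-monoʳ-≤ 3 (m≤m+n 3 M)) (≤-reflexive (sym (edges-stacked M)))))))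

innerColouring : ∀ n → ℕ → Colouring n
innerColouring n m u v = if (toℕ u <ᵇ m) ∧ (toℕ v <ᵇ m) then Sign.+ else Sign.-

inner-plus : ∀ n m u v → ⌊ innerColouring n m u v ≟ₛ Sign.+ ⌋ ≡ (toℕ u <ᵇ m) ∧ (toℕ v <ᵇ m)
inner-plus n m u v with (toℕ u <ᵇ m) ∧ (toℕ v <ᵇ m)
... | true = refl
... | false = refl

inner-symmetric : ∀ n m → SymColouring (innerColouring n m)
inner-symmetric n m u v = cong (λ b → if b then Sign.+ else Sign.-) (∧-comm (toℕ u <ᵇ m) (toℕ v <ᵇ m))

inner-eCount : ∀ n m → eCount (stacked n) (innerColouring n m) Sign.+ ≡ #edges (first n m)
inner-eCount n m = countPairs-cong {p = colourClass (stacked n) (innerColouring n m) Sign.+} {q = first n m} λ u v → cong (stacked n u v ∧_) (inner-plus n m u v)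

below : ∀ n → ℕ → Fin n → Bool
below n m v = toℕ v <ᵇ m

below-card : ∀ n m → card (vertices n) (below n m) ≤ m
below-card n m = subst (card (vertices n) (below n m) ≤_) (card-vertices m)
  (card-inject (vertices n) (vertices m) {below n m} {λ _ → true} (λ v w → toℕ v ≡ toℕ w)
    (λ e → fromℕ< (<ᵇ-true e) , refl , sym (toℕ-fromℕ< (<ᵇ-true e))) λ _ _ p q → toℕ-injective (trans p (sym q)))

supported-components : ∀ n' m → 1 ≤ m → (K : Adj (suc n')) → Symmetric K → (∀ u v → K u v ≡ true → toℕ u < m) → suc (suc n') ≤ #components K + m
supported-components n' m@(suc _) _ K s support = ≤-trans
    (s≤s (subst (_≤ m + card V above) (card-vertices n) (≤-trans (≤-reflexive (cnt-split (λ _ → true) (below n m) (allFin n))) (+-monoˡ-≤ (card V above) (below-card n m)))))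
    (≤-trans (≤-reflexive (trans (+-comm (suc m) (card V above)) (+-suc (card V above) m))) (+-monoˡ-≤ m at-least))
  where
  n = suc n'
  V = vertices n
  above q : Fin n → Bool
  above v = not (below n m v)
  q v = above v ∨ ⌊ v ≟ zero ⌋
  still : ∀ {x y} → above x ≡ true → Reach K x y → x ≡ y
  still a here = refl
  still {x} a (there {w = w} e _) = true≢false (<ᵇ-intro (support x w e)) (not-true a)
  independent : ∀ {x y} → q x ≡ true → q y ≡ true → Reach K x y → x ≡ y
  independent {x} {y} qx qy r with ∨-true {above x} qx | ∨-true {above y} qy
  ... | inj₁ a | _ = still a r
  ... | inj₂ _ | inj₁ b = sym (still b (reach-sym s r))
  ... | inj₂ e | inj₂ e' = trans (isYes⁻ (x ≟ zero) e) (sym (isYes⁻ (y ≟ zero) e'))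
  at-least : suc (card V above) ≤ #components K
  at-least = subst (_≤ #components K) (card-insert V above q zero refl refl λ x x≢0 → ∨-falseʳ {above x} (isNo⁺ (x ≟ zero) x≢0))
    (independent-≤ V (reach-equiv s) q independent (components-classes K s))

few-plus : ∀ n' m → 1 ≤ m → suc (2 * m) ≤ suc n' → ∀ {A} (T : Adj (suc n')) → SpanningTree A T →
  eCount T (innerColouring (suc n') m) Sign.+ + 2 ≤ eCount T (innerColouring (suc n') m) Sign.-
few-plus n' m 1≤m low T (sT , _ , conn , acyclic) = arith {p = #edges K}
    (forest-subgraph {H = T} {K} sT sK (colourClass-⊆ T f Sign.+) (acyclic⇒forest {T = T} sT acyclic)) (supported-components n' m 1≤m K (proj₁ sK) support)
    (eCount-total T f) (connected-components {H = T} (proj₁ sT) conn zero) (edges+components T sT)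
  where
  f = innerColouring (suc n') m
  K = colourClass T f Sign.+
  sK : SimpleGraph K
  sK = colourClass-simple {H = T} sT (inner-symmetric (suc n') m) Sign.+
  support : ∀ u v → K u v ≡ true → toℕ u < m
  support u v e = <ᵇ-true {toℕ u} (proj₁ (∧-true {toℕ u <ᵇ m} (trans (sym (inner-plus (suc n') m u v)) (proj₂ (∧-true {T u v} e)))))
  arith : ∀ {p q c t c'} → p + c ≤ suc n' → suc (suc n') ≤ c + m → t ≡ p + q → c' ≡ 1 → suc n' ≤ t + c' → p + 2 ≤ q
  arith {p} {q} {c} h₁ h₂ refl refl h₃ = linear (p + m + m + n' + 2) (+-mono-≤ (+-mono-≤ p<m p<m) (+-mono-≤ low h₃))
    (solve 3 (λ p m n → p :+ con 2 :+ (p :+ m :+ m :+ n :+ con 2) := con 1 :+ p :+ (con 1 :+ p) :+ (con 1 :+ con 2 :* m :+ (con 1 :+ n))) refl p m n')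
    (solve 4 (λ p q m n → m :+ m :+ (con 1 :+ n :+ (p :+ q :+ con 1)) := q :+ (p :+ m :+ m :+ n :+ con 2)) refl p q m n')
    where
    open +-*-Solver
    p<m : suc p ≤ m
    p<m = linear (suc n' + c) (+-mono-≤ h₁ h₂) (solve 3 (λ p c n → con 1 :+ p :+ (con 1 :+ n :+ c) := p :+ c :+ (con 2 :+ n)) refl p c n')
      (solve 3 (λ c m n → con 1 :+ n :+ (c :+ m) := m :+ (con 1 :+ n :+ c)) refl c m n')

sharp-for : ∀ N m → 3 ≤ m → 2 * m ≤ 2 + N → Σ (Adj (3 + N)) λ A → MaximalPlanar A × Σ (Colouring (3 + N)) λ f → SymColouring f
  × (eCount A f Sign.- ⊓ eCount A f Sign.+ ≡ 3 * m ∸ 6) × ((T : Adj (3 + N)) → SpanningTree A T → 1 < ∣ fSum f T ∣)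
sharp-for N m 3≤m low with m≤n⇒∃[o]m+o≡n 3≤m
... | j , refl = A , stacked-maximal N , f , inner-symmetric (3 + N) m , trans (m≥n⇒m⊓n≡n balance) exact , λ T tree →
      subst (1 <_) (sym (cong ∣_∣ (fSum-difference f T))) (⊖-large (eCount T f Sign.+) (eCount T f Sign.-) (few-plus (2 + N) m (s≤s z≤n) (s≤s low) T tree))
  where
  A = stacked (3 + N)
  f = innerColouring (3 + N) m
  m≤ : 3 + j ≤ 3 + N
  m≤ = m≤n⇒m≤1+n (≤-trans (m≤m+n m (m + 0)) low)
  plus : eCount A f Sign.+ + 6 ≡ 3 * m
  plus = trans (cong (_+ 6) (inner-eCount (3 + N) m)) (edges-first (suc N) j m≤)
  exact : eCount A f Sign.+ ≡ 3 * m ∸ 6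
  exact = trans (sym (m+n∸n≡m (eCount A f Sign.+) 6)) (cong (_∸ 6) plus)
  balance : eCount A f Sign.+ ≤ eCount A f Sign.-
  balance = arith plus (edges-stacked N) (eCount-total A f)
    where
    arith : ∀ {p q e} → p + 6 ≡ 3 * m → e + 6 ≡ 3 * (3 + N) → e ≡ p + q → p ≤ q
    arith {p} {q} h₁ h₂ refl = +-cancelˡ-≤ (p + 6) p q (≤-trans (m≤m+n (p + 6 + p) 6) (≤-trans (≤-reflexive (trans (+-assoc (p + 6) p 6) (cong₂ _+_ h₁ h₁)))
      (≤-trans (≤-reflexive (solve 1 (λ m → con 3 :* m :+ con 3 :* m := con 3 :* (con 2 :* m)) refl m)) (≤-trans (*-monoʳ-≤ 3 (m≤n⇒m≤1+n low))
        (≤-reflexive (trans (sym h₂) (solve 2 (λ p q → p :+ q :+ con 6 := p :+ con 6 :+ q) refl p q)))))))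
      where open +-*-Solver

sharpness : (n : ℕ) → 7 ≤ n → Σ (Adj n) λ A → MaximalPlanar A × Σ (Colouring n) λ f → SymColouring f
  × (eCount A f Sign.- ⊓ eCount A f Sign.+ ≡ 3 * ((n ∸ 1) / 2) ∸ 6) × ((T : Adj n) → SpanningTree A T → 1 < ∣ fSum f T ∣)
sharpness (suc zero) (s≤s ())
sharpness (suc (suc zero)) (s≤s (s≤s ()))
sharpness (suc (suc (suc N))) h = sharp-for N ((2 + N) / 2) (half-≥3 (≤-pred h)) (proj₁ (half-bounds (2 + N)))

theorem5p6 : ((n : ℕ) → 7 ≤ n → (A : Adj n) → MaximalPlanar A
    → (f : Colouring n) → SymColouring f
    → 3 * ((n ∸ 1) / 2) ∸ 5 ≤ eCount A f Sign.- ⊓ eCount A f Sign.+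
    → Σ (Adj n) λ T → SpanningTree A T × ∣ fSum f T ∣ ≤ 1)
    × ((n : ℕ) → 7 ≤ n → Σ (Adj n) λ A → MaximalPlanar A
    × Σ (Colouring n) λ f → SymColouring f
    × (eCount A f Sign.- ⊓ eCount A f Sign.+ ≡ 3 * ((n ∸ 1) / 2) ∸ 6)
    × ((T : Adj n) → SpanningTree A T → 1 < ∣ fSum f T ∣))
theorem5p6 = sufficiency , sharpness
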